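{- For every integer $s\ge 4$, every real $\eta>0$, and every integer $D\ge s-1$, there is an integer $g_{s,\eta,D}$ such that every graph $J$ satisfying $\Delta(J)\le D$, $d(J)>s-2+\eta$ and $g(J)\ge g_{s,\eta,D}$ contains an induced subdivision of $K_s$.
   Context: All graphs are finite and simple. $\Delta(J)$ is the maximum degree, $d(J)=2|E(J)|/|V(J)|$ the average degree, and $g(J)$ the girth (length of a shortest cycle; infinite if there is no cycle). A subdivision of $H$ is obtained by replacing each edge of $H$ by a path, these paths being internally vertex-disjoint; $J$ contains an induced subdivision of $H$ if some induced subgraph of $J$ is isomorphic to a subdivision of $H$. -}

module Defs where

open import Data.Nat as ℕ using (ℕ; zero; suc; _≤_)
open import Data.Integer using (+_)
open import Data.Rational using (ℚ; _/_)
open import Data.Bool using (Bool; true; false; if_then_else_; not; _∧_)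
open import Data.Fin using (Fin; toℕ)
open import Data.Fin.Properties using (_≟_; _<?_)
open import Data.List using (List; []; _∷_; _++_; [_]; allFin; map; length)
open import Data.Nat.ListAction using (sum)
open import Data.List.Membership.Propositional using (_∈_; _∉_)
open import Data.List.Relation.Unary.Unique.Propositional using (Unique)
open import Data.List.Relation.Unary.Linked using (Linked)
open import Data.Product using (Σ; ∃; _×_; _,_)
open import Data.Sum using (_⊎_)
open import Relation.Nullary using (¬_)
open import Relation.Nullary.Decidable using (⌊_⌋)
open import Relation.Binary.PropositionalEquality using (_≡_; _≢_)
open import Function.Definitions using (Injective)

record Graph : Set where
  field
    n      : ℕ
    adj    : Fin n → Fin n → Bool
    adj-sym : ∀ u v → adj u v ≡ adj v u
    irrefl : ∀ u → adj u u ≡ false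
open Graph public

V : Graph → Set
V J = Fin (n J)

Adj : (J : Graph) → V J → V J → Set
Adj J u v = adj J u v ≡ true

deg : (J : Graph) → V J → ℕ
deg J v = sum (map (λ u → if adj J v u then 1 else 0) (allFin (n J)))

MaxDegreeAtMost : Graph → ℕ → Set
MaxDegreeAtMost J D = ∀ v → deg J v ≤ D

numEdges : Graph → ℕ
numEdges J = sum (map (λ u → sum (map (λ v →
  if adj J u v ∧ ⌊ u <? v ⌋ then 1 else 0) (allFin (n J)))) (allFin (n J)))

avgDeg : Graph → ℚ
avgDeg J with n J
... | zero  = + 0 / 1
... | suc k = + (2 ℕ.* numEdges J) / suc k

IsCycle : (J : Graph) → V J → List (V J) → V J → Set
IsCycle J x mid y =
  1 ≤ length mid × Unique (x ∷ mid ++ [ y ]) ×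
  Linked (Adj J) (x ∷ mid ++ [ y ]) × Adj J y x

-- g(J) ≥ g : every cycle has length at least g (vacuous if J is acyclic,
-- matching g(J) = ∞).
GirthAtLeast : Graph → ℕ → Set
GirthAtLeast J g = ∀ x mid y → IsCycle J x mid y → g ≤ suc (suc (length mid))

K : ℕ → Graph
K s = record
  { n = s
  ; adj = λ u v → not ⌊ u ≟ v ⌋
  ; adj-sym = symK
  ; irrefl = irrK }
  where
  open import Relation.Binary.PropositionalEquality using (refl) renaming (sym to ≡-sym)
  open import Relation.Nullary using (yes; no)
  symK : ∀ (u v : Fin s) → not ⌊ u ≟ v ⌋ ≡ not ⌊ v ≟ u ⌋
  symK u v with u ≟ v | v ≟ u
  ... | yes _ | yes _ = refl
  ... | no _  | no _  = refl
  ... | yes p | no q  = Data.Empty.⊥-elim (q (≡-sym p))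
    where import Data.Empty
  ... | no p  | yes q = Data.Empty.⊥-elim (p (≡-sym q))
    where import Data.Empty
  irrK : ∀ (u : Fin s) → not ⌊ u ≟ u ⌋ ≡ false
  irrK u with u ≟ u
  ... | yes _ = refl
  ... | no p  = Data.Empty.⊥-elim (p refl)
    where import Data.Empty

Consecutive : {A : Set} → A → A → List A → Set
Consecutive {A} x y xs = Σ (List A) λ as → Σ (List A) λ bs → xs ≡ as ++ x ∷ y ∷ bs

IsEdge : (H : Graph) → V H → V H → Set
IsEdge H u v = (toℕ u ℕ.< toℕ v) × Adj H u v

-- S is a subdivision of H, witnessed by branch vertices b and, for each
-- edge uv (u < v) of H, the list P u v of interior vertices of the path
-- replacing uv, whose full vertex sequence is  b u ∷ P u v ++ [ b v ].
record SubdivisionData (H S : Graph) : Set where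
  field
    b : V H → V S
    P : V H → V H → List (V S)
    b-inj : Injective _≡_ _≡_ b
    path-unique : ∀ u v → IsEdge H u v → Unique (b u ∷ P u v ++ [ b v ])
    interior-not-branch : ∀ u v → IsEdge H u v → ∀ w → b w ∉ P u v
    disjoint : ∀ u v u' v' → IsEdge H u v → IsEdge H u' v' →
               (u ≢ u' ⊎ v ≢ v') → ∀ x → x ∈ P u v → x ∉ P u' v'
    covers : ∀ x → (Σ (V H) λ w → b w ≡ x) ⊎
                   (Σ (V H) λ u → Σ (V H) λ v → IsEdge H u v × x ∈ P u v)
    edges→ : ∀ x y → Adj S x y →
             Σ (V H) λ u → Σ (V H) λ v → IsEdge H u v ×
               (Consecutive x y (b u ∷ P u v ++ [ b v ]) ⊎
                Consecutive y x (b u ∷ P u v ++ [ b v ]))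
    edges← : ∀ x y u v → IsEdge H u v →
             Consecutive x y (b u ∷ P u v ++ [ b v ]) → Adj S x y

IsSubdivisionOf : Graph → Graph → Set
IsSubdivisionOf S H = SubdivisionData H S

HasInducedCopy : (J H : Graph) → Set
HasInducedCopy J H = Σ (V H → V J) λ f →
  Injective _≡_ _≡_ f × (∀ u v → adj H u v ≡ adj J (f u) (f v))

ContainsInducedSubdivision : Graph → Graph → Set
ContainsInducedSubdivision J H =
  Σ Graph λ S → IsSubdivisionOf S H × HasInducedCopy J S

{-# OPTIONS --safe #-}
module Submission where

-- The graph is replaced by an induced subgraph A of minimum order whose density exceeds a
-- threshold that increases slightly with the order.  Minimality makes A expand: a set S of at
-- most about half the vertices has |N[S]| ≥ |S| (1 + 1/O(log² |S|)), and even
-- |N[S]| ≥ (1 + ε) |S| as long as |N[S]| is below the girth.  Since A has bounded degree, it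
-- contains s vertices of degree at least s − 1 that are pairwise far apart.  They are joined
-- in pairs, one pair after the other, by geodesics of polylogarithmic length in what is left
-- of A after deleting the closed neighbourhoods of the interiors of the earlier paths and
-- balls around the other branch vertices; this makes the union of the paths induced.
-- Such a geodesic exists because the balls around both of its ends come to contain more than
-- half of A.  Near a branch vertex x only the earlier paths ending at x are in the way, and as
-- these were geodesics, the ball of radius r around x meets only their first r + O(1) vertices
-- and neighbours of these; and further out the ball is too large for the deleted set to matter.

open import Defs
open import Data.Nat using (ℕ; zero; suc; _+_; _*_; _∸_; _^_; _≤_; _<_; z≤n; s≤s; _≤?_; _<?_; NonZero; _⊔_)
import Data.Nat as ℕ
open import Data.Nat.Properties
open import Data.Nat.DivMod using (m/n*n≤m; m≡m%n+[m/n]*n; m%n<n; /-monoˡ-≤; m*n/n≡m)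
open import Data.Nat.ListAction using () renaming (sum to sumᴸ)
open import Data.Nat.Logarithm using (⌊log₂_⌋; ⌊log₂⌋-mono-≤; ⌊log₂[2*b]⌋≡1+⌊log₂b⌋; ⌊log₂[2^n]⌋≡n)
open import Data.Nat.Coprimality using (Coprime)
open import Data.Nat.Tactic.RingSolver using (solve-∀)
import Data.Integer as ℤ
import Data.Integer.Properties as ℤ
open import Data.Rational as ℚ using (ℚ; mkℚ; 0ℚ; *<*)
import Data.Rational.Properties as ℚ
open import Data.Rational.Unnormalised as ℚᵘ using (mkℚᵘ)
import Data.Rational.Unnormalised.Properties as ℚᵘ
open import Data.Bool using (Bool; true; false; if_then_else_; not; _∧_)
import Data.Bool.Properties as Bool
open import Data.Fin as Fin using (Fin; zero; suc; toℕ)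
import Data.Fin.Properties as Fin
open import Data.Fin.Subset.Properties using (anySubset?)
open import Data.Vec using () renaming (lookup to lookupⱽ; tabulate to tabulateⱽ)
import Data.Vec.Properties as Vec
open import Data.List using (List; []; _∷_; _++_; [_]; allFin; map; length; lookup; filter; cartesianProduct; applyUpTo; tabulate)
import Data.List.Properties as List
open import Data.List.Membership.Propositional using (_∈_; _∉_)
import Data.List.Membership.Propositional.Properties as List∈
open import Data.List.Membership.DecPropositional using () renaming (_∈?_ to mem?)
open import Data.List.Relation.Unary.Any using (here; there; index)
open import Data.List.Relation.Unary.Any.Properties using (lookup-index)
open import Data.List.Relation.Unary.All as All using (All; []; _∷_)
import Data.List.Relation.Unary.All.Properties as All
open import Data.List.Relation.Unary.AllPairs using ([]; _∷_)
open import Data.List.Relation.Unary.Unique.Propositional using (Unique)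
import Data.List.Relation.Unary.Unique.Propositional.Properties as Unique
open import Data.List.Relation.Unary.Linked using (Linked; [-]; _∷_)
import Data.List.Relation.Unary.Linked.Properties as Linked
open import Data.Product using (Σ; ∃; _×_; _,_; proj₁; proj₂)
import Data.Sum as Sum
open import Data.Sum using (_⊎_; inj₁; inj₂; [_,_]′)
open import Data.Unit using (⊤; tt)
open import Data.Empty using (⊥-elim)
open import Function using (_∘_; id; const)
open import Function.Definitions using (Injective)
open import Relation.Nullary using (¬_; Dec; yes; no; does; _×-dec_; _⊎-dec_; _→-dec_; ¬?)
open import Relation.Nullary.Decidable using (dec-true; ⌊_⌋)
open import Relation.Unary using (Decidable)
open import Relation.Binary.Definitions using (tri<; tri≈; tri>)
open import Relation.Binary.PropositionalEquality
  using (_≡_; _≢_; refl; sym; trans; cong; cong₂; subst; subst₂; _≗_)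
open import Algebra.Properties.Semiring.Sum +-*-semiring
  using (sum; sum-cong-≗; ∑-distrib-+; ∑-comm; *-distribˡ-sum)

-- Finite sets as Boolean predicates

-- The girth bound may depend only on s, η and D, yet the routes have length polylogarithmic in the
-- order n of the core. So the loss near a branch vertex must be bounded independently of n until
-- its ball is large enough to ignore all routes. This dictates a hierarchy of scales. A parameter k
-- is chosen with log n between two consecutive values of a polynomial in k; then the routes
-- together have size polynomial in k and are negligible beyond 2^k, the guarded balls are
-- negligible beyond 2^(poly k), and branch vertices can still be spread so far apart that no
-- guarded ball is met earlier. An expansion of 1/log² tolerates losses only from some constant size
-- on. Below that size nothing may be lost, and the girth takes over: forbidden vertices occur only
-- along legs already used, and degree s - 1 leaves one leg free. Expansion comes from comparing a
-- set and its closed neighbourhood with thresholds that differ by 1/k - 1/(k+1), where k is of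
-- order log. With q₂ twice the denominator of η, the thresholds tend to s - 2 + 2/q₂ and never fall
-- below s - 2 + 1/q₂.

Sub : ℕ → Set
Sub n = Fin n → Bool

infix 4 _∈ˢ_ _∉ˢ_ _⊆ˢ_ _∈ˢ?_

_∈ˢ_ : ∀ {n} → Fin n → Sub n → Set
v ∈ˢ X = X v ≡ true

_∉ˢ_ : ∀ {n} → Fin n → Sub n → Set
v ∉ˢ X = ¬ v ∈ˢ X

_⊆ˢ_ : ∀ {n} → Sub n → Sub n → Set
X ⊆ˢ Y = ∀ {v} → v ∈ˢ X → v ∈ˢ Y

_∈ˢ?_ : ∀ {n} (v : Fin n) (X : Sub n) → Dec (v ∈ˢ X)
v ∈ˢ? X = X v Bool.≟ true

does⁻ : ∀ {A : Set} (a? : Dec A) → does a? ≡ true → A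
does⁻ (yes a) _ = a

⟪_⟫ : ∀ {n} {P : Fin n → Set} → Decidable P → Sub n
⟪ P? ⟫ v = does (P? v)

∈⟪⟫⁻ : ∀ {n} {P : Fin n → Set} (P? : Decidable P) {v} → v ∈ˢ ⟪ P? ⟫ → P v
∈⟪⟫⁻ P? {v} = does⁻ (P? v)

∈⟪⟫⁺ : ∀ {n} {P : Fin n → Set} (P? : Decidable P) {v} → P v → v ∈ˢ ⟪ P? ⟫
∈⟪⟫⁺ P? {v} = dec-true (P? v)

𝟙 : Bool → ℕ
𝟙 b = if b then 1 else 0

𝟙≤1 : ∀ b → 𝟙 b ≤ 1
𝟙≤1 true  = ≤-refl
𝟙≤1 false = z≤n

𝟙-true : ∀ {b} → b ≡ true → 𝟙 b ≡ 1
𝟙-true refl = refl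

𝟙-split : ∀ {a b c} → (a ≡ true → b ≡ true ⊎ c ≡ true) → 𝟙 a ≤ 𝟙 b + 𝟙 c
𝟙-split {false} f = z≤n
𝟙-split {true} {b} {c} f with f refl
... | inj₁ refl = s≤s z≤n
... | inj₂ refl = m≤n+m 1 (𝟙 b)

𝟙-disjoint : ∀ {a b c} → (b ≡ true → a ≡ true) → (c ≡ true → a ≡ true) →
             ¬ (b ≡ true × c ≡ true) → 𝟙 b + 𝟙 c ≤ 𝟙 a
𝟙-disjoint {a} {true}  {true}  f g h = ⊥-elim (h (refl , refl))
𝟙-disjoint {a} {true}  {false} f g h = ≤-reflexive (sym (𝟙-true (f refl)))
𝟙-disjoint {a} {false} {true}  f g h = ≤-reflexive (sym (𝟙-true (g refl)))
𝟙-disjoint {a} {false} {false} f g h = z≤n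

sum-mono : ∀ {n} {f g : Fin n → ℕ} → (∀ i → f i ≤ g i) → sum f ≤ sum g
sum-mono {zero}  h = z≤n
sum-mono {suc n} h = +-mono-≤ (h zero) (sum-mono (h ∘ suc))

term≤sum : ∀ {n} (f : Fin n → ℕ) i → f i ≤ sum f
term≤sum f zero    = m≤m+n _ _
term≤sum f (suc i) = ≤-trans (term≤sum (f ∘ suc) i) (m≤n+m _ (f zero))

sum-const : ∀ n c → sum {n} (const c) ≡ n * c
sum-const zero    c = refl
sum-const (suc n) c = cong (c +_) (sum-const n c)

sum-+ : ∀ {n} (f g : Fin n → ℕ) → sum (λ i → f i + g i) ≡ sum f + sum g
sum-+ = ∑-distrib-+

sum-*ˡ : ∀ {n} c (f : Fin n → ℕ) → sum (λ i → c * f i) ≡ c * sum f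
sum-*ˡ c f = sym (*-distribˡ-sum c f)

sum-swap : ∀ {m n} (f : Fin m → Fin n → ℕ) →
           sum (λ i → sum (f i)) ≡ sum (λ j → sum (λ i → f i j))
sum-swap = ∑-comm

opaque
  card : ∀ {n} → Sub n → ℕ
  card X = sum (λ v → 𝟙 (X v))

  card-cong : ∀ {n} {X Y : Sub n} → X ≗ Y → card X ≡ card Y
  card-cong h = sum-cong-≗ (λ i → cong 𝟙 (h i))

  card-∪ : ∀ {n} {X Y Z : Sub n} → (∀ {v} → v ∈ˢ X → v ∈ˢ Y ⊎ v ∈ˢ Z) → card X ≤ card Y + card Z
  card-∪ {X = X} {Y} {Z} h =
    ≤-trans (sum-mono (λ v → 𝟙-split {X v} {Y v} {Z v} h)) (≤-reflexive (sum-+ (𝟙 ∘ Y) (𝟙 ∘ Z)))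

  card-⊎ : ∀ {n} {X Y Z : Sub n} → Y ⊆ˢ X → Z ⊆ˢ X → (∀ {v} → v ∈ˢ Y → v ∉ˢ Z) →
           card Y + card Z ≤ card X
  card-⊎ {X = X} {Y} {Z} f g h = ≤-trans (≤-reflexive (sym (sum-+ (𝟙 ∘ Y) (𝟙 ∘ Z))))
    (sum-mono (λ v → 𝟙-disjoint {X v} {Y v} {Z v} f g (λ (a , b) → h a b)))

∅ˢ : ∀ {n} → Sub n
∅ˢ _ = false

opaque
  unfolding card

  card-∅ : ∀ {n} → card {n} ∅ˢ ≡ 0
  card-∅ {n} = trans (sum-const n 0) (*-zeroʳ n)

card-⊆ : ∀ {n} {X Y : Sub n} → X ⊆ˢ Y → card X ≤ card Y
card-⊆ {X = X} {Y} h = ≤-trans (card-∪ {Z = ∅ˢ} (inj₁ ∘ h))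
  (≤-reflexive (trans (cong (card Y +_) card-∅) (+-identityʳ _)))

full : ∀ {n} → Sub n
full _ = true

opaque
  unfolding card

  card-full : ∀ {n} → card {n} full ≡ n
  card-full {n} = trans (sum-const n 1) (*-identityʳ n)

opaque
  unfolding card

  ∈⇒card>0 : ∀ {n} {X : Sub n} {v} → v ∈ˢ X → 0 < card X
  ∈⇒card>0 {X = X} {v} h = ≤-trans (≤-reflexive (sym (𝟙-true h))) (term≤sum (𝟙 ∘ X) v)

card-⊈ : ∀ {n} {X Y : Sub n} → card Y < card X → ∃ λ v → v ∈ˢ X × v ∉ˢ Y
card-⊈ {X = X} {Y} h with Fin.any? (λ v → (v ∈ˢ? X) ×-dec ¬? (v ∈ˢ? Y))
... | yes p = p
... | no ¬p = ⊥-elim (<⇒≱ h (card-⊆ λ {v} v∈X → sub v v∈X))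
  where
  sub : ∀ v → v ∈ˢ X → v ∈ˢ Y
  sub v v∈X with v ∈ˢ? Y
  ... | yes p = p
  ... | no q = ⊥-elim (¬p (v , v∈X , q))

card>0⇒∃ : ∀ {n} {X : Sub n} → 0 < card X → ∃ λ v → v ∈ˢ X
card>0⇒∃ {X = X} h with card-⊈ {X = X} {∅ˢ} (≤-trans (s≤s (≤-reflexive card-∅)) h)
... | v , p , _ = v , p

⁅_⁆ˢ : ∀ {n} → Fin n → Sub n
⁅ x ⁆ˢ v = does (v Fin.≟ x)

x∈⁅x⁆ˢ : ∀ {n} (x : Fin n) → x ∈ˢ ⁅ x ⁆ˢ
x∈⁅x⁆ˢ x = dec-true (x Fin.≟ x) refl

∈⁅⁆ˢ⁻ : ∀ {n} {x v : Fin n} → v ∈ˢ ⁅ x ⁆ˢ → v ≡ x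
∈⁅⁆ˢ⁻ {x = x} {v} = does⁻ (v Fin.≟ x)

opaque
  unfolding card

  card-⁅⁆ : ∀ {n} (x : Fin n) → card ⁅ x ⁆ˢ ≡ 1
  card-⁅⁆ {suc n} zero    = cong suc (card-∅ {n})
  card-⁅⁆ {suc n} (suc x) = trans (sum-cong-≗ {n} (λ i → cong 𝟙 (lem i))) (card-⁅⁆ x)
    where
    lem : ∀ i → ⁅ suc x ⁆ˢ (suc i) ≡ ⁅ x ⁆ˢ i
    lem i with i Fin.≟ x
    ... | yes _ = refl
    ... | no  _ = refl

infixl 7 _∩ˢ_
infixl 6 _∪ˢ_ _∖ˢ_

opaque
  _∩ˢ_ _∪ˢ_ _∖ˢ_ : ∀ {n} → Sub n → Sub n → Sub n
  X ∩ˢ Y = ⟪ (λ v → (v ∈ˢ? X) ×-dec (v ∈ˢ? Y)) ⟫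
  X ∪ˢ Y = ⟪ (λ v → (v ∈ˢ? X) ⊎-dec (v ∈ˢ? Y)) ⟫
  X ∖ˢ Y = ⟪ (λ v → (v ∈ˢ? X) ×-dec ¬? (v ∈ˢ? Y)) ⟫

module _ {n} {X Y : Sub n} where
  opaque
    unfolding _∩ˢ_

    ∈∩⁻ : ∀ {v} → v ∈ˢ X ∩ˢ Y → v ∈ˢ X × v ∈ˢ Y
    ∈∩⁻ {v} = does⁻ ((v ∈ˢ? X) ×-dec (v ∈ˢ? Y))

    ∈∩⁺ : ∀ {v} → v ∈ˢ X → v ∈ˢ Y → v ∈ˢ X ∩ˢ Y
    ∈∩⁺ {v} p q = dec-true ((v ∈ˢ? X) ×-dec (v ∈ˢ? Y)) (p , q)

    ∈∪⁻ : ∀ {v} → v ∈ˢ X ∪ˢ Y → v ∈ˢ X ⊎ v ∈ˢ Y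
    ∈∪⁻ {v} = does⁻ ((v ∈ˢ? X) ⊎-dec (v ∈ˢ? Y))

    ∈∪⁺ : ∀ {v} → v ∈ˢ X ⊎ v ∈ˢ Y → v ∈ˢ X ∪ˢ Y
    ∈∪⁺ {v} = dec-true ((v ∈ˢ? X) ⊎-dec (v ∈ˢ? Y))

    ∈∖⁻ : ∀ {v} → v ∈ˢ X ∖ˢ Y → v ∈ˢ X × v ∉ˢ Y
    ∈∖⁻ {v} = does⁻ ((v ∈ˢ? X) ×-dec ¬? (v ∈ˢ? Y))

    ∈∖⁺ : ∀ {v} → v ∈ˢ X → v ∉ˢ Y → v ∈ˢ X ∖ˢ Y
    ∈∖⁺ {v} p q = dec-true ((v ∈ˢ? X) ×-dec ¬? (v ∈ˢ? Y)) (p , q)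

opaque
  unfolding card

  card-⋃ : ∀ {m n} {X : Sub n} (R : Fin m → Sub n) →
           (∀ {v} → v ∈ˢ X → ∃ λ i → v ∈ˢ R i) → card X ≤ sum (λ i → card (R i))
  card-⋃ {X = X} R h = ≤-trans (sum-mono pt) (≤-reflexive (sum-swap (λ v i → 𝟙 (R i v))))
    where
    pt : ∀ v → 𝟙 (X v) ≤ sum (λ i → 𝟙 (R i v))
    pt v with v ∈ˢ? X
    ... | no q = ≤-trans (≤-reflexive (cong 𝟙 (Bool.¬-not q))) z≤n
    ... | yes p with h p
    ... | i , r = ≤-trans (𝟙≤1 (X v)) (≤-trans (≤-reflexive (sym (𝟙-true r))) (term≤sum (λ i → 𝟙 (R i v)) i))

card-⋃-const : ∀ {m n b} {X : Sub n} (R : Fin m → Sub n) → (∀ i → card (R i) ≤ b) →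
         (∀ {v} → v ∈ˢ X → ∃ λ i → v ∈ˢ R i) → card X ≤ m * b
card-⋃-const {m} R hb h = ≤-trans (card-⋃ R h) (≤-trans (sum-mono hb) (≤-reflexive (sum-const m _)))

majorities-meet : ∀ {n} {A X Y : Sub n} → X ⊆ˢ A → Y ⊆ˢ A →
  card A < 2 * card X → card A < 2 * card Y → ∃ λ v → v ∈ˢ X × v ∈ˢ Y
majorities-meet {A = A} {X} {Y} X⊆A Y⊆A hX hY with Fin.any? (λ v → (v ∈ˢ? X) ×-dec (v ∈ˢ? Y))
... | yes p = p
... | no ¬p = ⊥-elim (<⇒≱ (+-mono-< hX hY) (begin
    2 * card X + 2 * card Y   ≡⟨ *-distribˡ-+ 2 (card X) (card Y) ⟨
    2 * (card X + card Y)     ≤⟨ *-monoʳ-≤ 2 (card-⊎ X⊆A Y⊆A (λ p q → ¬p (_ , p , q))) ⟩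
    2 * card A                ≡⟨ cong (card A +_) (+-identityʳ _) ⟩
    card A + card A           ∎))
  where open ≤-Reasoning

sumᴸ-allFin : ∀ {n} (f : Fin n → ℕ) → sumᴸ (map f (allFin n)) ≡ sum f
sumᴸ-allFin {n} f = trans (cong sumᴸ (List.map-tabulate id f)) (go f)
  where
  go : ∀ {m} (f : Fin m → ℕ) → sumᴸ (tabulate f) ≡ sum f
  go {zero}  f = refl
  go {suc m} f = cong (f zero +_) (go (f ∘ suc))

unique-length≤card : ∀ {n} {X : Sub n} (xs : List (Fin n)) → Unique xs → (∀ {v} → v ∈ xs → v ∈ˢ X) →
                     length xs ≤ card X
unique-length≤card [] _ _ = z≤n
unique-length≤card {X = X} (x ∷ xs) (x∉ ∷ u) h = ≤-trans (+-mono-≤ (≤-reflexive (sym (card-⁅⁆ x)))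
  (unique-length≤card {X = X ∖ˢ ⁅ x ⁆ˢ} xs u (λ v∈xs → ∈∖⁺ (h (there v∈xs)) (λ e →
     All.All¬⇒¬Any x∉ (subst (_∈ xs) (∈⁅⁆ˢ⁻ e) v∈xs)))))
  (card-⊎ (λ v∈ → subst (_∈ˢ X) (sym (∈⁅⁆ˢ⁻ v∈)) (h (here refl))) (proj₁ ∘ ∈∖⁻) (λ p q → proj₂ (∈∖⁻ q) p))

card-remove : ∀ {n} {X : Sub n} {x} → x ∈ˢ X → card X ≡ suc (card (X ∖ˢ ⁅ x ⁆ˢ))
card-remove {X = X} {x} x∈X = ≤-antisym
  (≤-trans (card-∪ {Y = ⁅ x ⁆ˢ} {X ∖ˢ ⁅ x ⁆ˢ} split) (≤-reflexive (cong (_+ card (X ∖ˢ ⁅ x ⁆ˢ)) (card-⁅⁆ x))))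
  (≤-trans (≤-reflexive (cong (_+ card (X ∖ˢ ⁅ x ⁆ˢ)) (sym (card-⁅⁆ x))))
    (card-⊎ (λ v∈ → subst (_∈ˢ X) (sym (∈⁅⁆ˢ⁻ v∈)) x∈X) (proj₁ ∘ ∈∖⁻) (λ p q → proj₂ (∈∖⁻ q) p)))
  where
  split : ∀ {v} → v ∈ˢ X → v ∈ˢ ⁅ x ⁆ˢ ⊎ v ∈ˢ X ∖ˢ ⁅ x ⁆ˢ
  split {v} v∈ with v ∈ˢ? ⁅ x ⁆ˢ
  ... | yes p = inj₁ p
  ... | no q = inj₂ (∈∖⁺ v∈ q)

-- Induced subgraphs given by vertex sets: edges, balls, geodesics, cycles

module Graphs (J : Graph) where

  S : Set
  S = Sub (n J)

  Near : V J → V J → Set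
  Near u v = u ≡ v ⊎ Adj J u v

  adj? : ∀ u v → Dec (Adj J u v)
  adj? u v = adj J u v Bool.≟ true

  near? : ∀ u v → Dec (Near u v)
  near? u v = (u Fin.≟ v) ⊎-dec adj? u v

  adj-symm : ∀ {u v} → Adj J u v → Adj J v u
  adj-symm {u} {v} h = trans (adj-sym J v u) h

  near-symm : ∀ {u v} → Near u v → Near v u
  near-symm (inj₁ e) = inj₁ (sym e)
  near-symm (inj₂ e) = inj₂ (adj-symm e)

  adj⇒≢ : ∀ {u v} → Adj J u v → u ≢ v
  adj⇒≢ {u} h refl with trans (sym h) (irrefl J u)
  ... | ()

  opaque
    nbrs : S → V J → S
    nbrs X u = ⟪ (λ v → (u ∈ˢ? X) ×-dec ((v ∈ˢ? X) ×-dec adj? u v)) ⟫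

    nbrs⁻ : ∀ {X u v} → v ∈ˢ nbrs X u → u ∈ˢ X × v ∈ˢ X × Adj J u v
    nbrs⁻ {X} {u} {v} = does⁻ ((u ∈ˢ? X) ×-dec ((v ∈ˢ? X) ×-dec adj? u v))

    nbrs⁺ : ∀ {X u v} → u ∈ˢ X → v ∈ˢ X → Adj J u v → v ∈ˢ nbrs X u
    nbrs⁺ {X} {u} {v} a b c = dec-true ((u ∈ˢ? X) ×-dec ((v ∈ˢ? X) ×-dec adj? u v)) (a , b , c)

  -- Each edge inside `X` is counted from both ends, so `e2 X / card X` is the average degree of the
  -- subgraph induced on `X`.
  e2 : S → ℕ
  e2 X = sum (λ u → card (nbrs X u))

  e2-cover : ∀ {X Y Z : S} → (∀ {u v} → u ∈ˢ X → v ∈ˢ X → Adj J u v → (u ∈ˢ Y × v ∈ˢ Y) ⊎ (u ∈ˢ Z × v ∈ˢ Z)) →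
             e2 X ≤ e2 Y + e2 Z
  e2-cover {X} {Y} {Z} h = ≤-trans
    (sum-mono (λ u → card-∪ {X = nbrs X u} {nbrs Y u} {nbrs Z u} (λ v∈ → pt (nbrs⁻ {X} v∈))))
    (≤-reflexive (sum-+ (λ u → card (nbrs Y u)) (λ u → card (nbrs Z u))))
    where
    pt : ∀ {u v} → u ∈ˢ X × v ∈ˢ X × Adj J u v → v ∈ˢ nbrs Y u ⊎ v ∈ˢ nbrs Z u
    pt (a , b , c) with h a b c
    ... | inj₁ (p , q) = inj₁ (nbrs⁺ {Y} p q c)
    ... | inj₂ (p , q) = inj₂ (nbrs⁺ {Z} p q c)

  e2-empty : ∀ {X : S} → card X ≡ 0 → e2 X ≡ 0
  e2-empty {X} h = ≤-antisym (≤-trans (sum-mono {g = const 0} pt) (≤-reflexive (trans (sum-const (n J) 0) (*-zeroʳ (n J))))) z≤n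
    where
    pt : ∀ u → card (nbrs X u) ≤ 0
    pt u = ≤-trans (card-⊆ (proj₁ ∘ proj₂ ∘ nbrs⁻ {X})) (≤-reflexive h)

  e2-pair : ∀ x y → e2 (⁅ x ⁆ˢ ∪ˢ ⁅ y ⁆ˢ) ≤ 2
  e2-pair x y = begin
    sum (λ u → card (nbrs Z u))                ≤⟨ sum-mono pt ⟩
    sum (λ u → 𝟙 (⁅ x ⁆ˢ u) + 𝟙 (⁅ y ⁆ˢ u))    ≡⟨ sum-+ (𝟙 ∘ ⁅ x ⁆ˢ) (𝟙 ∘ ⁅ y ⁆ˢ) ⟩
    sum (𝟙 ∘ ⁅ x ⁆ˢ) + sum (𝟙 ∘ ⁅ y ⁆ˢ)        ≡⟨ cong₂ _+_ (one x) (one y) ⟩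
    2                                          ∎
    where
    open ≤-Reasoning
    Z = ⁅ x ⁆ˢ ∪ˢ ⁅ y ⁆ˢ
    opaque
      unfolding card
      one : ∀ (z : V J) → sum (𝟙 ∘ ⁅ z ⁆ˢ) ≡ 1
      one z = card-⁅⁆ z
    other : ∀ {u v} → u ≡ x → v ∈ˢ nbrs Z u → v ∈ˢ ⁅ y ⁆ˢ
    other {v = v} refl v∈ with nbrs⁻ {Z} {v = v} v∈
    ... | _ , v∈Z , a with ∈∪⁻ v∈Z
    ... | inj₁ p = ⊥-elim (adj⇒≢ a (sym (∈⁅⁆ˢ⁻ p)))
    ... | inj₂ p = p
    other′ : ∀ {u v} → u ≡ y → v ∈ˢ nbrs Z u → v ∈ˢ ⁅ x ⁆ˢ
    other′ {v = v} refl v∈ with nbrs⁻ {Z} {v = v} v∈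
    ... | _ , v∈Z , a with ∈∪⁻ v∈Z
    ... | inj₁ p = p
    ... | inj₂ p = ⊥-elim (adj⇒≢ a (sym (∈⁅⁆ˢ⁻ p)))
    pt : ∀ u → card (nbrs Z u) ≤ 𝟙 (⁅ x ⁆ˢ u) + 𝟙 (⁅ y ⁆ˢ u)
    pt u with u Fin.≟ x | u Fin.≟ y
    ... | yes p | _     = ≤-trans (≤-trans (card-⊆ (other p)) (≤-reflexive (card-⁅⁆ y))) (s≤s z≤n)
    ... | no _  | yes p = ≤-trans (card-⊆ (other′ p)) (≤-reflexive (card-⁅⁆ x))
    ... | no p  | no q  = ≤-trans (card-⊆ {Y = ∅ˢ} no-nbr) (≤-reflexive card-∅)
      where
      no-nbr : nbrs Z u ⊆ˢ ∅ˢ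
      no-nbr {v} v∈ with ∈∪⁻ (proj₁ (nbrs⁻ {Z} {v = v} v∈))
      ... | inj₁ r = ⊥-elim (p (∈⁅⁆ˢ⁻ r))
      ... | inj₂ r = ⊥-elim (q (∈⁅⁆ˢ⁻ r))

  -- Closed neighbourhoods and balls

  opaque
    N[_] : S → S
    N[ X ] = ⟪ (λ v → Fin.any? (λ u → (u ∈ˢ? X) ×-dec near? u v)) ⟫

    ∈N⁻ : ∀ {X v} → v ∈ˢ N[ X ] → ∃ λ u → u ∈ˢ X × Near u v
    ∈N⁻ {X} {v} = does⁻ (Fin.any? (λ u → (u ∈ˢ? X) ×-dec near? u v))

    ∈N⁺ : ∀ {X u v} → u ∈ˢ X → Near u v → v ∈ˢ N[ X ]
    ∈N⁺ {X} {u} {v} p q = dec-true (Fin.any? (λ u → (u ∈ˢ? X) ×-dec near? u v)) (u , p , q)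

  X⊆N : ∀ {X} → X ⊆ˢ N[ X ]
  X⊆N p = ∈N⁺ p (inj₁ refl)

  opaque
    -- Distance is measured inside the subgraph induced on `H`, so deleting vertices means shrinking
    -- `H`. The ball is empty when `x` lies outside `H`.
    ball : S → V J → ℕ → S
    ball H x zero    = H ∩ˢ ⁅ x ⁆ˢ
    ball H x (suc r) = H ∩ˢ N[ ball H x r ]

    ball⊆ : ∀ {H x} r → ball H x r ⊆ˢ H
    ball⊆ zero    = proj₁ ∘ ∈∩⁻
    ball⊆ (suc r) = proj₁ ∘ ∈∩⁻

    ball-zero⁻ : ∀ {H x v} → v ∈ˢ ball H x 0 → v ≡ x
    ball-zero⁻ h = ∈⁅⁆ˢ⁻ (proj₂ (∈∩⁻ h))

    ball-zero⁺ : ∀ {H x} → x ∈ˢ H → x ∈ˢ ball H x 0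
    ball-zero⁺ {x = x} h = ∈∩⁺ h (x∈⁅x⁆ˢ x)

    ball-suc⁻ : ∀ {H x v r} → v ∈ˢ ball H x (suc r) → ∃ λ u → u ∈ˢ ball H x r × Near u v
    ball-suc⁻ h = ∈N⁻ (proj₂ (∈∩⁻ h))

    ball-suc⁺ : ∀ {H x u v r} → u ∈ˢ ball H x r → Near u v → v ∈ˢ H → v ∈ˢ ball H x (suc r)
    ball-suc⁺ p q h = ∈∩⁺ h (∈N⁺ p q)

  ball-mono1 : ∀ {H x} r → ball H x r ⊆ˢ ball H x (suc r)
  ball-mono1 r p = ball-suc⁺ p (inj₁ refl) (ball⊆ r p)

  ball-mono : ∀ {H x r r′} → r ≤ r′ → ball H x r ⊆ˢ ball H x r′
  ball-mono {H} {x} {r} {r′} h {v} p = subst (λ m → v ∈ˢ ball H x m) (trans (+-comm (r′ ∸ r) r) (m+[n∸m]≡n h)) (go (r′ ∸ r))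
    where
    go : ∀ k → v ∈ˢ ball H x (k + r)
    go zero = p
    go (suc k) = ball-mono1 (k + r) (go k)

  ball-⊆ : ∀ {H H′ x} r → (∀ {r′ v} → r′ ≤ r → v ∈ˢ ball H x r′ → v ∈ˢ H′) → ball H x r ⊆ˢ ball H′ x r
  ball-⊆ {H′ = H′} {x} zero h {v} p = subst (_∈ˢ ball H′ x 0) (sym e) (ball-zero⁺ (subst (_∈ˢ H′) e (h z≤n p)))
    where e = ball-zero⁻ p
  ball-⊆ (suc r) h p with ball-suc⁻ p
  ... | u , u∈ , near = ball-suc⁺ (ball-⊆ r (λ l → h (m≤n⇒m≤1+n l)) u∈) near (h ≤-refl p)

  ball-resp : ∀ {H H′ x} r → H ⊆ˢ H′ → ball H x r ⊆ˢ ball H′ x r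
  ball-resp r sub = ball-⊆ r (λ {r′} _ p → sub (ball⊆ r′ p))

  ball-trans : ∀ {H x u v a} b → u ∈ˢ ball H x a → v ∈ˢ ball H u b → v ∈ˢ ball H x (a + b)
  ball-trans {H} {x} {a = a} zero p q =
    subst₂ (λ w m → w ∈ˢ ball H x m) (sym (ball-zero⁻ q)) (sym (+-identityʳ a)) p
  ball-trans {H} {x} {v = v} {a} (suc b) p q with ball-suc⁻ q
  ... | w , w∈ , near = subst (λ m → v ∈ˢ ball H x m) (sym (+-suc a b))
                          (ball-suc⁺ (ball-trans b p w∈) near (ball⊆ (suc b) q))

  ball-sym : ∀ {H x v} r → v ∈ˢ ball H x r → x ∈ˢ ball H v r
  ball-sym {H} {x} zero p = subst (λ w → x ∈ˢ ball H w 0) (sym e) (ball-zero⁺ (subst (_∈ˢ H) e (ball⊆ 0 p)))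
    where e = ball-zero⁻ p
  ball-sym {H} (suc r) p with ball-suc⁻ p
  ... | u , u∈ , near = ball-trans r (ball-suc⁺ (ball-zero⁺ (ball⊆ (suc r) p)) (near-symm near) (ball⊆ r u∈)) (ball-sym r u∈)

  -- Geodesics

  -- A shortest path of the subgraph induced on `H`. Positions are plain natural numbers and `at` is
  -- arbitrary beyond `len`, which keeps `Fin` out of the index arithmetic.
  record Geo (H : S) (x y : V J) : Set where
    field
      len     : ℕ
      at      : ℕ → V J
      at-len  : at len ≡ y
      at-ball : ∀ {t} → t ≤ len → at t ∈ˢ ball H x t
      step    : ∀ {t} → t < len → Adj J (at t) (at (suc t))
      minimal : ∀ {m} → y ∈ˢ ball H x m → len ≤ m

    at-0 : at 0 ≡ x
    at-0 = ball-zero⁻ (at-ball z≤n)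

    at∈H : ∀ {t} → t ≤ len → at t ∈ˢ H
    at∈H {t} h = ball⊆ t (at-ball h)

    segment : ∀ {t} i → t + i ≤ len → at (t + i) ∈ˢ ball H (at t) i
    segment {t} zero h = subst (λ m → at m ∈ˢ ball H (at t) 0) (sym (+-identityʳ t))
      (ball-zero⁺ (at∈H (≤-trans (m≤m+n t 0) h)))
    segment {t} (suc i) h = subst (λ m → at m ∈ˢ ball H (at t) (suc i)) (sym (+-suc t i))
      (ball-suc⁺ (segment i (≤-trans (n≤1+n _) h′)) (inj₂ (step h′)) (at∈H h′))
      where
      h′ : suc (t + i) ≤ len
      h′ = ≤-trans (≤-reflexive (sym (+-suc t i))) h

    to-end : ∀ {t} → t ≤ len → y ∈ˢ ball H (at t) (len ∸ t)
    to-end {t} h = subst (_∈ˢ ball H (at t) (len ∸ t)) (trans (cong at (m+[n∸m]≡n h)) at-len)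
      (segment (len ∸ t) (≤-reflexive (m+[n∸m]≡n h)))

    -- A shortcut to `at t`, continued along the rest of the path, would reach `y` in fewer than
    -- `len` steps.
    geodesic : ∀ {t m} → t ≤ len → at t ∈ˢ ball H x m → t ≤ m
    geodesic {t} {m} h p = +-cancelʳ-≤ (len ∸ t) t m
      (≤-trans (≤-reflexive (m+[n∸m]≡n h)) (minimal (ball-trans (len ∸ t) p (to-end h))))

    at-injective : ∀ {t t′} → t ≤ len → t′ ≤ len → at t ≡ at t′ → t ≡ t′
    at-injective h h′ e = ≤-antisym (geodesic h (subst (_∈ˢ ball H x _) (sym e) (at-ball h′)))
                                    (geodesic h′ (subst (_∈ˢ ball H x _) e (at-ball h)))

    at-adj : ∀ {t t′} → t ≤ len → t′ ≤ len → Adj J (at t) (at t′) → t ≤ suc t′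
    at-adj h h′ a = geodesic h (ball-suc⁺ (at-ball h′) (inj₂ (adj-symm a)) (at∈H h))

  open Geo public

  -- The predecessor of `y` supplied by the ball is itself at minimal distance, one less than that
  -- of `y`, so a geodesic to it extends by one step.
  geo-minimal : ∀ {H x y} m → y ∈ˢ ball H x m → (∀ {k} → y ∈ˢ ball H x k → m ≤ k) →
                Σ (Geo H x y) λ γ → len γ ≡ m
  geo-minimal {H} {x} {y} zero p _ = record
    { len = 0 ; at = const x ; at-len = sym (ball-zero⁻ p)
    ; at-ball = λ { z≤n → subst (_∈ˢ ball H x 0) (ball-zero⁻ p) p }
    ; step = λ () ; minimal = λ _ → z≤n } , refl
  geo-minimal {H} {x} {y} (suc m) p mn with ball-suc⁻ p
  ... | u , u∈ , inj₁ refl = ⊥-elim (<⇒≱ (n<1+n m) (mn u∈))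
  ... | u , u∈ , inj₂ a with geo-minimal m u∈ (λ q → ≤-pred (mn (ball-suc⁺ q (inj₂ a) (ball⊆ (suc m) p))))
  ... | γ , refl = record
    { len = suc (len γ) ; at = at′ ; at-len = last ; at-ball = inball ; step = st ; minimal = mn } , refl
    where
    at′ : ℕ → V J
    at′ t with t ≤? len γ
    ... | yes _ = at γ t
    ... | no _  = y
    old : ∀ {t} → t ≤ len γ → at′ t ≡ at γ t
    old {t} h with t ≤? len γ
    ... | yes _ = refl
    ... | no q  = ⊥-elim (q h)
    last : at′ (suc (len γ)) ≡ y
    last with suc (len γ) ≤? len γ
    ... | yes q = ⊥-elim (<⇒≱ (n<1+n _) q)
    ... | no _ = refl
    inball : ∀ {t} → t ≤ suc (len γ) → at′ t ∈ˢ ball H x t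
    inball {t} h with m≤n⇒m<n∨m≡n h
    ... | inj₁ (s≤s h′) = subst (_∈ˢ ball H x t) (sym (old h′)) (at-ball γ h′)
    ... | inj₂ refl = subst (_∈ˢ ball H x t) (sym last) p
    st : ∀ {t} → t < suc (len γ) → Adj J (at′ t) (at′ (suc t))
    st {t} (s≤s h) with m≤n⇒m<n∨m≡n h
    ... | inj₁ h′ = subst₂ (Adj J) (sym (old h)) (sym (old h′)) (step γ h′)
    ... | inj₂ refl = subst₂ (Adj J) (sym (trans (old ≤-refl) (at-len γ))) (sym last) a

  geo : ∀ {H x y} m → y ∈ˢ ball H x m → Σ (Geo H x y) λ γ → len γ ≤ m
  geo {H} {x} {y} zero p = let (γ , e) = geo-minimal zero p (λ _ → z≤n) in γ , ≤-reflexive e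
  geo {H} {x} {y} (suc m) p with y ∈ˢ? ball H x m
  ... | yes q = let (γ , e) = geo m q in γ , m≤n⇒m≤1+n e
  ... | no q = let (γ , e) = geo-minimal (suc m) p (λ r → ≰⇒> (λ k≤m → q (ball-mono k≤m r))) in γ , ≤-reflexive e

  geo-reverse : ∀ {H x y} → Geo H x y → Geo H y x
  geo-reverse {H} {x} {y} γ = record
    { len = len γ ; at = λ t → at γ (len γ ∸ t)
    ; at-len = trans (cong (at γ) (n∸n≡0 (len γ))) (at-0 γ)
    ; at-ball = λ {t} h → ball-sym t (subst (λ m → y ∈ˢ ball H (at γ (len γ ∸ t)) m) (m∸[m∸n]≡n h)
                                        (to-end γ (m∸n≤m (len γ) t)))
    ; step = λ {t} h → adj-symm (subst (λ m → Adj J (at γ (len γ ∸ suc t)) (at γ m)) (sym (+-∸-assoc 1 h))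
                         (step γ (≤-trans (≤-reflexive (sym (+-∸-assoc 1 h))) (m∸n≤m (len γ) t))))
    ; minimal = λ {m} p → minimal γ (ball-sym m p) }

  -- Girth

  _∖₁_ : S → V J → S
  X ∖₁ x = X ∖ˢ ⁅ x ⁆ˢ

  -- A geodesic from `u` to `u′` that avoids `x` closes up through `x`. It repeats no vertex and has
  -- at most `r + 1` of them.
  short-cycle : ∀ {g} → GirthAtLeast J g → ∀ {x u u′ r} → Adj J x u → Adj J x u′ → u ≢ u′ →
                u′ ∈ˢ ball (full ∖₁ x) u r → g ≤ suc (suc r)
  short-cycle girth {x} {u} {u′} {r} xu xu′ u≢u′ p with geo r p
  ... | γ , l≤r = ≤-trans (girth x mid (at γ (len γ)) cyc) (s≤s (s≤s (≤-trans (≤-reflexive (List.length-applyUpTo (at γ) (len γ))) l≤r)))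
    where
    mid = applyUpTo (at γ) (len γ)
    e : mid ++ [ at γ (len γ) ] ≡ applyUpTo (at γ) (suc (len γ))
    e = List.applyUpTo-∷ʳ (at γ) (len γ)
    pos : 1 ≤ len γ
    pos with len γ in eq
    ... | zero = ⊥-elim (u≢u′ (trans (sym (at-0 γ)) (trans (cong (at γ) (sym eq)) (at-len γ))))
    ... | suc _ = s≤s z≤n
    x∉ : x ∉ applyUpTo (at γ) (suc (len γ))
    x∉ x∈ with List∈.∈-applyUpTo⁻ (at γ) x∈
    ... | t , s≤s t≤ , eq = proj₂ (∈∖⁻ (at∈H γ t≤)) (subst (_∈ˢ ⁅ x ⁆ˢ) eq (x∈⁅x⁆ˢ x))
    unq : Unique (x ∷ applyUpTo (at γ) (suc (len γ)))
    unq = All.¬Any⇒All¬ _ x∉ ∷ Unique.applyUpTo⁺₁ (at γ) (suc (len γ))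
            (λ i<j j< ei → <-irrefl (at-injective γ (≤-trans (<⇒≤ i<j) (≤-pred j<)) (≤-pred j<) ei) i<j)
    lnk : ∀ m → m ≤ len γ → Linked (Adj J) (x ∷ applyUpTo (at γ) (suc m))
    lnk m h = subst (Adj J x) (sym (at-0 γ)) xu ∷ Linked.applyUpTo⁺₁ (at γ) (suc m) (λ i< → step γ (≤-trans (≤-pred i<) h))
    cyc : IsCycle J x mid (at γ (len γ))
    cyc = ≤-trans pos (≤-reflexive (sym (List.length-applyUpTo (at γ) (len γ))))
        , subst (λ l → Unique (x ∷ l)) (sym e) unq
        , subst (λ l → Linked (Adj J) (x ∷ l)) (sym e) (lnk (len γ) ≤-refl)
        , subst (λ w → Adj J w x) (sym (at-len γ)) (adj-symm xu′)

  -- Trace the walk back from `z` to its last visit to `x`: from the following vertex `u` on it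
  -- avoids `x`.
  first-step : ∀ {H x z} r → z ∈ˢ ball H x r → z ≢ x →
               ∃ λ u → Adj J x u × u ∈ˢ H × z ∈ˢ ball (full ∖₁ x) u r
  first-step zero p z≢x = ⊥-elim (z≢x (ball-zero⁻ p))
  first-step {H} {x} {z} (suc r) p z≢x with ball-suc⁻ p
  ... | w , w∈ , near with w Fin.≟ x
  ... | no w≢x with first-step r w∈ w≢x
  ... | u , xu , u∈ , w∈′ = u , xu , u∈ , ball-suc⁺ w∈′ near (∈∖⁺ refl (z≢x ∘ ∈⁅⁆ˢ⁻))
  first-step {H} {x} {z} (suc r) p z≢x | w , w∈ , inj₁ e | yes refl = ⊥-elim (z≢x (sym e))
  first-step {H} {x} {z} (suc r) p z≢x | w , w∈ , inj₂ a | yes refl =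
    z , a , ball⊆ (suc r) p , ball-mono z≤n (ball-zero⁺ (∈∖⁺ refl (z≢x ∘ ∈⁅⁆ˢ⁻)))

  -- A set spanning at least as many edges as vertices contains a cycle: strip
  -- vertices of degree at most one, then follow a path that never backtracks.

  Two : S → V J → Set
  Two X x = ∃ λ y → ∃ λ z → y ∈ˢ nbrs X x × z ∈ˢ nbrs X x × y ≢ z

  two? : ∀ X x → Dec (Two X x)
  two? X x = Fin.any? (λ y → Fin.any? (λ z → (y ∈ˢ? nbrs X x) ×-dec ((z ∈ˢ? nbrs X x) ×-dec ¬? (y Fin.≟ z))))

  Branching : S → Set
  Branching X = ∀ {x} → x ∈ˢ X → Two X x

  ∈-split : ∀ {A : Set} {y : A} {l : List A} → y ∈ l → Σ (List A) λ as → Σ (List A) λ bs → l ≡ as ++ y ∷ bs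
  ∈-split = List∈.∈-∃++

  module _ {g} (girth : GirthAtLeast J g) where

    unique-prefix : ∀ {A : Set} (as : List A) {y bs} → Unique (as ++ y ∷ bs) → Unique (as ++ [ y ])
    unique-prefix [] _ = [] ∷ []
    unique-prefix (a ∷ as) (a∉ ∷ u) = pre as a∉ ∷ unique-prefix as u
      where
      pre : ∀ {P : _ → Set} as {y bs} → All P (as ++ y ∷ bs) → All P (as ++ [ y ])
      pre [] (p ∷ _) = p ∷ []
      pre (_ ∷ as) (p ∷ ps) = p ∷ pre as ps

    linked-prefix : ∀ {A : Set} {R : A → A → Set} (as : List A) {y bs} → Linked R (as ++ y ∷ bs) → Linked R (as ++ [ y ])
    linked-prefix [] _ = [-]
    linked-prefix (a ∷ []) (r ∷ _) = r ∷ [-]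
    linked-prefix (a ∷ b ∷ as) (r ∷ l) = r ∷ linked-prefix (b ∷ as) l

    closed-path : ∀ {X} h as y bs → Unique (h ∷ as ++ y ∷ bs) → Linked (Adj J) (h ∷ as ++ y ∷ bs) →
      (∀ {v} → v ∈ h ∷ as ++ y ∷ bs → v ∈ˢ X) → 1 ≤ length as → Adj J y h → g ≤ card X
    closed-path {X} h as y bs u l sub pos a = ≤-trans (girth h as y (pos , unique-prefix (h ∷ as) u , linked-prefix (h ∷ as) l , a))
      (≤-trans (s≤s (≤-trans (≤-trans (s≤s (m≤m+n (length as) (length bs))) (≤-reflexive (sym (+-suc (length as) (length bs)))))
                      (≤-reflexive (sym (List.length-++ as)))))
        (unique-length≤card _ u sub))

    onward : ∀ {X h} → Two X h → ∀ (l : List (V J)) → ∃ λ y → y ∈ˢ nbrs X h × (∀ {m l′} → l ≡ m ∷ l′ → y ≢ m)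
    onward (y , _ , p , _) [] = y , p , λ ()
    onward (y , z , p , q , y≢z) (m ∷ l′) with y Fin.≟ m
    ... | no y≢m = y , p , λ { refl → y≢m }
    ... | yes refl = z , q , λ { refl e → y≢z (sym e) }

    -- The path `h ∷ l` is listed newest vertex first, and `k` bounds how often it can still grow
    -- inside `X`. There is always a continuation other than the vertex just left, so a return to
    -- the path encloses at least three vertices.
    never-backtrack : ∀ {X} → Branching X → ∀ k h l → card X < k + length (h ∷ l) →
      Unique (h ∷ l) → Linked (Adj J) (h ∷ l) → (∀ {v} → v ∈ h ∷ l → v ∈ˢ X) → g ≤ card X
    never-backtrack {X} br zero h l long u lk sub = ⊥-elim (<⇒≱ long (unique-length≤card _ u sub))
    never-backtrack {X} br (suc k) h l long u lk sub with onward {X} (br (sub (here refl))) l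
    ... | y , y∈ , y≢ with mem? Fin._≟_ y l
    ... | no y∉ = never-backtrack br k y (h ∷ l) (≤-trans long (≤-reflexive (sym (+-suc k _))))
                    (((λ e → adj⇒≢ (proj₂ (proj₂ (nbrs⁻ {X} y∈))) (sym e)) ∷ All.¬Any⇒All¬ _ y∉) ∷ u)
                    (adj-symm (proj₂ (proj₂ (nbrs⁻ {X} y∈))) ∷ lk)
                    (λ { (here refl) → proj₁ (proj₂ (nbrs⁻ {X} y∈)) ; (there v∈) → sub v∈ })
    ... | yes y∈l with ∈-split y∈l
    ... | [] , bs , refl = ⊥-elim (y≢ refl refl)
    ... | (a ∷ as) , bs , refl = closed-path h (a ∷ as) y bs u lk sub (s≤s z≤n)
                                   (adj-symm (proj₂ (proj₂ (nbrs⁻ {X} y∈))))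

    -- Removing a vertex with at most one neighbour costs at most 2 in `e2` and so preserves the
    -- hypothesis. The `suc` there makes its negation the forest bound `e2 X + 2 ≤ 2 * k` without
    -- any parity argument.
    dense⇒large : ∀ k (X : S) → card X ≡ k → 0 < k → 2 * k ≤ suc (e2 X) → g ≤ k
    dense⇒large zero X _ () _
    dense⇒large (suc k) X eq _ dense with Fin.any? (λ x → (x ∈ˢ? X) ×-dec ¬? (two? X x))
    ... | no none = ≤-trans (start (card>0⇒∃ (≤-trans (s≤s z≤n) (≤-reflexive (sym eq))))) (≤-reflexive eq)
      where
      br : Branching X
      br {x} x∈ with two? X x
      ... | yes p = p
      ... | no q = ⊥-elim (none (x , x∈ , q))
      start : ∃ (_∈ˢ X) → g ≤ card X
      start (x , x∈) = never-backtrack br (card X) x [] (≤-reflexive (+-comm 1 (card X))) ([] ∷ []) [-]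
                         (λ { (here refl) → x∈ })
    ... | yes (x , x∈ , ¬two) = ≤-trans (remove (Fin.any? (λ y → y ∈ˢ? nbrs X x))) (n≤1+n k)
      where
      card′ : card (X ∖₁ x) ≡ k
      card′ = suc-injective (trans (sym (card-remove x∈)) eq)
      -- The recursion needs a nonempty rest. If `x` is isolated, the edges that remain guarantee
      -- it; otherwise the neighbour of `x` does.
      pos : ∀ {m} → 0 < e2 (X ∖₁ x) ⊎ (∃ λ y → y ∈ˢ X ∖₁ x) → k ≡ m → 0 < m
      pos {zero} (inj₁ p) refl = ⊥-elim (<⇒≱ p (≤-reflexive (e2-empty {X ∖₁ x} card′)))
      pos {zero} (inj₂ (_ , p)) refl = ≤-trans (∈⇒card>0 p) (≤-reflexive card′)
      pos {suc m} _ _ = s≤s z≤n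
      2k : 2 * suc k ≡ 2 + 2 * k
      2k = *-suc 2 k
      in-rest : ∀ {v} → v ∈ˢ X → v ≢ x → v ∈ˢ X ∖₁ x
      in-rest p q = ∈∖⁺ p (q ∘ ∈⁅⁆ˢ⁻)
      remove : Dec (∃ λ y → y ∈ˢ nbrs X x) → g ≤ k
      remove (no isolated) = dense⇒large k (X ∖₁ x) card′ (pos (inj₁ (≤-pred (≤-trans (≤-trans (s≤s (s≤s z≤n)) (≤-reflexive (sym 2k))) big))) refl)
                               (≤-trans (≤-trans (m≤n+m (2 * k) 2) (≤-reflexive (sym 2k))) big)
        where
        big : 2 * suc k ≤ suc (e2 (X ∖₁ x))
        big = ≤-trans dense (s≤s (≤-trans (e2-cover {X} {X ∖₁ x} {∅ˢ} (λ {u} {v} u∈ v∈ a → inj₁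
          ( in-rest u∈ (λ { refl → isolated (v , nbrs⁺ {X} u∈ v∈ a) })
          , in-rest v∈ (λ { refl → isolated (u , nbrs⁺ {X} v∈ u∈ (adj-symm a)) }))))
          (≤-reflexive (trans (cong (e2 (X ∖₁ x) +_) (e2-empty {∅ˢ} card-∅)) (+-identityʳ _)))))
      remove (yes (y , y∈)) = dense⇒large k (X ∖₁ x) card′
          (pos (inj₂ (y , in-rest (proj₁ (proj₂ (nbrs⁻ {X} y∈))) (adj⇒≢ (proj₂ (proj₂ (nbrs⁻ {X} y∈))) ∘ sym))) refl)
          (+-cancelˡ-≤ 2 _ _ (≤-trans (≤-trans (≤-reflexive (sym 2k)) dense) (≤-trans (s≤s (≤-trans cover (+-monoʳ-≤ (e2 (X ∖₁ x)) (e2-pair x y)))) (≤-reflexive (cong suc (+-comm _ 2))))))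
        where
        only : ∀ {v} → v ∈ˢ nbrs X x → v ≡ y
        only {v} v∈ with v Fin.≟ y
        ... | yes e = e
        ... | no q = ⊥-elim (¬two (v , y , v∈ , y∈ , q))
        cover : e2 X ≤ e2 (X ∖₁ x) + e2 (⁅ x ⁆ˢ ∪ˢ ⁅ y ⁆ˢ)
        cover = e2-cover {X} {X ∖₁ x} {⁅ x ⁆ˢ ∪ˢ ⁅ y ⁆ˢ} pt
          where
          inx : x ∈ˢ ⁅ x ⁆ˢ ∪ˢ ⁅ y ⁆ˢ
          inx = ∈∪⁺ (inj₁ (x∈⁅x⁆ˢ x))
          iny : ∀ {v} → v ∈ˢ nbrs X x → v ∈ˢ ⁅ x ⁆ˢ ∪ˢ ⁅ y ⁆ˢ
          iny {v} p = ∈∪⁺ (inj₂ (subst (_∈ˢ ⁅ y ⁆ˢ) (sym (only p)) (x∈⁅x⁆ˢ y)))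
          pt : ∀ {u v} → u ∈ˢ X → v ∈ˢ X → Adj J u v →
               (u ∈ˢ X ∖₁ x × v ∈ˢ X ∖₁ x) ⊎ (u ∈ˢ ⁅ x ⁆ˢ ∪ˢ ⁅ y ⁆ˢ × v ∈ˢ ⁅ x ⁆ˢ ∪ˢ ⁅ y ⁆ˢ)
          pt {u} {v} u∈ v∈ a with u Fin.≟ x | v Fin.≟ x
          ... | yes refl | _ = inj₂ (inx , iny (nbrs⁺ {X} u∈ v∈ a))
          ... | no _ | yes refl = inj₂ (iny (nbrs⁺ {X} v∈ u∈ (adj-symm a)) , inx)
          ... | no p | no q = inj₁ (in-rest u∈ p , in-rest v∈ q)

  -- Sizes of neighbourhoods and balls under bounded degree

  module _ {D} (maxdeg : MaxDegreeAtMost J D) where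

    card-adj : ∀ v → card ⟪ adj? v ⟫ ≤ D
    card-adj v = ≤-trans (≤-reflexive e) (maxdeg v)
      where
      opaque
        unfolding card
        e : card ⟪ adj? v ⟫ ≡ deg J v
        e = trans (sum-cong-≗ {n J} (λ u → pt (adj J v u))) (sym (sumᴸ-allFin (λ u → 𝟙 (adj J v u))))
          where
          pt : ∀ b → 𝟙 (does (b Bool.≟ true)) ≡ 𝟙 b
          pt true = refl
          pt false = refl

    card-near : ∀ v → card ⟪ near? v ⟫ ≤ suc D
    card-near v = ≤-trans (card-∪ {Y = ⁅ v ⁆ˢ} {⟪ adj? v ⟫} sp) (+-mono-≤ (≤-reflexive (card-⁅⁆ v)) (card-adj v))
      where
      sp : ∀ {w} → w ∈ˢ ⟪ near? v ⟫ → w ∈ˢ ⁅ v ⁆ˢ ⊎ w ∈ˢ ⟪ adj? v ⟫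
      sp {w} p with ∈⟪⟫⁻ (near? v) p
      ... | inj₁ refl = inj₁ (x∈⁅x⁆ˢ v)
      ... | inj₂ a = inj₂ (∈⟪⟫⁺ (adj? v) a)

    card-N : ∀ X → card N[ X ] ≤ suc D * card X
    card-N X = ≤-trans (card-⋃ R (λ {v} p → let (u , u∈ , q) = ∈N⁻ p in u , ∈⟪⟫⁺ (R? u) (u∈ , q)))
                 (≤-trans (sum-mono bnd) (≤-reflexive e))
      where
      R? : ∀ u → Decidable (λ v → u ∈ˢ X × Near u v)
      R? u v = (u ∈ˢ? X) ×-dec near? u v
      R : V J → S
      R u = ⟪ R? u ⟫
      bnd : ∀ u → card (R u) ≤ suc D * 𝟙 (X u)
      bnd u with u ∈ˢ? X
      ... | yes p = ≤-trans (card-⊆ {X = ⟪ near? u ⟫} id) (≤-trans (card-near u) (≤-reflexive (sym (trans (cong (suc D *_) (𝟙-true p)) (*-identityʳ (suc D))))))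
      ... | no _ = ≤-trans (≤-reflexive card-∅) z≤n
      opaque
        unfolding card
        e : sum (λ u → suc D * 𝟙 (X u)) ≡ suc D * card X
        e = sum-*ˡ (suc D) (𝟙 ∘ X)

    card-ball : ∀ H x r → card (ball H x r) ≤ suc D ^ r
    card-ball H x zero = ≤-trans (card-⊆ (λ p → subst (_∈ˢ ⁅ x ⁆ˢ) (sym (ball-zero⁻ p)) (x∈⁅x⁆ˢ x))) (≤-reflexive (card-⁅⁆ x))
    card-ball H x (suc r) = ≤-trans (card-⊆ (λ p → let (u , u∈ , q) = ball-suc⁻ p in ∈N⁺ u∈ q))
      (≤-trans (card-N (ball H x r)) (*-monoʳ-≤ (suc D) (card-ball H x r)))

-- Exponentials beat polynomials

k<2^k : ∀ k → k < 2 ^ k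
k<2^k zero    = s≤s z≤n
k<2^k (suc k) = ≤-trans (+-mono-≤ (≤-trans (s≤s z≤n) (k<2^k k)) (k<2^k k))
                        (≤-reflexive (cong (2 ^ k +_) (sym (+-identityʳ (2 ^ k)))))

-- At twice `z = 2a + b` the bound follows from `z (z + 1) ≤ 2^z * 2^z`; after that each step adds
-- `a` on the left and doubles the right.
linear≤exp : ∀ a b → ∃ λ y₀ → ∀ y → y₀ ≤ y → a * y + b ≤ 2 ^ y
linear≤exp a b = z + z , λ y h → subst (λ y → a * y + b ≤ 2 ^ y) (trans (+-comm (y ∸ (z + z)) (z + z)) (m+[n∸m]≡n h)) (go (y ∸ (z + z)))
  where
  open ≤-Reasoning
  z = a + a + b
  eq : ∀ a b z → a * (z + z) + b ≡ (a + a) * z + b * 1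
  eq = solve-∀
  base : a * (z + z) + b ≤ 2 ^ (z + z)
  base = begin
    a * (z + z) + b        ≡⟨ eq a b z ⟩
    (a + a) * z + b * 1    ≤⟨ +-monoʳ-≤ ((a + a) * z) (*-monoʳ-≤ b (s≤s z≤n)) ⟩
    (a + a) * z + b * suc z ≤⟨ +-monoˡ-≤ (b * suc z) (*-monoʳ-≤ (a + a) (n≤1+n z)) ⟩
    (a + a) * suc z + b * suc z ≡⟨ *-distribʳ-+ (suc z) (a + a) b ⟨
    z * suc z              ≤⟨ *-mono-≤ (<⇒≤ (k<2^k z)) (k<2^k z) ⟩
    2 ^ z * 2 ^ z          ≡⟨ ^-distribˡ-+-* 2 z z ⟨
    2 ^ (z + z)            ∎
  a≤ : ∀ k → a ≤ 2 ^ (k + (z + z))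
  a≤ k = ≤-trans (≤-trans (m≤m+n a a) (≤-trans (m≤m+n (a + a) b) (≤-trans (m≤m+n z z) (m≤n+m (z + z) k)))) (<⇒≤ (k<2^k (k + (z + z))))
  go : ∀ k → a * (k + (z + z)) + b ≤ 2 ^ (k + (z + z))
  go zero = base
  go (suc k) = begin
    a * suc (k + (z + z)) + b              ≡⟨ cong (_+ b) (*-suc a (k + (z + z))) ⟩
    a + a * (k + (z + z)) + b              ≡⟨ +-assoc a _ b ⟩
    a + (a * (k + (z + z)) + b)            ≤⟨ +-mono-≤ (a≤ k) (go k) ⟩
    2 ^ (k + (z + z)) + 2 ^ (k + (z + z))  ≡⟨ cong (2 ^ (k + (z + z)) +_) (+-identityʳ _) ⟨
    2 ^ suc (k + (z + z))                  ∎

-- The base `2 + k` is at least 2, so constants and sums are absorbed by raising the exponent.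
Poly : (ℕ → ℕ) → Set
Poly f = ∃ λ m → ∀ k → f k ≤ (2 + k) ^ m

Poly-const : ∀ a → Poly (λ _ → a)
Poly-const a = a , λ k → ≤-trans (<⇒≤ (k<2^k a)) (^-monoˡ-≤ a (m≤m+n 2 k))

Poly-id : Poly (λ k → k)
Poly-id = 1 , λ k → ≤-trans (m≤n+m k 2) (≤-reflexive (sym (*-identityʳ (2 + k))))

^-monoʳ : ∀ k {m m′} → m ≤ m′ → (2 + k) ^ m ≤ (2 + k) ^ m′
^-monoʳ k = ^-monoʳ-≤ (2 + k)

Poly-* : ∀ {f g} → Poly f → Poly g → Poly (λ k → f k * g k)
Poly-* (m , F) (m′ , G) = m + m′ , λ k → ≤-trans (*-mono-≤ (F k) (G k)) (≤-reflexive (sym (^-distribˡ-+-* (2 + k) m m′)))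

Poly-+ : ∀ {f g} → Poly f → Poly g → Poly (λ k → f k + g k)
Poly-+ {f} {g} (m , F) (m′ , G) = suc (m + m′) , λ k → begin
  f k + g k                                  ≤⟨ +-mono-≤ (≤-trans (F k) (^-monoʳ k (m≤m+n m m′))) (≤-trans (G k) (^-monoʳ k (m≤n+m m′ m))) ⟩
  (2 + k) ^ (m + m′) + (2 + k) ^ (m + m′)    ≡⟨ cong ((2 + k) ^ (m + m′) +_) (+-identityʳ _) ⟨
  2 * (2 + k) ^ (m + m′)                     ≤⟨ *-monoˡ-≤ ((2 + k) ^ (m + m′)) (m≤m+n 2 k) ⟩
  (2 + k) ^ suc (m + m′)                     ∎
  where open ≤-Reasoning

Poly-∘ : ∀ {f g} → Poly f → Poly g → Poly (λ k → f (g k))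
Poly-∘ {f} {g} (m , F) G with Poly-+ (Poly-const 2) G
... | m′ , G′ = m′ * m , λ k → ≤-trans (F (g k)) (≤-trans (^-monoˡ-≤ m (G′ k)) (≤-reflexive (^-*-assoc (2 + k) m′ m)))

Poly-suc : ∀ {f} → Poly f → Poly (λ k → suc (f k))
Poly-suc = Poly-+ (Poly-const 1)

Poly-^ : ∀ {f} m → Poly f → Poly (λ k → f k ^ m)
Poly-^ zero    F = Poly-const 1
Poly-^ (suc m) F = Poly-* F (Poly-^ m F)

-- After extracting an (m+1)-st root it suffices that `2 + k` is at most 2 to the power
-- `k / (m + 1)`, which compares a linear function with an exponential.
eventually : ∀ {f} → Poly f → ∃ λ k₀ → ∀ k → k₀ ≤ k → f k ≤ 2 ^ k
eventually {f} (m , F) with linear≤exp (suc m) (3 + m)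
... | y₀ , H = y₀ * suc m , λ k h → begin
  f k                              ≤⟨ F k ⟩
  (2 + k) ^ m                      ≤⟨ ^-monoʳ k (n≤1+n m) ⟩
  (2 + k) ^ suc m                  ≤⟨ ^-monoˡ-≤ (suc m) (base k h) ⟩
  (2 ^ (k ℕ./ suc m)) ^ suc m        ≡⟨ ^-*-assoc 2 (k ℕ./ suc m) (suc m) ⟩
  2 ^ (k ℕ./ suc m * suc m)          ≤⟨ ^-monoʳ-≤ 2 (m/n*n≤m k (suc m)) ⟩
  2 ^ k                            ∎
  where
  open ≤-Reasoning
  eq : ∀ m y → 2 + (suc m + y * suc m) ≡ suc m * y + (3 + m)
  eq = solve-∀
  base : ∀ k → y₀ * suc m ≤ k → 2 + k ≤ 2 ^ (k ℕ./ suc m)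
  base k h = begin
    2 + k                          ≤⟨ +-monoʳ-≤ 2 (≤-trans (≤-reflexive (m≡m%n+[m/n]*n k (suc m))) (+-monoˡ-≤ (k ℕ./ suc m * suc m) (<⇒≤ (m%n<n k (suc m))))) ⟩
    2 + (suc m + k ℕ./ suc m * suc m) ≡⟨ eq m (k ℕ./ suc m) ⟩
    suc m * (k ℕ./ suc m) + (3 + m)  ≤⟨ H (k ℕ./ suc m) (≤-trans (≤-reflexive (sym (m*n/n≡m y₀ (suc m)))) (/-monoˡ-≤ (suc m) h)) ⟩
    2 ^ (k ℕ./ suc m)                ∎

binary-scale : ∀ n → 1 ≤ n → ∃ λ K → 2 ^ K ≤ n × n < 2 ^ suc K
binary-scale (suc zero) _ = 0 , s≤s z≤n , s≤s (s≤s z≤n)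
binary-scale (suc n@(suc _)) _ with binary-scale n (s≤s z≤n)
... | K , lo , hi with suc n <? 2 ^ suc K
... | yes p = K , m≤n⇒m≤1+n lo , p
... | no q = suc K , ≮⇒≥ q , ≤-trans (s≤s hi) (≤-trans (≤-reflexive (+-comm 1 (2 ^ suc K))) (≤-trans
      (+-monoʳ-≤ (2 ^ suc K) (≤-trans (s≤s z≤n) (k<2^k (suc K)))) (≤-reflexive (cong (2 ^ suc K +_) (sym (+-identityʳ _))))))

-- Since `k ≤ f k`, the value at `K + 1` exceeds `K` at the latest, which bounds the search for a
-- crossing.
last-below : ∀ (f : ℕ → ℕ) k* K → f k* ≤ K → (∀ k → k ≤ f k) → ∃ λ k → k* ≤ k × f k ≤ K × K < f (suc k)
last-below f k* K h unb = go (suc K) k* ≤-refl h (m≤n+m (suc K) k*)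
  where
  go : ∀ fuel k → k* ≤ k → f k ≤ K → suc K ≤ k + fuel → ∃ λ k → k* ≤ k × f k ≤ K × K < f (suc k)
  go fuel k le fk lim with suc K ≤? f (suc k)
  ... | yes p = k , le , fk , p
  go zero k le fk lim | no q = ⊥-elim (<⇒≱ (≤-trans lim (≤-reflexive (+-identityʳ k))) (≤-trans (unb k) fk))
  go (suc fuel) k le fk lim | no q = go fuel (suc k) (m≤n⇒m≤1+n le) (≤-pred (≰⇒> q)) (≤-trans lim (≤-reflexive (+-suc k fuel)))

-- The scale function κ of the density thresholds.  It uses log₂ (a²) rather than log₂ a so that
-- it increases between 5n/8 and n, which lets sets grow beyond half of the vertices.

opaque
  κ : ℕ → ℕ
  κ a = suc ⌊log₂ (a * a) ⌋

  κ-mono : ∀ {a b} → a ≤ b → κ a ≤ κ b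
  κ-mono h = s≤s (⌊log₂⌋-mono-≤ (*-mono-≤ h h))

  κ-gap : ∀ {a n} → 1 ≤ a → 2 * (a * a) ≤ n * n → suc (κ a) ≤ κ n
  κ-gap {suc a} _ h = s≤s (≤-trans (≤-reflexive (sym (⌊log₂[2*b]⌋≡1+⌊log₂b⌋ (suc a * suc a)))) (⌊log₂⌋-mono-≤ h))

  κ-bound : ∀ {a j} → 1 ≤ a → a < 2 ^ j → κ a ≤ suc (j + j)
  κ-bound {suc a} {j} _ h = ≤-trans (≤-reflexive (sym (⌊log₂[2*b]⌋≡1+⌊log₂b⌋ (suc a * suc a))))
    (≤-trans (⌊log₂⌋-mono-≤ (*-monoʳ-≤ 2 (≤-trans (*-mono-≤ (<⇒≤ h) (<⇒≤ h)) (≤-reflexive (sym (^-distribˡ-+-* 2 j j))))))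
             (≤-reflexive (⌊log₂[2^n]⌋≡n (suc (j + j)))))

  1≤κ : ∀ a → 1 ≤ κ a
  1≤κ a = s≤s z≤n

-- Arithmetic of the density thresholds

-- An upper bound σ/k on P - Q implies the weaker bound σ/l, whatever the sign of P - Q. This moves
-- a heaviness inequality to a smaller value of κ.
scale-down : ∀ {k l P Q σ} → l ≤ k → k * P ≤ k * Q + σ → l * P ≤ l * Q + σ
scale-down {k} {l} {P} {Q} {σ} l≤k h with ≤-total P Q
... | inj₁ P≤Q = ≤-trans (*-monoʳ-≤ l P≤Q) (m≤m+n _ σ)
... | inj₂ Q≤P with m≤n⇒∃[o]m+o≡n Q≤P
... | x , refl = ≤-trans (≤-reflexive (*-distribˡ-+ l Q x)) (+-monoʳ-≤ (l * Q) (≤-trans (*-monoˡ-≤ x l≤k)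
      (+-cancelˡ-≤ (k * Q) _ _ (≤-trans (≤-reflexive (sym (*-distribˡ-+ k Q x))) h))))

-- The companion for lightness: if Q exceeds P by at least σ/l, it does so by at least σ/k for
-- larger k.
scale-up : ∀ {k l P Q σ} → 1 ≤ l → l ≤ k → l * P + σ ≤ l * Q → k * P + σ ≤ k * Q
scale-up {k} {suc l} {P} {Q} {σ} _ l≤k h with m≤n⇒∃[o]m+o≡n l≤k
... | x , refl = begin
  (suc l + x) * P + σ          ≡⟨ eq l x P σ ⟩
  (suc l * P + σ) + x * P      ≤⟨ +-mono-≤ h (*-monoʳ-≤ x (*-cancelˡ-≤ (suc l) (≤-trans (m≤m+n _ σ) h))) ⟩
  suc l * Q + x * Q            ≡⟨ *-distribʳ-+ Q (suc l) x ⟨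
  (suc l + x) * Q              ∎
  where
  open ≤-Reasoning
  eq : ∀ l x P σ → (suc l + x) * P + σ ≡ (suc l * P + σ) + x * P
  eq = solve-∀

-- Both inequalities carry the same k, so their difference cancels the b remaining vertices and
-- leaves a bound on the edges that meet the σ removed ones.
heavy-minus-light : ∀ {c q k eA eB eY b σ} →
  k * (c * (b + σ)) ≤ k * (q * eA) + (b + σ) → k * (q * eB) + b ≤ k * (c * b) → eA ≤ eB + eY →
  k * (c * σ) ≤ k * (q * eY) + σ
heavy-minus-light {c} {q} {k} {eA} {eB} {eY} {b} {σ} hA hB hE = +-cancelˡ-≤ (k * (c * b)) _ _ (begin
  k * (c * b) + k * (c * σ)            ≡⟨ eq₁ c k b σ ⟩
  k * (c * (b + σ))                    ≤⟨ hA ⟩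
  k * (q * eA) + (b + σ)               ≤⟨ +-monoˡ-≤ (b + σ) (*-monoʳ-≤ k (*-monoʳ-≤ q hE)) ⟩
  k * (q * (eB + eY)) + (b + σ)        ≡⟨ eq₂ q k eB eY b σ ⟩
  (k * (q * eB) + b) + (k * (q * eY) + σ) ≤⟨ +-monoˡ-≤ _ hB ⟩
  k * (c * b) + (k * (q * eY) + σ)     ∎)
  where
  open ≤-Reasoning
  eq₁ : ∀ c k b σ → k * (c * b) + k * (c * σ) ≡ k * (c * (b + σ))
  eq₁ = solve-∀
  eq₂ : ∀ q k eB eY b σ → k * (q * (eB + eY)) + (b + σ) ≡ (k * (q * eB) + b) + (k * (q * eY) + σ)
  eq₂ = solve-∀

-- After division the hypotheses read (c - 1/(k+1)) σ ≤ q e ≤ (c - 1/k)(σ + δ). The gap 1/k -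
-- 1/(k+1) = 1/(k(k+1)) has to be paid for by δ; this is the source of the log² in the expansion.
expansion : ∀ {c q k σ δ e} → suc k * (c * σ) ≤ suc k * (q * e) + σ → k * (q * e) + (σ + δ) ≤ k * (c * (σ + δ)) →
            σ ≤ c * (k * suc k) * δ
expansion {c} {q} {k} {σ} {δ} {e} h1 h2 = ≤-trans (m≤m+n σ (suc k * δ)) (+-cancelˡ-≤ Z _ _ (begin
  Z + (σ + suc k * δ)                                                ≡⟨ eq₁ c q k σ δ e ⟩
  k * (suc k * (c * σ)) + suc k * (k * (q * e) + (σ + δ))            ≤⟨ +-mono-≤ (*-monoʳ-≤ k h1) (*-monoʳ-≤ (suc k) h2) ⟩
  k * (suc k * (q * e) + σ) + suc k * (k * (c * (σ + δ)))            ≡⟨ eq₂ c q k σ δ e ⟩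
  Z + c * (k * suc k) * δ                                            ∎))
  where
  open ≤-Reasoning
  Z = k * (suc k * (c * σ)) + suc k * (k * (q * e)) + k * σ
  eq₁ : ∀ c q k σ δ e → k * (suc k * (c * σ)) + suc k * (k * (q * e)) + k * σ + (σ + suc k * δ)
        ≡ k * (suc k * (c * σ)) + suc k * (k * (q * e) + (σ + δ))
  eq₁ = solve-∀
  eq₂ : ∀ c q k σ δ e → k * (suc k * (q * e) + σ) + suc k * (k * (c * (σ + δ)))
        ≡ k * (suc k * (c * σ)) + suc k * (k * (q * e)) + k * σ + c * (k * suc k) * δ
  eq₂ = solve-∀

-- Accumulated growth

x+[y+z] : ∀ x y z → x + (y + z) ≡ x + z + y
x+[y+z] = solve-∀

accumulate : ∀ (f : ℕ → ℕ) w h T → (∀ t → t < T → w * f t + h ≤ w * f (suc t)) → w * f 0 + T * h ≤ w * f T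
accumulate f w h zero    H = ≤-reflexive (+-identityʳ _)
accumulate f w h (suc T) H = begin
  w * f 0 + (h + T * h)  ≡⟨ x+[y+z] (w * f 0) h (T * h) ⟩
  w * f 0 + T * h + h    ≤⟨ +-monoˡ-≤ h (accumulate f w h T (λ t l → H t (m≤n⇒m≤1+n l))) ⟩
  w * f T + h            ≤⟨ H T ≤-refl ⟩
  w * f (suc T)          ∎
  where open ≤-Reasoning

mono-≤ : ∀ (f : ℕ → ℕ) → (∀ t → f t ≤ f (suc t)) → ∀ {s t} → s ≤ t → f s ≤ f t
mono-≤ f h {s} {t} s≤t = subst (λ m → f s ≤ f m) (m+[n∸m]≡n s≤t) (go (t ∸ s))
  where
  go : ∀ k → f s ≤ f (s + k)
  go zero    = ≤-reflexive (cong f (sym (+-identityʳ s)))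
  go (suc k) = ≤-trans (go k) (≤-trans (h (s + k)) (≤-reflexive (cong f (sym (+-suc s k)))))

-- Each of `m` consecutive steps adds at least the m-th part of the value at their start, so
-- together they double it; `j₀` doublings suffice.
tree-growth : ∀ (b : ℕ → ℕ) m j₀ → .{{NonZero m}} → (∀ t → b t ≤ b (suc t)) → 1 ≤ b 0 →
  (∀ t → t < m * j₀ → b t < 2 ^ j₀ → suc m * b t ≤ m * b (suc t)) → 2 ^ j₀ ≤ b (m * j₀)
tree-growth b m j₀ mono pos H = go j₀ ≤-refl
  where
  open ≤-Reasoning
  go : ∀ j → j ≤ j₀ → 2 ^ j ≤ b (m * j)
  go zero    _ = ≤-trans pos (≤-reflexive (cong b (sym (*-zeroʳ m))))
  go (suc j) j< with 2 ^ j₀ ≤? b (m * suc j)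
  ... | yes p = ≤-trans (^-monoʳ-≤ 2 j<) p
  ... | no small = *-cancelˡ-≤ m (begin
    m * (2 ^ suc j)                    ≡⟨ eq m (2 ^ j) ⟩
    m * 2 ^ j + m * 2 ^ j              ≤⟨ +-mono-≤ (*-monoʳ-≤ m IH) (*-monoʳ-≤ m IH) ⟩
    m * b (m * j) + m * b (m * j)      ≡⟨ cong (λ z → m * b z + m * b (m * j)) (sym (+-identityʳ (m * j))) ⟩
    m * b (m * j + 0) + m * b (m * j)  ≤⟨ accumulate (λ t → b (m * j + t)) m (b (m * j)) m one ⟩
    m * b (m * j + m)                  ≡⟨ cong (λ z → m * b z) (trans (+-comm (m * j) m) (sym (*-suc m j))) ⟩
    m * b (m * suc j)                  ∎)
    where
    eq : ∀ m x → m * (2 * x) ≡ m * x + m * x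
    eq = solve-∀
    IH = go j (≤-trans (n≤1+n j) j<)
    le : ∀ {t} → t < m → m * j + t < m * suc j
    le {t} l = ≤-trans (≤-reflexive (sym (+-suc (m * j) t))) (≤-trans (+-monoʳ-≤ (m * j) l) (≤-reflexive (trans (+-comm (m * j) m) (sym (*-suc m j)))))
    one : ∀ t → t < m → m * b (m * j + t) + b (m * j) ≤ m * b (m * j + suc t)
    one t l = begin
      m * b (m * j + t) + b (m * j)      ≤⟨ +-monoʳ-≤ _ (mono-≤ b mono (m≤m+n (m * j) t)) ⟩
      m * b (m * j + t) + b (m * j + t)  ≡⟨ +-comm _ (b (m * j + t)) ⟩
      suc m * b (m * j + t)              ≤⟨ H (m * j + t) (≤-trans (le l) (*-monoʳ-≤ m j<)) (≤-<-trans (mono-≤ b mono (<⇒≤ (le l))) (≰⇒> small)) ⟩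
      m * b (suc (m * j + t))            ≡⟨ cong (λ z → m * b z) (sym (+-suc (m * j) t)) ⟩
      m * b (m * j + suc t)              ∎

-- Doubling from 2^j takes at most 2 W(j) steps, so 2^j is reached by radius R(j).
module Growth (c : ℕ) (1≤c : 1 ≤ c) where

  opaque
    -- A set of fewer than 2^(j+2) vertices has κ at most 2j + 5, and (2j+5)(2j+6) ≤ 30 (j+1)², with
    -- equality at j = 0. The cubic `R` is chosen so that its increments dominate `2 * W j`.
    W R : ℕ → ℕ
    W j = 30 * c * (suc j * suc j)
    R j = 60 * c * (suc j * suc j * suc j)

    W-big : ∀ j → 8 ≤ 2 * W j
    W-big j = ≤-trans (m≤m+n 8 52) (*-monoʳ-≤ 2 (*-mono-≤ {30} (*-monoʳ-≤ 30 1≤c) (s≤s (z≤n {j + j * suc j}))))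

  W≢0 : ∀ j → NonZero (2 * W j)
  W≢0 j = ℕ.>-nonZero (≤-trans (s≤s z≤n) (W-big j))

  opaque
    unfolding W

    R-step : ∀ j → R j + 2 * W j ≤ R (suc j)
    R-step j = ≤-trans (m≤m+n _ (60 * c * (2 * (j * j) + 7 * j + 6))) (≤-reflexive (eq c j))
      where
      eq : ∀ c j → 60 * c * (suc j * suc j * suc j) + 2 * (30 * c * (suc j * suc j)) + 60 * c * (2 * (j * j) + 7 * j + 6) ≡ 60 * c * (suc (suc j) * suc (suc j) * suc (suc j))
      eq = solve-∀

  R-mono : ∀ {i j} → i ≤ j → R i ≤ R j
  R-mono = mono-≤ R (λ j → ≤-trans (m≤m+n _ _) (R-step j))

  opaque
    unfolding W

    κκ≤W : ∀ {k} j → k ≤ suc (suc (suc j) + suc (suc j)) → c * (k * suc k) ≤ W j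
    κκ≤W {k} j h = begin
      c * (k * suc k)                            ≤⟨ *-monoʳ-≤ c (*-mono-≤ h (s≤s h)) ⟩
      c * (suc (suc (suc j) + suc (suc j)) * suc (suc (suc (suc j) + suc (suc j)))) ≤⟨ m≤m+n _ (c * (26 * (j * j) + 38 * j)) ⟩
      c * (suc (suc (suc j) + suc (suc j)) * suc (suc (suc (suc j) + suc (suc j)))) + c * (26 * (j * j) + 38 * j) ≡⟨ eq c j ⟩
      W j                                        ∎
      where
      open ≤-Reasoning
      eq : ∀ c j → c * (suc (suc (suc j) + suc (suc j)) * suc (suc (suc (suc j) + suc (suc j)))) + c * (26 * (j * j) + 38 * j) ≡ 30 * c * (suc j * suc j)
      eq = solve-∀

  -- In the application `n` is the order of the core, `a r` the size of a ball in the allowed part,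
  -- `y r` the size of its closed neighbourhood in the core, and `d r` the number of vertices of the
  -- latter that are not allowed.
  module _ (n : ℕ) (a y d : ℕ → ℕ)
    (a-mono : ∀ r → a r ≤ a (suc r)) (a≤n : ∀ r → a r ≤ n) (y≤a+d : ∀ r → y r ≤ a (suc r) + d r)
    (expand : ∀ r j → 8 * y r ≤ 5 * n → 2 ^ j ≤ a r → y r < 2 ^ suc (suc j) → 2 ^ j + W j * a r ≤ W j * y r)
    where

    open ≤-Reasoning

    Ripe : ℕ → ℕ → Set
    Ripe j r = n < 2 * a r ⊎ 2 ^ suc j ≤ a r

    ripe-mono : ∀ {j r r′} → r ≤ r′ → Ripe j r → Ripe j r′
    ripe-mono h (inj₁ p) = inj₁ (≤-trans p (*-monoʳ-≤ 2 (mono-≤ a a-mono h)))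
    ripe-mono h (inj₂ p) = inj₂ (≤-trans p (mono-≤ a a-mono h))

    -- If `y r` exceeds 5n/8, the loss of at most n/8 leaves more than n/2. If `y r` is at least
    -- 2^(j+2), losing at most 2^j leaves 2^(j+1). Otherwise the expansion gains 2^j / W, of which
    -- the loss consumes at most half.
    one-step : ∀ j r → 2 ^ j ≤ a r → 2 * W j * d r ≤ 2 ^ j → Ripe j (suc r) ⊎ 2 * W j * a r + 2 ^ j ≤ 2 * W j * a (suc r)
    one-step j r big small with 8 * y r ≤? 5 * n | y r <? 2 ^ suc (suc j)
    ... | no q | _ = inj₁ (inj₁ (*-cancelˡ-< 4 _ _ (+-cancelʳ-< n (4 * n) (4 * (2 * a (suc r))) (begin-strict
      4 * n + n                 ≡⟨ +-comm (4 * n) n ⟩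
      5 * n                     <⟨ ≰⇒> q ⟩
      8 * y r                   ≤⟨ *-monoʳ-≤ 8 (y≤a+d r) ⟩
      8 * (a (suc r) + d r)     ≡⟨ *-distribˡ-+ 8 (a (suc r)) (d r) ⟩
      8 * a (suc r) + 8 * d r   ≤⟨ +-monoʳ-≤ (8 * a (suc r)) (≤-trans (*-monoˡ-≤ (d r) (W-big j)) (≤-trans small (≤-trans big (a≤n r)))) ⟩
      8 * a (suc r) + n         ≡⟨ cong (_+ n) (*-assoc 4 2 (a (suc r))) ⟩
      4 * (2 * a (suc r)) + n   ∎))))
    ... | yes _ | no q = inj₁ (inj₂ (+-cancelʳ-≤ (2 ^ j) _ _ (begin
      2 ^ suc j + 2 ^ j         ≤⟨ +-monoʳ-≤ (2 ^ suc j) (m≤m+n (2 ^ j) _) ⟩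
      2 ^ suc j + 2 ^ suc j     ≡⟨ cong (2 ^ suc j +_) (+-identityʳ (2 ^ suc j)) ⟨
      2 ^ suc (suc j)           ≤⟨ ≮⇒≥ q ⟩
      y r                       ≤⟨ y≤a+d r ⟩
      a (suc r) + d r           ≤⟨ +-monoʳ-≤ (a (suc r)) (≤-trans (≤-trans (≤-reflexive (sym (*-identityˡ (d r)))) (*-monoˡ-≤ (d r) (≤-trans (s≤s z≤n) (W-big j)))) small) ⟩
      a (suc r) + 2 ^ j         ∎)))
    ... | yes p | yes p′ = inj₂ (+-cancelʳ-≤ (2 ^ j) _ _ (begin
      2 * W j * a r + 2 ^ j + 2 ^ j        ≡⟨ eq₁ (W j) (a r) (2 ^ j) ⟩
      2 * (2 ^ j + W j * a r)              ≤⟨ *-monoʳ-≤ 2 (expand r j p big p′) ⟩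
      2 * (W j * y r)                      ≤⟨ *-monoʳ-≤ 2 (*-monoʳ-≤ (W j) (y≤a+d r)) ⟩
      2 * (W j * (a (suc r) + d r))        ≡⟨ eq₂ (W j) (a (suc r)) (d r) ⟩
      2 * W j * a (suc r) + 2 * W j * d r  ≤⟨ +-monoʳ-≤ (2 * W j * a (suc r)) small ⟩
      2 * W j * a (suc r) + 2 ^ j          ∎))
      where
      eq₁ : ∀ w a x → 2 * w * a + x + x ≡ 2 * (x + w * a)
      eq₁ = solve-∀
      eq₂ : ∀ w a x → 2 * (w * (a + x)) ≡ 2 * w * a + 2 * w * x
      eq₂ = solve-∀

    -- Each of the `2 * W j` steps gains the corresponding fraction of 2^j, so the size doubles
    -- unless the scale becomes ripe sooner.
    stage : ∀ j r → 2 ^ j ≤ a r → (∀ r′ → r′ < r + 2 * W j → 2 * W j * d r′ ≤ 2 ^ j) → Ripe j (r + 2 * W j)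
    stage j r big small = finish (go (2 * W j) ≤-refl)
      where
      go : ∀ t → t ≤ 2 * W j → Ripe j (r + t) ⊎ 2 * W j * 2 ^ j + t * 2 ^ j ≤ 2 * W j * a (r + t)
      go zero _ = inj₂ (≤-trans (≤-reflexive (+-identityʳ _)) (*-monoʳ-≤ (2 * W j) (≤-trans big (≤-reflexive (cong a (sym (+-identityʳ r)))))))
      go (suc t) h with go t (≤-trans (n≤1+n t) h)
      ... | inj₁ p = inj₁ (ripe-mono {j} (+-monoʳ-≤ r (n≤1+n t)) p)
      ... | inj₂ p with one-step j (r + t) (≤-trans big (mono-≤ a a-mono (m≤m+n r t))) (small (r + t) (+-monoʳ-< r h))
      ... | inj₁ q = inj₁ (subst (Ripe j) (sym (+-suc r t)) q)
      ... | inj₂ q = inj₂ (begin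
        2 * W j * 2 ^ j + (2 ^ j + t * 2 ^ j)  ≡⟨ x+[y+z] (2 * W j * 2 ^ j) (2 ^ j) (t * 2 ^ j) ⟩
        2 * W j * 2 ^ j + t * 2 ^ j + 2 ^ j    ≤⟨ +-monoˡ-≤ (2 ^ j) p ⟩
        2 * W j * a (r + t) + 2 ^ j            ≤⟨ q ⟩
        2 * W j * a (suc (r + t))              ≡⟨ cong (λ z → 2 * W j * a z) (sym (+-suc r t)) ⟩
        2 * W j * a (r + suc t)                ∎)
      eq : ∀ w x → w * (2 * x) ≡ w * x + w * x
      eq = solve-∀
      finish : Ripe j (r + 2 * W j) ⊎ 2 * W j * 2 ^ j + 2 * W j * 2 ^ j ≤ 2 * W j * a (r + 2 * W j) → Ripe j (r + 2 * W j)
      finish (inj₁ p) = p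
      finish (inj₂ p) = inj₂ (*-cancelˡ-≤ (2 * W j) {{W≢0 j}} (≤-trans (≤-reflexive (eq (2 * W j) (2 ^ j))) p))

    growth : ∀ j₀ → 2 ^ j₀ ≤ a (R j₀) → (∀ j r → j₀ ≤ j → r < R (suc j) → 2 * W j * d r ≤ 2 ^ j) →
             ∀ i → n < 2 * a (R (j₀ + i)) ⊎ 2 ^ (j₀ + i) ≤ a (R (j₀ + i))
    growth j₀ base small zero = inj₂ (subst (λ j → 2 ^ j ≤ a (R j)) (sym (+-identityʳ j₀)) base)
    growth j₀ base small (suc i) = subst (λ j → n < 2 * a (R j) ⊎ 2 ^ j ≤ a (R j)) (sym (+-suc j₀ i)) (next (growth j₀ base small i))
      where
      j = j₀ + i
      next : n < 2 * a (R j) ⊎ 2 ^ j ≤ a (R j) → Ripe j (R (suc j))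
      next (inj₁ p) = ripe-mono {j} (R-mono (n≤1+n j)) (inj₁ p)
      next (inj₂ p) = ripe-mono {j} (R-step j) (stage j (R j) p (λ r h → small j r (m≤m+n j₀ i) (≤-trans h (R-step j))))

    -- At scale `K + 1` the doubling alternative would give a ball with more than `n` vertices.
    majority : ∀ j₀ K → j₀ ≤ suc K → n < 2 ^ suc K → 2 ^ j₀ ≤ a (R j₀) →
      (∀ j r → j₀ ≤ j → r < R (suc j) → 2 * W j * d r ≤ 2 ^ j) → n < 2 * a (R (suc K))
    majority j₀ K h hi base small with growth j₀ base small (suc K ∸ j₀)
    ... | g rewrite m+[n∸m]≡n h with g
    ... | inj₁ p = p
    ... | inj₂ p = ⊥-elim (<⇒≱ hi (≤-trans p (a≤n _)))

-- The minimal dense core, its expansion and its vertices of high degree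

module Density (J : Graph) (q₂ s₂ : ℕ) where

  open Graphs J

  c : ℕ
  c = q₂ * s₂ + 2

  1≤c : 1 ≤ c
  1≤c = ≤-trans (s≤s z≤n) (m≤n+m 2 (q₂ * s₂))

  -- Average degree at least s₂ + 2/q₂ − 1/(q₂ κ), cleared of denominators.
  Heavy : S → Set
  Heavy X = 0 < card X × κ (card X) * (c * card X) ≤ κ (card X) * (q₂ * e2 X) + card X

  Light : S → Set
  Light X = κ (card X) * (q₂ * e2 X) + card X ≤ κ (card X) * (c * card X)

  heavy? : ∀ X → Dec (Heavy X)
  heavy? X = (0 <? card X) ×-dec (κ (card X) * (c * card X) ≤? κ (card X) * (q₂ * e2 X) + card X)

  e2-mono : ∀ {X Y} → X ⊆ˢ Y → e2 X ≤ e2 Y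
  e2-mono {X} {Y} h = sum-mono (λ u → card-⊆ {X = nbrs X u} {nbrs Y u} (λ v∈ → let (a , b , d) = nbrs⁻ {X} v∈ in nbrs⁺ (h a) (h b) d))

  heavy-resp : ∀ {X Y} → X ≗ Y → Heavy X → Heavy Y
  heavy-resp {X} {Y} e h = subst₂ (λ a b → 0 < a × κ a * (c * a) ≤ κ a * (q₂ * b) + a) (card-cong e)
    (≤-antisym (e2-mono {X} {Y} (λ {v} p → trans (sym (e v)) p)) (e2-mono {Y} {X} (λ {v} p → trans (e v) p))) h

  ¬heavy⇒light : ∀ {X} → ¬ Heavy X → 0 < card X → Light X
  ¬heavy⇒light {X} ¬h pos with κ (card X) * (c * card X) ≤? κ (card X) * (q₂ * e2 X) + card X
  ... | yes p = ⊥-elim (¬h (pos , p))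
  ... | no q = <⇒≤ (≰⇒> q)

  record Core : Set where
    field
      A     : S
      heavy : Heavy A
      light : ∀ {Y} → card Y < card A → 0 < card Y → Light Y

  core : ∀ X → Heavy X → Core
  core X h = go (card X) X ≤-refl h
    where
    go : ∀ fuel X → card X ≤ fuel → Heavy X → Core
    go fuel X le h with anySubset? (λ p → (card (lookupⱽ p) <? card X) ×-dec heavy? (lookupⱽ p))
    ... | no none = record { A = X ; heavy = h ; light = λ {Y} lt → ¬heavy⇒light (λ hY → none (tabulateⱽ Y ,
            subst (_< card X) (card-cong (λ v → sym (Vec.lookup∘tabulate Y v))) lt ,
            heavy-resp (λ v → sym (Vec.lookup∘tabulate Y v)) hY)) }
    go zero X le h | yes (p , lt , h′) = ⊥-elim (<⇒≱ lt (≤-trans le z≤n))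
    go (suc fuel) X le h | yes (p , lt , h′) = go fuel (lookupⱽ p) (≤-pred (≤-trans lt le)) h′

  module Core-properties (K : Core) where

    open Core K public

    ∣A∣ : ℕ
    ∣A∣ = card A

    heavy-bound : κ ∣A∣ * (c * ∣A∣) ≤ κ ∣A∣ * (q₂ * e2 A) + ∣A∣
    heavy-bound = proj₂ heavy

    density : c * ∣A∣ ≤ q₂ * e2 A + ∣A∣
    density = subst₂ (λ x y → x ≤ y + ∣A∣) (*-identityˡ _) (*-identityˡ _) (scale-down {κ ∣A∣} {1} {c * ∣A∣} {q₂ * e2 A} (1≤κ ∣A∣) heavy-bound)

    closure : S → S
    closure X = A ∩ˢ N[ X ]

    module _ {X : S} (X⊆A : X ⊆ˢ A) (pos : 0 < card X) where

      X⊆closure : X ⊆ˢ closure X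
      X⊆closure p = ∈∩⁺ (X⊆A p) (X⊆N p)

      card-split : card A ≡ card (A ∖ˢ X) + card X
      card-split = ≤-antisym (card-∪ split) (card-⊎ (proj₁ ∘ ∈∖⁻) X⊆A (proj₂ ∘ ∈∖⁻))
        where
        split : ∀ {v} → v ∈ˢ A → v ∈ˢ A ∖ˢ X ⊎ v ∈ˢ X
        split {v} v∈ with v ∈ˢ? X
        ... | yes p = inj₂ p
        ... | no r  = inj₁ (∈∖⁺ v∈ r)

      edge-split : e2 A ≤ e2 (A ∖ˢ X) + e2 (closure X)
      edge-split = e2-cover pt
        where
        pt : ∀ {u v} → u ∈ˢ A → v ∈ˢ A → Adj J u v → (u ∈ˢ A ∖ˢ X × v ∈ˢ A ∖ˢ X) ⊎ (u ∈ˢ closure X × v ∈ˢ closure X)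
        pt {u} {v} u∈ v∈ a with u ∈ˢ? X | v ∈ˢ? X
        ... | yes p | _     = inj₂ (X⊆closure p , ∈∩⁺ v∈ (∈N⁺ p (inj₂ a)))
        ... | no _  | yes p = inj₂ (∈∩⁺ u∈ (∈N⁺ p (inj₂ (adj-symm a))) , X⊆closure p)
        ... | no p  | no r  = inj₁ (∈∖⁺ u∈ p , ∈∖⁺ v∈ r)

      -- The rest is light with respect to its own κ, and `scale-up` carries this to the κ of `A`.
      -- An empty rest is treated apart because lightness is known only for nonempty sets.
      rest-light : κ ∣A∣ * (q₂ * e2 (A ∖ˢ X)) + card (A ∖ˢ X) ≤ κ ∣A∣ * (c * card (A ∖ˢ X))
      rest-light with card (A ∖ˢ X) in eq
      ... | zero = ≤-reflexive (begin-equality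
          κ ∣A∣ * (q₂ * e2 (A ∖ˢ X)) + 0  ≡⟨ +-identityʳ _ ⟩
          κ ∣A∣ * (q₂ * e2 (A ∖ˢ X))      ≡⟨ cong (λ z → κ ∣A∣ * (q₂ * z)) (e2-empty {A ∖ˢ X} eq) ⟩
          κ ∣A∣ * (q₂ * 0)                ≡⟨ cong (κ ∣A∣ *_) (trans (*-zeroʳ q₂) (sym (*-zeroʳ c))) ⟩
          κ ∣A∣ * (c * 0)                 ∎)
          where open ≤-Reasoning
      ... | suc b = scale-up {κ ∣A∣} {κ (suc b)} (1≤κ (suc b)) (κ-mono (<⇒≤ smaller))
            (subst (λ z → κ z * (q₂ * e2 (A ∖ˢ X)) + z ≤ κ z * (c * z)) eq (light (subst (_< ∣A∣) (sym eq) smaller) (subst (0 <_) (sym eq) (s≤s z≤n))))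
          where
          smaller : suc b < ∣A∣
          smaller = ≤-trans (≤-reflexive (+-comm 1 (suc b))) (≤-trans (+-monoʳ-≤ (suc b) pos)
                      (≤-reflexive (trans (cong (_+ card X) (sym eq)) (sym card-split))))

      -- Every edge of `A` not inside the rest lies inside `closure X`, which must therefore supply
      -- the edges that a heavy `A` has beyond its light rest.
      left-over : κ ∣A∣ * (c * card X) ≤ κ ∣A∣ * (q₂ * e2 (closure X)) + card X
      left-over = heavy-minus-light {c} {q₂} {κ ∣A∣} {e2 A} {e2 (A ∖ˢ X)} {e2 (closure X)} {card (A ∖ˢ X)}
        (subst (λ z → κ ∣A∣ * (c * z) ≤ κ ∣A∣ * (q₂ * e2 A) + z) card-split heavy-bound) rest-light edge-split

      ∣closure∣>0 : 0 < card (closure X)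
      ∣closure∣>0 = ≤-trans pos (card-⊆ X⊆closure)

      -- The closure is small enough for κ to be larger by one at `A`, so `left-over` holds with
      -- `suc (κ (card (closure X)))`, while the closure itself is light with its own κ. These are
      -- the two sides of `expansion`.
      expands : 8 * card (closure X) ≤ 5 * ∣A∣ → card X ≤ c * (κ (card (closure X)) * suc (κ (card (closure X)))) * (card (closure X) ∸ card X)
      expands h = expansion {c} {q₂} {κ (card (closure X))} {card X} {card (closure X) ∸ card X} {e2 (closure X)}
        (scale-down {κ ∣A∣} {suc (κ (card (closure X)))} {c * card X} {q₂ * e2 (closure X)} (κ-gap ∣closure∣>0 gap) left-over)
        (subst (λ z → κ (card (closure X)) * (q₂ * e2 (closure X)) + z ≤ κ (card (closure X)) * (c * z)) (sym (m+[n∸m]≡n (card-⊆ X⊆closure))) (light y<n ∣closure∣>0))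
        where
        open ≤-Reasoning
        eq₁ : ∀ y → 32 * (2 * (y * y)) ≡ 8 * y * (8 * y)
        eq₁ = solve-∀
        eq₂ : ∀ y → 5 * y * (5 * y) ≡ 25 * (y * y)
        eq₂ = solve-∀
        -- The fraction 5/8 works because 2 (5/8)² = 25/32 < 1.
        gap : 2 * (card (closure X) * card (closure X)) ≤ ∣A∣ * ∣A∣
        gap = *-cancelˡ-≤ 32 (begin
          32 * (2 * (card (closure X) * card (closure X)))  ≡⟨ eq₁ (card (closure X)) ⟩
          8 * card (closure X) * (8 * card (closure X))     ≤⟨ *-mono-≤ h h ⟩
          5 * ∣A∣ * (5 * ∣A∣)           ≡⟨ eq₂ ∣A∣ ⟩
          25 * (∣A∣ * ∣A∣)              ≤⟨ *-monoˡ-≤ (∣A∣ * ∣A∣) (m≤m+n 25 7) ⟩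
          32 * (∣A∣ * ∣A∣)              ∎)
        y<n : card (closure X) < ∣A∣
        y<n = *-cancelˡ-< 8 _ _ (≤-<-trans h (*-monoˡ-< ∣A∣ {{ℕ.>-nonZero (proj₁ heavy)}} (m<m+n 5 {3} (s≤s z≤n))))

      open Growth c 1≤c

      expands-at-scale : ∀ j → 8 * card (closure X) ≤ 5 * ∣A∣ → 2 ^ j ≤ card X → card (closure X) < 2 ^ suc (suc j) →
        2 ^ j + W j * card X ≤ W j * card (closure X)
      expands-at-scale j h lo hi = begin
        2 ^ j + W j * card X                          ≤⟨ +-monoˡ-≤ (W j * card X) (≤-trans lo (expands h)) ⟩
        c * (κ (card (closure X)) * suc (κ (card (closure X)))) * δ + W j * card X ≤⟨ +-monoˡ-≤ _ (*-monoˡ-≤ δ (κκ≤W j (κ-bound {card (closure X)} {suc (suc j)} ∣closure∣>0 hi))) ⟩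
        W j * δ + W j * card X                        ≡⟨ *-distribˡ-+ (W j) δ (card X) ⟨
        W j * (δ + card X)                            ≡⟨ cong (W j *_) (m∸n+n≡m (card-⊆ X⊆closure)) ⟩
        W j * card (closure X)                                  ∎
        where
        open ≤-Reasoning
        δ = card (closure X) ∸ card X

    module _ {g} (girth : GirthAtLeast J g) (2≤s₂ : 2 ≤ s₂) (1≤q₂ : 1 ≤ q₂) where

      sparse : ∀ {Y} → 0 < card Y → card Y < g → suc (suc (e2 Y)) ≤ 2 * card Y
      sparse {Y} pos small = ≰⇒> (λ h → <⇒≱ small (dense⇒large girth (card Y) Y refl pos h))

      -- Here s ≥ 4 enters: the thresholds lie strictly above 2, beyond the average degree of any
      -- forest.
      2q₂<c : suc (2 * q₂) < c
      2q₂<c = ≤-trans (≤-reflexive (+-comm 2 (2 * q₂))) (+-monoˡ-≤ 2 (≤-trans (≤-reflexive (*-comm 2 q₂)) (*-monoʳ-≤ q₂ 2≤s₂)))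

      -- Below the girth the closure spans a forest, yet by `left-over` it has more than
      -- `2 * card X` in `e2`. The summand `2 * q₂` on the left, one vertex beyond the factor, comes
      -- from the forest bound and later pays for the centre of the ball.
      tree-expands : ∀ {X} → X ⊆ˢ A → 0 < card X → card (closure X) < g →
        suc (2 * q₂) * card X + 2 * q₂ ≤ 2 * q₂ * card (closure X)
      tree-expands {X} X⊆A pos small = begin
        suc (2 * q₂) * card X + 2 * q₂                  ≤⟨ +-monoˡ-≤ (2 * q₂) (+-cancelʳ-≤ (card X) _ _ bound) ⟩
        q₂ * e2 (closure X) + 2 * q₂                            ≡⟨ eq q₂ (e2 (closure X)) ⟩
        q₂ * suc (suc (e2 (closure X))) ≤⟨ *-monoʳ-≤ q₂ (sparse {closure X} (∣closure∣>0 X⊆A pos) small) ⟩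
        q₂ * (2 * card (closure X)) ≡⟨ eq′ q₂ (card (closure X)) ⟩
        2 * q₂ * card (closure X) ∎
        where
        open ≤-Reasoning
        eq : ∀ q e → q * e + 2 * q ≡ q * suc (suc e)
        eq = solve-∀
        eq′ : ∀ q y → q * (2 * y) ≡ 2 * q * y
        eq′ = solve-∀
        bound : suc (2 * q₂) * card X + card X ≤ q₂ * e2 (closure X) + card X
        bound = begin
          suc (2 * q₂) * card X + card X   ≡⟨ +-comm _ (card X) ⟩
          suc (suc (2 * q₂)) * card X      ≤⟨ *-monoˡ-≤ (card X) 2q₂<c ⟩
          c * card X                       ≡⟨ *-identityˡ _ ⟨
          1 * (c * card X)                 ≤⟨ scale-down {κ ∣A∣} {1} {c * card X} {q₂ * e2 (closure X)} (1≤κ ∣A∣) (left-over X⊆A pos) ⟩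
          1 * (q₂ * e2 (closure X)) + card X         ≡⟨ cong (_+ card X) (*-identityˡ _) ⟩
          q₂ * e2 (closure X) + card X               ∎

      -- The core is too dense for a forest, so it contains a cycle. Large girth thereby makes the
      -- core as large as the choice of scales requires.
      girth≤∣A∣ : g ≤ ∣A∣
      girth≤∣A∣ = dense⇒large girth ∣A∣ A refl (proj₁ heavy) (m≤n⇒m≤1+n (*-cancelˡ-≤ q₂ {{ℕ.>-nonZero 1≤q₂}} (+-cancelʳ-≤ ∣A∣ _ _ (begin
        q₂ * (2 * ∣A∣) + ∣A∣     ≡⟨ eq q₂ ∣A∣ ⟩
        suc (2 * q₂) * ∣A∣       ≤⟨ *-monoˡ-≤ ∣A∣ (<⇒≤ 2q₂<c) ⟩
        c * ∣A∣                  ≤⟨ density ⟩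
        q₂ * e2 A + ∣A∣          ∎))))
        where
        open ≤-Reasoning
        eq : ∀ q y → q * (2 * y) + y ≡ suc (2 * q) * y
        eq = solve-∀

    High? : Decidable (λ v → v ∈ˢ A × s₂ < card (nbrs A v))
    High? v = (v ∈ˢ? A) ×-dec (s₂ <? card (nbrs A v))

    High : S
    High = ⟪ High? ⟫

    -- The average degree in the core is at least s₂ + 1/q₂. Vertices outside `High` contribute at
    -- most s₂ each, and those in `High` at most D.
    many-high : ∀ {D} → MaxDegreeAtMost J D → ∣A∣ ≤ q₂ * D * card High
    many-high {D} maxdeg = +-cancelʳ-≤ (q₂ * (s₂ * ∣A∣) + ∣A∣) _ _ (begin
      ∣A∣ + (q₂ * (s₂ * ∣A∣) + ∣A∣)                  ≡⟨ eq₁ q₂ s₂ ∣A∣ ⟩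
      c * ∣A∣                                        ≤⟨ density ⟩
      q₂ * e2 A + ∣A∣                                ≤⟨ +-monoˡ-≤ ∣A∣ (*-monoʳ-≤ q₂ degrees) ⟩
      q₂ * (s₂ * ∣A∣ + D * card High) + ∣A∣          ≡⟨ eq₂ q₂ (s₂ * ∣A∣) D (card High) ∣A∣ ⟩
      q₂ * D * card High + (q₂ * (s₂ * ∣A∣) + ∣A∣)   ∎)
      where
      open ≤-Reasoning
      eq₁ : ∀ q s a → a + (q * (s * a) + a) ≡ (q * s + 2) * a
      eq₁ = solve-∀
      eq₂ : ∀ q x D h a → q * (x + D * h) + a ≡ q * D * h + (q * x + a)
      eq₂ = solve-∀
      pt : ∀ u → Dec (u ∈ˢ A) → Dec (s₂ < card (nbrs A u)) → card (nbrs A u) ≤ s₂ * 𝟙 (A u) + D * 𝟙 (High u)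
      pt u (no u∉) _ = ≤-trans (≤-trans (card-⊆ {Y = ∅ˢ} (λ v∈ → ⊥-elim (u∉ (proj₁ (nbrs⁻ v∈))))) (≤-reflexive card-∅)) z≤n
      pt u (yes u∈) (yes deg) = ≤-trans (card-⊆ {Y = ⟪ adj? u ⟫} (λ v∈ → ∈⟪⟫⁺ (adj? u) (proj₂ (proj₂ (nbrs⁻ {A} v∈)))))
              (≤-trans (card-adj maxdeg u) (≤-trans (≤-reflexive (sym (trans (cong (D *_) (𝟙-true (∈⟪⟫⁺ High? (u∈ , deg)))) (*-identityʳ D)))) (m≤n+m _ (s₂ * 𝟙 (A u)))))
      pt u (yes u∈) (no small) = ≤-trans (≮⇒≥ small) (≤-trans (≤-reflexive (sym (trans (cong (s₂ *_) (𝟙-true u∈)) (*-identityʳ s₂)))) (m≤m+n _ _))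
      opaque
        unfolding card
        collect : sum (λ u → s₂ * 𝟙 (A u) + D * 𝟙 (High u)) ≡ s₂ * card A + D * card High
        collect = trans (sum-+ (λ u → s₂ * 𝟙 (A u)) (λ u → D * 𝟙 (High u))) (cong₂ _+_ (sum-*ˡ s₂ (𝟙 ∘ A)) (sum-*ˡ D (𝟙 ∘ High)))
      degrees : e2 A ≤ s₂ * ∣A∣ + D * card High
      degrees = ≤-trans (sum-mono (λ u → pt u (u ∈ˢ? A) (s₂ <? card (nbrs A u)))) (≤-reflexive collect)

-- Routing between branch vertices, one pair after another

Simple : ∀ {s} → List (Fin s × Fin s) → Set
Simple [] = ⊤
Simple ((i , j) ∷ es) = i ≢ j × (i , j) ∉ es × (j , i) ∉ es × Simple es

module Routing (J : Graph) {D} (maxdeg : MaxDegreeAtMost J D) (A : Sub (n J)) {s : ℕ} (v : Fin s → V J)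
  (v∈A : ∀ i → v i ∈ˢ A) (ρ sep : ℕ)
  (far : ∀ {i j} → i ≢ j → v j ∉ˢ Graphs.ball J A (v i) sep) where

  open Graphs J

  Clear : Fin s → Fin s → V J → Set
  Clear i j w = ∀ k → k ≢ i → k ≢ j → w ∉ˢ ball A (v k) ρ

  clear? : ∀ i j w → Dec (Clear i j w)
  clear? i j w = Fin.all? (λ k → ¬? (k Fin.≟ i) →-dec (¬? (k Fin.≟ j) →-dec ¬? (w ∈ˢ? ball A (v k) ρ)))

  Allowed : Fin s → Fin s → S → V J → Set
  Allowed i j F w = w ∈ˢ A × (w ≡ v i ⊎ w ≡ v j ⊎ (Clear i j w × w ∉ˢ F))

  allowed? : ∀ i j F → Decidable (Allowed i j F)
  allowed? i j F w = (w ∈ˢ? A) ×-dec ((w Fin.≟ v i) ⊎-dec ((w Fin.≟ v j) ⊎-dec (clear? i j w ×-dec ¬? (w ∈ˢ? F))))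

  opaque
    allowed : Fin s → Fin s → S → S
    allowed i j F = ⟪ allowed? i j F ⟫

    allowed⁻ : ∀ {i j F w} → w ∈ˢ allowed i j F → Allowed i j F w
    allowed⁻ {i} {j} {F} = ∈⟪⟫⁻ (allowed? i j F)

    allowed⁺ : ∀ {i j F w} → Allowed i j F w → w ∈ˢ allowed i j F
    allowed⁺ {i} {j} {F} = ∈⟪⟫⁺ (allowed? i j F)

  allowed-swap : ∀ {i j F} → allowed i j F ⊆ˢ allowed j i F
  allowed-swap {i} {j} {F} p with allowed⁻ p
  ... | a , inj₁ e = allowed⁺ (a , inj₂ (inj₁ e))
  ... | a , inj₂ (inj₁ e) = allowed⁺ (a , inj₁ e)
  ... | a , inj₂ (inj₂ (cl , f)) = allowed⁺ (a , inj₂ (inj₂ ((λ k k≢j k≢i → cl k k≢i k≢j) , f)))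

  allowed⊆A : ∀ {i j F} → allowed i j F ⊆ˢ A
  allowed⊆A p = proj₁ (allowed⁻ p)

  Route : Fin s → Fin s → S → Set
  Route i j F = Geo (allowed i j F) (v i) (v j)

  Wake : ∀ {H x y} → Geo H x y → V J → Set
  Wake γ w = ∃ λ (t : Fin (len γ)) → 0 < toℕ t × Near (at γ (toℕ t)) w

  wake? : ∀ {H x y} (γ : Geo H x y) → Decidable (Wake γ)
  wake? γ w = Fin.any? (λ t → (0 <? toℕ t) ×-dec near? (at γ (toℕ t)) w)

  opaque
    wake : ∀ {H x y} → Geo H x y → S
    wake γ = ⟪ wake? γ ⟫

    wake⁻ : ∀ {H x y} {γ : Geo H x y} {w} → w ∈ˢ wake γ → ∃ λ t → 0 < t × t < len γ × Near (at γ t) w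
    wake⁻ {γ = γ} p with ∈⟪⟫⁻ (wake? γ) p
    ... | t , pos , near = toℕ t , pos , Fin.toℕ<n t , near

    wake⁺ : ∀ {H x y} {γ : Geo H x y} {w t} → 0 < t → t < len γ → Near (at γ t) w → w ∈ˢ wake γ
    wake⁺ {γ = γ} {w} pos lt near = ∈⟪⟫⁺ (wake? γ) (Fin.fromℕ< lt ,
      subst (0 <_) (sym (Fin.toℕ-fromℕ< lt)) pos , subst (λ t → Near (at γ t) w) (sym (Fin.toℕ-fromℕ< lt)) near)

    card-wake : ∀ {H x y} (γ : Geo H x y) → card (wake γ) ≤ len γ * suc D
    card-wake γ = card-⋃-const (λ t → ⟪ near? (at γ (toℕ t)) ⟫) (λ t → card-near maxdeg (at γ (toℕ t)))
      (λ p → let (t , _ , near) = ∈⟪⟫⁻ (wake? γ) p in t , ∈⟪⟫⁺ (near? (at γ (toℕ t))) near)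

  -- Routes laid so far, most recent first; F collects the closed neighbourhoods of
  -- their interiors, which every later route must avoid.
  data Plan (L : ℕ) : List (Fin s × Fin s) → S → Set where
    []     : Plan L [] ∅ˢ
    extend : ∀ {es F i j} → Plan L es F → (γ : Route i j F) → len γ ≤ L → Plan L ((i , j) ∷ es) (F ∪ˢ wake γ)

  card-forbidden : ∀ {L es F} → Plan L es F → card F ≤ length es * (L * suc D)
  card-forbidden [] = ≤-reflexive card-∅
  card-forbidden {L} (extend {es} {F} P γ l) = ≤-trans (card-∪ {Y = wake γ} {F} (Sum.swap ∘ ∈∪⁻))
    (+-mono-≤ (≤-trans (card-wake γ) (*-monoˡ-≤ (suc D) l)) (card-forbidden P))

  interior-allowed : ∀ {i j F} (γ : Route i j F) {t} → 0 < t → t < len γ → Clear i j (at γ t) × at γ t ∉ˢ F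
  interior-allowed γ {t} pos lt with allowed⁻ (at∈H γ (<⇒≤ lt))
  ... | _ , inj₁ e = ⊥-elim (<-irrefl (sym (at-injective γ (<⇒≤ lt) z≤n (trans e (sym (at-0 γ))))) pos)
  ... | _ , inj₂ (inj₁ e) = ⊥-elim (<-irrefl (at-injective γ (<⇒≤ lt) ≤-refl (trans e (sym (at-len γ)))) lt)
  ... | _ , inj₂ (inj₂ p) = p

  route-long : ∀ {i j F′} → i ≢ j → (γ : Route i j F′) → sep < len γ
  route-long i≢j γ = ≰⇒> (λ le → far i≢j (subst (_∈ˢ ball A _ sep) (at-len γ)
    (ball-mono le (ball-resp (len γ) allowed⊆A (at-ball γ ≤-refl)))))

  -- Growth of a ball around a branch vertex while avoiding the routes laid so far

  module Source {a b : Fin s} (a≢b : a ≢ b) {L es F} (P : Plan L es F) where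

    H : S
    H = allowed a b F

    X Y : ℕ → S
    X r = ball H (v a) r
    Y r = A ∩ˢ N[ X r ]

    va∈H : v a ∈ˢ H
    va∈H = allowed⁺ (v∈A a , inj₁ refl)

    X⊆A : ∀ r → X r ⊆ˢ A
    X⊆A r p = allowed⊆A (ball⊆ r p)

    X-close : ∀ r → X r ⊆ˢ ball A (v a) r
    X-close r = ball-resp r allowed⊆A

    Y-close : ∀ r → Y r ⊆ˢ ball A (v a) (suc r)
    Y-close r p with ∈∩⁻ p
    ... | w∈A , q with ∈N⁻ q
    ... | u , u∈ , near = ball-suc⁺ (X-close r u∈) near w∈A

    Y⊆X∪ : ∀ r {w} → w ∈ˢ Y r → w ∈ˢ X (suc r) ⊎ w ∈ˢ Y r ∖ˢ H
    Y⊆X∪ r {w} p with w ∈ˢ? H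
    ... | no q = inj₂ (∈∖⁺ p q)
    ... | yes q with ∈N⁻ (proj₂ (∈∩⁻ p))
    ... | u , u∈ , near = inj₁ (ball-suc⁺ u∈ near q)

    close-clear : ∀ {r k w} → r + ρ ≤ sep → w ∈ˢ ball A (v a) r → k ≢ a → w ∉ˢ ball A (v k) ρ
    close-clear le p k≢a q = far (k≢a ∘ sym) (ball-mono le (ball-trans ρ p (ball-sym ρ q)))

    close≢ : ∀ {r k w} → r ≤ sep → w ∈ˢ ball A (v a) r → k ≢ a → w ≢ v k
    close≢ le p k≢a refl = far (k≢a ∘ sym) (ball-mono le p)

    blocked : ∀ {r w} → w ∈ˢ Y r ∖ˢ H → w ∈ˢ F ⊎ ∃ λ k → k ≢ a × w ∈ˢ ball A (v k) ρ
    blocked {r} {w} p with w ∈ˢ? F | ∈∖⁻ p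
    ... | yes q | _ = inj₁ q
    ... | no q | w∈Y , w∉H with Fin.any? (λ k → ¬? (k Fin.≟ a) ×-dec (w ∈ˢ? ball A (v k) ρ))
    ... | yes z = inj₂ z
    ... | no ¬z = ⊥-elim (w∉H (allowed⁺ (proj₁ (∈∩⁻ w∈Y) , inj₂ (inj₂ ((λ k k≢a _ z → ¬z (k , k≢a , z)) , q)))))

    deducted-close : ∀ {r} → suc r + ρ ≤ sep → Y r ∖ˢ H ⊆ˢ F
    deducted-close {r} le p with blocked p
    ... | inj₁ q = q
    ... | inj₂ (k , k≢a , q) = ⊥-elim (close-clear le (Y-close r (proj₁ (∈∖⁻ p))) k≢a q)

    deducted : ∀ r → card (Y r ∖ˢ H) ≤ card F + s * suc D ^ ρ
    deducted r = ≤-trans (card-∪ {Y = F} {⟪ guarded? ⟫} sp)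
      (+-monoʳ-≤ (card F) (card-⋃-const (λ k → ball A (v k) ρ) (λ k → card-ball maxdeg A (v k) ρ) (∈⟪⟫⁻ guarded?)))
      where
      guarded? : Decidable (λ w → ∃ λ k → w ∈ˢ ball A (v k) ρ)
      guarded? w = Fin.any? (λ k → w ∈ˢ? ball A (v k) ρ)
      sp : ∀ {w} → w ∈ˢ Y r ∖ˢ H → w ∈ˢ F ⊎ w ∈ˢ ⟪ guarded? ⟫
      sp p with blocked p
      ... | inj₁ q = inj₁ q
      ... | inj₂ (k , _ , q) = inj₂ (∈⟪⟫⁺ guarded? (k , q))

    -- Close to v a only the routes ending at v a matter, and of these only a short
    -- initial piece, because they were geodesics when they were laid.

    Incident : Fin s → Fin s → Set
    Incident i j = i ≡ a ⊎ j ≡ a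

    incident? : ∀ i j → Dec (Incident i j)
    incident? i j = (i Fin.≟ a) ⊎-dec (j Fin.≟ a)

    not-end : ∀ {i j k} → Incident i j → k ≢ i → k ≢ j → k ≢ a
    not-end (inj₁ refl) k≢i _ = k≢i
    not-end (inj₂ refl) _ k≢j = k≢j

    end-allowed : ∀ {i j F′ w} → Incident i j → w ∈ˢ A → w ≡ v a → w ∈ˢ allowed i j F′
    end-allowed (inj₁ refl) w∈A e = allowed⁺ (w∈A , inj₁ e)
    end-allowed (inj₂ refl) w∈A e = allowed⁺ (w∈A , inj₂ (inj₁ e))

    -- A route with an end at `v a` is read away from `v a`, whichever end that is; the far end
    -- stays unnamed so that both orientations share one type.
    Outward : Fin s → Fin s → S → Set
    Outward i j F′ = ∃ λ z → Geo (allowed i j F′) (v a) z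

    orient : ∀ {i j F′} → Incident i j → Route i j F′ → Outward i j F′
    orient (inj₁ refl) γ = _ , γ
    orient (inj₂ refl) γ = _ , geo-reverse γ

    record Hit (r : ℕ) (w : V J) {i j F′} (o : Outward i j F′) : Set where
      field
        t     : ℕ
        pos   : 0 < t
        t≤len : t ≤ len (proj₂ o)
        t≤    : t ≤ suc (suc r)
        near  : Near (at (proj₂ o) t) w

    module Local {r} (r<ρ : suc (suc r) ≤ ρ) (r+ρ≤sep : suc r + ρ ≤ sep) where

      ≤sep : ∀ {m} → m ≤ suc r → m ≤ sep
      ≤sep h = ≤-trans h (≤-trans (m≤m+n (suc r) ρ) r+ρ≤sep)

      -- Less was forbidden when the earlier route was laid, and this close to `v a` no other
      -- guarded ball intervenes. So distances from `v a` were then at most what they are now within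
      -- the present ball.
      X⊆earlier : ∀ {i j F′} → F′ ⊆ˢ F → Incident i j → X r ⊆ˢ ball (allowed i j F′) (v a) r
      X⊆earlier {i} {j} {F′} F′⊆F inc = ball-⊆ r sub
        where
        sub : ∀ {r′ w} → r′ ≤ r → w ∈ˢ ball H (v a) r′ → w ∈ˢ allowed i j F′
        sub {r′} {w} le p with allowed⁻ (ball⊆ r′ p)
        ... | w∈A , inj₁ e = end-allowed inc w∈A e
        ... | w∈A , inj₂ (inj₁ e) = ⊥-elim (close≢ (≤sep (m≤n⇒m≤1+n le)) (X-close r′ p) (a≢b ∘ sym) e)
        ... | w∈A , inj₂ (inj₂ (_ , w∉F)) = allowed⁺ (w∈A , inj₂ (inj₂
          ((λ k k≢i k≢j → close-clear (≤-trans (+-monoˡ-≤ ρ (m≤n⇒m≤1+n le)) r+ρ≤sep) (X-close r′ p) (not-end inc k≢i k≢j)) , w∉F ∘ F′⊆F)))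

      -- When `γ` was laid, `w` was allowed and within distance `r + 1` of `v a`, so the vertex of
      -- `γ` next to it was within `r + 2`. On a geodesic from `v a` distance equals position.
      hit : ∀ {i j F′ w} → F′ ⊆ˢ F → (inc : Incident i j) (γ : Route i j F′) → w ∈ˢ wake γ → w ∉ˢ F′ → w ∈ˢ Y r →
            Hit r w (orient inc γ)
      hit {i} {j} {F′} {w} F′⊆F inc γ w∈wake w∉F′ w∈Y = outward inc
        where
        w∈H : w ∈ˢ allowed i j F′
        w∈H = allowed⁺ (proj₁ (∈∩⁻ w∈Y) , inj₂ (inj₂ ((λ k k≢i k≢j → close-clear r+ρ≤sep (Y-close r w∈Y) (not-end inc k≢i k≢j)) , w∉F′)))
        w-ball : w ∈ˢ ball (allowed i j F′) (v a) (suc r)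
        w-ball with ∈N⁻ (proj₂ (∈∩⁻ w∈Y))
        ... | u , u∈ , near = ball-suc⁺ (X⊆earlier F′⊆F inc u∈) near w∈H
        outward : (inc′ : Incident i j) → Hit r w (orient inc′ γ)
        outward (inj₁ refl) with wake⁻ {γ = γ} w∈wake
        ... | t , pos , lt , near = record { t = t ; pos = pos ; t≤len = <⇒≤ lt
            ; t≤ = geodesic γ (<⇒≤ lt) (ball-suc⁺ w-ball (near-symm near) (at∈H γ (<⇒≤ lt))) ; near = near }
        outward (inj₂ refl) with wake⁻ {γ = γ} w∈wake
        ... | t , pos , lt , near = record { t = len γ ∸ t ; pos = m<n⇒0<n∸m lt ; t≤len = m∸n≤m (len γ) t
            ; t≤ = geodesic (geo-reverse γ) (m∸n≤m (len γ) t) (subst (_∈ˢ ball (allowed i j F′) (v a) (suc (suc r))) (cong (at γ) (sym back))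
                     (ball-suc⁺ w-ball (near-symm near) (at∈H γ (<⇒≤ lt))))
            ; near = subst (λ m → Near (at γ m) w) (sym back) near }
            where
            back : len γ ∸ (len γ ∸ t) ≡ t
            back = m∸[m∸n]≡n (<⇒≤ lt)

      -- The interior of such a route stays out of the guarded ball of radius `ρ` around `v a`, and
      -- a wake reaches only one step further in.
      miss : ∀ {i j F′ w} → ¬ Incident i j → (γ : Route i j F′) → w ∈ˢ wake γ → w ∉ˢ Y r
      miss {i} {j} ¬inc γ w∈wake w∈Y with wake⁻ {γ = γ} w∈wake
      ... | t , pos , lt , near = proj₁ (interior-allowed γ pos lt) a (λ e → ¬inc (inj₁ (sym e))) (λ e → ¬inc (inj₂ (sym e)))
              (ball-mono r<ρ (ball-suc⁺ (Y-close r w∈Y) (near-symm near) (allowed⊆A (at∈H γ (<⇒≤ lt)))))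

      -- Each forbidden vertex is charged to the oldest route with it in its wake, and there to one
      -- of the positions 0, ..., r + 2. This makes the bound independent of the lengths of the
      -- routes.
      card-hits : ∀ {es′ F′} → Plan L es′ F′ → F′ ⊆ˢ F → card (Y r ∩ˢ F′) ≤ length es′ * ((3 + r) * suc D)
      card-hits [] _ = ≤-trans (card-⊆ (proj₂ ∘ ∈∩⁻)) (≤-reflexive card-∅)
      card-hits (extend {es′} {F′} {i} {j} P′ γ _) sub = ≤-trans
        (card-∪ {Y = (Y r ∖ˢ F′) ∩ˢ wake γ} {Y r ∩ˢ F′} sp) (+-mono-≤ new (card-hits P′ (λ p → sub (∈∪⁺ (inj₁ p)))))
        where
        sp : ∀ {w} → w ∈ˢ Y r ∩ˢ (F′ ∪ˢ wake γ) → w ∈ˢ (Y r ∖ˢ F′) ∩ˢ wake γ ⊎ w ∈ˢ Y r ∩ˢ F′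
        sp {w} p with w ∈ˢ? F′ | ∈∩⁻ p
        ... | yes q | w∈Y , _ = inj₂ (∈∩⁺ w∈Y q)
        ... | no q | w∈Y , w∈ with ∈∪⁻ w∈
        ... | inj₁ z = ⊥-elim (q z)
        ... | inj₂ z = inj₁ (∈∩⁺ (∈∖⁺ w∈Y q) z)
        new : card ((Y r ∖ˢ F′) ∩ˢ wake γ) ≤ (3 + r) * suc D
        new with incident? i j
        ... | no ¬inc = ≤-trans (card-⊆ {Y = ∅ˢ} (λ p → ⊥-elim (miss ¬inc γ (proj₂ (∈∩⁻ p)) (proj₁ (∈∖⁻ (proj₁ (∈∩⁻ p))))))) (≤-trans (≤-reflexive card-∅) z≤n)
        ... | yes inc = card-⋃-const {3 + r} (λ t → ⟪ near? (at (proj₂ (orient inc γ)) (toℕ t)) ⟫)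
                          (λ t → card-near maxdeg (at (proj₂ (orient inc γ)) (toℕ t))) covers
          where
          covers : ∀ {w} → w ∈ˢ (Y r ∖ˢ F′) ∩ˢ wake γ → ∃ λ t → w ∈ˢ ⟪ near? (at (proj₂ (orient inc γ)) (toℕ t)) ⟫
          covers {w} p with ∈∩⁻ p
          ... | q , z with ∈∖⁻ q
          ... | w∈Y , w∉F′ with hit (λ m → sub (∈∪⁺ (inj₁ m))) inc γ z w∉F′ w∈Y
          ... | h = Fin.fromℕ< (s≤s (Hit.t≤ h)) , ∈⟪⟫⁺ (near? _)
                      (subst (λ m → Near (at (proj₂ (orient inc γ)) m) w) (sym (Fin.toℕ-fromℕ< (s≤s (Hit.t≤ h)))) (Hit.near h))

      deducted-local : card (Y r ∖ˢ H) ≤ length es * ((3 + r) * suc D)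
      deducted-local = ≤-trans (card-⊆ (λ p → ∈∩⁺ (proj₁ (∈∖⁻ p)) (deducted-close r+ρ≤sep p))) (card-hits P id)

    -- Below the girth: a forbidden vertex near v a would close a short cycle through v a,
    -- except for the first vertices of the routes ending at v a.

    to-first : ∀ {H′ x y} (γ : Geo H′ x y) {t} → suc t ≤ len γ → at γ 1 ∈ˢ ball (full ∖₁ x) (at γ (suc t)) t
    to-first {x = x} γ {t} lt = go t lt
      where
      avoid : ∀ {t} → suc t ≤ len γ → at γ (suc t) ∈ˢ full ∖₁ x
      avoid lt = ∈∖⁺ refl (λ e → 0≢1+n (sym (at-injective γ lt z≤n (trans (∈⁅⁆ˢ⁻ e) (sym (at-0 γ))))))
      go : ∀ t → suc t ≤ len γ → at γ 1 ∈ˢ ball (full ∖₁ x) (at γ (suc t)) t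
      go zero lt = ball-zero⁺ (avoid lt)
      go (suc t) lt = ball-trans t (ball-suc⁺ (ball-zero⁺ (avoid lt)) (inj₂ (adj-symm (step γ lt))) (avoid (<⇒≤ lt))) (go t (<⇒≤ lt))

    outward-first : ∀ {i j F′} (o : Outward i j F′) → 0 < len (proj₂ o) → Adj J (v a) (at (proj₂ o) 1)
    outward-first (_ , γ) pos = subst (λ x → Adj J x (at γ 1)) (at-0 γ) (step γ pos)

    hit-first : ∀ {r w i j F′} {o : Outward i j F′} → Hit r w o → w ≢ v a → at (proj₂ o) 1 ∈ˢ ball (full ∖₁ v a) w (2 + r)
    hit-first {r} {w} {o = _ , γ} record { t = suc t ; pos = pos ; t≤len = le ; t≤ = s≤s t≤ ; near = near } w≢ =
      ball-mono (s≤s t≤) (ball-trans t (ball-suc⁺ (ball-zero⁺ (∈∖⁺ refl (w≢ ∘ ∈⁅⁆ˢ⁻))) (near-symm near)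
        (∈∖⁺ refl (λ e → 0≢1+n (sym (at-injective γ le z≤n (trans (∈⁅⁆ˢ⁻ e) (sym (at-0 γ)))))))) (to-first γ le))

    hit-pos : ∀ {r w i j F′} {o : Outward i j F′} → Hit r w o → 0 < len (proj₂ o)
    hit-pos h = ≤-trans (Hit.pos h) (Hit.t≤len h)

    first∈wake : ∀ {i j F′} → 1 ≤ sep → i ≢ j → (inc : Incident i j) (γ : Route i j F′) → at (proj₂ (orient inc γ)) 1 ∈ˢ wake γ
    first∈wake 1≤sep i≢j (inj₁ refl) γ = wake⁺ (s≤s z≤n) (≤-<-trans 1≤sep (route-long i≢j γ)) (inj₁ refl)
    first∈wake 1≤sep i≢j (inj₂ refl) γ = wake⁺ (m<n⇒0<n∸m lt) (≤-trans (≤-reflexive (sym (+-∸-assoc 1 (<⇒≤ lt)))) (m∸n≤m (len γ) 0)) (inj₁ refl)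
      where
      lt : 1 < len γ
      lt = ≤-<-trans 1≤sep (route-long i≢j γ)

    module Tree {g} (girth : GirthAtLeast J g) (simple : Simple ((a , b) ∷ es))
      {r} (r<ρ : suc (suc r) ≤ ρ) (r+ρ≤sep : suc r + ρ ≤ sep) (small : 5 + (r + r) < g) where

      open Local {r} r<ρ r+ρ≤sep

      1≤sep : 1 ≤ sep
      1≤sep = ≤sep (s≤s z≤n)

      locate : ∀ {es′ F′ w} → Simple es′ → Plan L es′ F′ → F′ ⊆ˢ F → w ∈ˢ F′ → w ∈ˢ Y r →
               ∃ λ i → ∃ λ j → ∃ λ F″ → Σ (Outward i j F″) λ o → Hit r w o × at (proj₂ o) 1 ∈ˢ F′
      locate _ [] _ () _
      locate {w = w} (i≢j , _ , _ , simple′) (extend {F = F′} {i} {j} P′ γ _) sub w∈ w∈Y with w ∈ˢ? F′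
      ... | yes q = let (i , j , F″ , o , h , f) = locate simple′ P′ (λ p → sub (∈∪⁺ (inj₁ p))) q w∈Y in i , j , F″ , o , h , ∈∪⁺ (inj₁ f)
      ... | no q with ∈∪⁻ w∈ | incident? i j
      ... | inj₁ z | _ = ⊥-elim (q z)
      ... | inj₂ z | no ¬inc = ⊥-elim (miss ¬inc γ z w∈Y)
      ... | inj₂ z | yes inc = i , j , F′ , orient inc γ , hit (λ p → sub (∈∪⁺ (inj₁ p))) inc γ z q w∈Y , ∈∪⁺ (inj₂ (first∈wake 1≤sep i≢j inc γ))

      -- A blocked `w` would be reached from `v a` in two ways: through the ball, starting with some
      -- `u` in `H`, and along an old route, starting with its first vertex. That vertex lies in `F`
      -- and `u` does not, so the two ways close a cycle of length at most `5 + 2r`.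
      unblocked : ∀ {x w} → x ∈ˢ X r → x ≢ v a → Near x w → w ∈ˢ A → w ≢ v a → w ∈ˢ H
      unblocked {x} {w} x∈ x≢ near w∈A w≢ with w ∈ˢ? H
      ... | yes p = p
      ... | no w∉H with first-step r x∈ x≢ | locate (proj₂ (proj₂ (proj₂ simple))) P id (deducted-close r+ρ≤sep (∈∖⁺ w∈Y w∉H)) w∈Y
        where
        w∈Y : w ∈ˢ Y r
        w∈Y = ∈∩⁺ w∈A (∈N⁺ x∈ near)
      ... | u , au , u∈H , x∈′ | i , j , F″ , o , h , first∈F =
        ⊥-elim (<⇒≱ small (short-cycle girth au (outward-first o (hit-pos h)) u≢first
          (ball-mono (≤-reflexive (bound r)) (ball-trans (2 + r) (ball-suc⁺ x∈′ near (∈∖⁺ refl (w≢ ∘ ∈⁅⁆ˢ⁻))) (hit-first h w≢)))))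
        where
        bound : ∀ r → suc r + (2 + r) ≡ 3 + (r + r)
        bound = solve-∀
        u≢first : u ≢ at (proj₂ o) 1
        u≢first e with allowed⁻ u∈H
        ... | _ , inj₁ q = adj⇒≢ au (sym q)
        ... | u∈A , inj₂ (inj₁ q) = close≢ 1≤sep (ball-suc⁺ (ball-zero⁺ (v∈A a)) (inj₂ au) u∈A) (a≢b ∘ sym) q
        ... | _ , inj₂ (inj₂ (_ , u∉F)) = u∉F (subst (_∈ˢ F) (sym e) first∈F)

    others : List (Fin s × Fin s) → List (Fin s)
    others [] = []
    others ((i , j) ∷ es) with i Fin.≟ a | j Fin.≟ a
    ... | yes _ | _     = j ∷ others es
    ... | no _  | yes _ = i ∷ others es
    ... | no _  | no _  = others es

    others⁻ : ∀ es {k} → k ∈ others es → (a , k) ∈ es ⊎ (k , a) ∈ es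
    others⁻ ((i , j) ∷ es) k∈ with i Fin.≟ a | j Fin.≟ a
    others⁻ ((i , j) ∷ es) (here refl) | yes refl | _ = inj₁ (here refl)
    others⁻ ((i , j) ∷ es) (there k∈)  | yes _ | _ = Sum.map there there (others⁻ es k∈)
    others⁻ ((i , j) ∷ es) (here refl) | no _ | yes refl = inj₂ (here refl)
    others⁻ ((i , j) ∷ es) (there k∈)  | no _ | yes _ = Sum.map there there (others⁻ es k∈)
    others⁻ ((i , j) ∷ es) k∈ | no _ | no _ = Sum.map there there (others⁻ es k∈)

    no-loop : ∀ es → Simple es → (a , a) ∉ es
    no-loop (_ ∷ es) (i≢j , _) (here refl) = i≢j refl
    no-loop (_ ∷ es) (_ , _ , _ , simple) (there p) = no-loop es simple p

    a∉others : ∀ es → Simple es → a ∉ others es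
    a∉others es simple a∈ = [ no-loop es simple , no-loop es simple ]′ (others⁻ es a∈)

    others-unique : ∀ es → Simple es → Unique (others es)
    others-unique [] _ = []
    others-unique ((i , j) ∷ es) (i≢j , ij∉ , ji∉ , simple) with i Fin.≟ a | j Fin.≟ a
    ... | yes refl | _ = All.¬Any⇒All¬ _ (λ p → [ ij∉ , ji∉ ]′ (others⁻ es p)) ∷ others-unique es simple
    ... | no _ | yes refl = All.¬Any⇒All¬ _ (λ p → [ ji∉ , ij∉ ]′ (others⁻ es p)) ∷ others-unique es simple
    ... | no _ | no _ = others-unique es simple

    -- The indices `a`, `b` and the far ends of the earlier routes at `a` are pairwise distinct
    -- elements of `Fin s`.
    others-few : Simple ((a , b) ∷ es) → 2 + length (others es) ≤ s
    others-few (_ , ab∉ , ba∉ , simple) = ≤-trans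
      (unique-length≤card {X = full} (a ∷ b ∷ others es) unq (λ _ → refl)) (≤-reflexive card-full)
      where
      unq : Unique (a ∷ b ∷ others es)
      unq = All.¬Any⇒All¬ _ (λ { (here e) → a≢b e ; (there p) → a∉others es simple p })
          ∷ All.¬Any⇒All¬ _ (λ p → [ ab∉ , ba∉ ]′ (others⁻ es p)) ∷ others-unique es simple

    module Legs {g} (girth : GirthAtLeast J g) (simple : Simple ((a , b) ∷ es))
      (2≤ρ : 2 ≤ ρ) (1+ρ≤sep : 1 + ρ ≤ sep) (5<g : 5 < g) where

      open Local {0} 2≤ρ 1+ρ≤sep

      1≤sep : 1 ≤ sep
      1≤sep = ≤sep (s≤s z≤n)

      nbrs⊆Y : nbrs A (v a) ⊆ˢ Y 0
      nbrs⊆Y p with nbrs⁻ p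
      ... | _ , w∈A , aw = ∈∩⁺ w∈A (∈N⁺ (ball-zero⁺ va∈H) (inj₂ aw))

      -- A route ending at `v a` forbids only its own first vertex among the neighbours of `v a`: a
      -- second one would lie on a cycle of length at most 4.
      card-legs : ∀ {es′ F′} → Simple es′ → Plan L es′ F′ → F′ ⊆ˢ F → card (nbrs A (v a) ∩ˢ F′) ≤ length (others es′)
      card-legs _ [] _ = ≤-trans (card-⊆ (proj₂ ∘ ∈∩⁻)) (≤-reflexive card-∅)
      card-legs (i≢j , _ , _ , simple′) (extend {es′} {F′} {i} {j} P′ γ _) sub = ≤-trans (card-∪ {Y = New} {nbrs A (v a) ∩ˢ F′} sp)
          (≤-trans (+-monoʳ-≤ (card New) (card-legs simple′ P′ sub′)) new)
        where
        sub′ : F′ ⊆ˢ F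
        sub′ p = sub (∈∪⁺ (inj₁ p))
        New = (nbrs A (v a) ∖ˢ F′) ∩ˢ wake γ
        sp : ∀ {w} → w ∈ˢ nbrs A (v a) ∩ˢ (F′ ∪ˢ wake γ) → w ∈ˢ New ⊎ w ∈ˢ nbrs A (v a) ∩ˢ F′
        sp {w} p with w ∈ˢ? F′ | ∈∩⁻ p
        ... | yes q | w∈N , _ = inj₂ (∈∩⁺ w∈N q)
        ... | no q | w∈N , w∈ with ∈∪⁻ w∈
        ... | inj₁ z = ⊥-elim (q z)
        ... | inj₂ z = inj₁ (∈∩⁺ (∈∖⁺ w∈N q) z)
        first : (inc : Incident i j) → New ⊆ˢ ⁅ at (proj₂ (orient inc γ)) 1 ⁆ˢ
        first inc {w} p with ∈∩⁻ p
        ... | q , z with ∈∖⁻ q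
        ... | w∈N , w∉F′ with w Fin.≟ at (proj₂ (orient inc γ)) 1 | nbrs⁻ w∈N
        ... | yes _ | _ = refl
        ... | no w≢ | _ , _ , aw = ⊥-elim (<⇒≱ 5<g (≤-trans (short-cycle girth aw (outward-first (orient inc γ) (hit-pos h)) w≢
                (hit-first h (adj⇒≢ aw ∘ sym))) (n≤1+n 4)))
          where
          h = hit sub′ inc γ z w∉F′ (nbrs⊆Y w∈N)
        one : Incident i j → card New ≤ 1
        one inc = ≤-trans (card-⊆ (first inc)) (≤-reflexive (card-⁅⁆ (at (proj₂ (orient inc γ)) 1)))
        new : card New + length (others es′) ≤ length (others ((i , j) ∷ es′))
        new with i Fin.≟ a | j Fin.≟ a
        ... | yes e | _     = +-monoˡ-≤ (length (others es′)) (one (inj₁ e))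
        ... | no _  | yes e = +-monoˡ-≤ (length (others es′)) (one (inj₂ e))
        ... | no p  | no q  = ≤-reflexive (cong (_+ length (others es′)) (≤-antisym (≤-trans
              (card-⊆ {Y = ∅ˢ} (λ m → ⊥-elim (miss [ p , q ]′ γ (proj₂ (∈∩⁻ m)) (nbrs⊆Y (proj₁ (∈∖⁻ (proj₁ (∈∩⁻ m)))))))) (≤-reflexive card-∅)) z≤n))

      -- At most s - 2 earlier routes end at `v a`, each spoiling one neighbour, and `v a` has at
      -- least s - 1 neighbours in the core.
      free-leg : s ≤ suc (card (nbrs A (v a))) → ∃ λ u → u ∈ˢ X 1 × u ≢ v a
      free-leg deg with card-⊈ {X = nbrs A (v a)} {nbrs A (v a) ∩ˢ F} (≤-trans (s≤s (card-legs (proj₂ (proj₂ (proj₂ simple))) P id))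
                         (≤-pred (≤-trans (others-few simple) deg)))
      ... | u , u∈N , u∉ with nbrs⁻ u∈N
      ... | _ , u∈A , au = u , ball-suc⁺ (ball-zero⁺ va∈H) (inj₂ au) u∈H , adj⇒≢ au ∘ sym
        where
        u∈H : u ∈ˢ H
        u∈H = allowed⁺ (u∈A , inj₂ (inj₂ ((λ k k≢a _ → close-clear 1+ρ≤sep (ball-suc⁺ (ball-zero⁺ (v∈A a)) (inj₂ au) u∈A) k≢a)
                                       , λ u∈F → u∉ (∈∩⁺ u∈N u∈F))))

-- j₀: scale at which growth leaves the tree regime; R k₁ and R k₂: radii from which on
-- the routes already laid, respectively the guarded balls, are negligible; E bounds the
-- number of routes.
record Scales (q₂ s₂ D E g n : ℕ) : Set where
  c : ℕ
  c = q₂ * s₂ + 2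
  open Growth c (≤-trans (s≤s z≤n) (m≤n+m 2 (q₂ * s₂))) public
  field
    j₀ k₁ k₂ top : ℕ
    j₀≤k₁ : j₀ ≤ k₁
    k₁≤k₂ : k₁ ≤ k₂
    j₀≤top : j₀ ≤ top
    n<2^   : n < 2 ^ suc top
  L : ℕ
  L = R (suc top) + R (suc top)
  ρ : ℕ
  -- The 2 covers the step from a ball to its closed neighbourhood and the step from a route to its
  -- wake, so `miss` applies up to radius `R k₁`.
  ρ = 2 + R k₁
  sep : ℕ
  -- Up to radius `R k₂` a ball then stays out of the guarded balls of the other branch vertices.
  sep = R k₂ + ρ
  field
    tree-radius : suc (2 * q₂ * j₀) ≤ R j₀
    tree-small  : suc D * 2 ^ j₀ < g
    tree-girth  : 5 + (2 * q₂ * j₀ + 2 * q₂ * j₀) < g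
    deduct-near : ∀ j → j₀ ≤ j → 2 * W j * (E * ((3 + R (suc j)) * suc D)) ≤ 2 ^ j
    deduct-mid  : ∀ j → k₁ ≤ j → 2 * W j * (E * (L * suc D)) ≤ 2 ^ j
    deduct-far  : ∀ j → k₂ ≤ j → 2 * W j * (E * (L * suc D) + (2 + s₂) * suc D ^ ρ) ≤ 2 ^ j
    spread      : q₂ * D * ((2 + s₂) * suc D ^ sep) < n

-- Choosing branch vertices and laying all routes in the core

module _ (J : Graph) {D} (maxdeg : MaxDegreeAtMost J D) (q₂ s₂ : ℕ) (1≤q₂ : 1 ≤ q₂) (2≤s₂ : 2 ≤ s₂)
  {g} (girth : GirthAtLeast J g) (C : Density.Core J q₂ s₂) where

  open Graphs J
  open Density J q₂ s₂ using (module Core-properties)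
  open Core-properties C

  module _ {E} (scales : Scales q₂ s₂ D E g ∣A∣) where

    open Scales scales

    Spread : ℕ → Set
    Spread m = Σ (Fin m → V J) λ v → (∀ i → v i ∈ˢ High) × (∀ {i j} → i ≢ j → v j ∉ˢ ball A (v i) sep)

    -- Greedy choice: by `many-high` and `spread`, the balls around the vertices chosen so far
    -- cannot cover `High`.
    spread-out : ∀ m → m ≤ 2 + s₂ → Spread m
    spread-out zero    _ = (λ ()) , (λ ()) , λ { {()} }
    spread-out (suc m) h with spread-out m (≤-trans (n≤1+n m) h)
    ... | v , high , far with card-⊈ {X = High} {⟪ covered? ⟫} (*-cancelˡ-< (q₂ * D) _ _ (≤-<-trans
          (*-monoʳ-≤ (q₂ * D) (≤-trans (card-⋃-const (λ k → ball A (v k) sep) (λ k → card-ball maxdeg A (v k) sep) (∈⟪⟫⁻ covered?))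
              (*-monoˡ-≤ (suc D ^ sep) (≤-trans (n≤1+n m) h))))
          (≤-trans spread (many-high maxdeg))))
      where
      covered? : Decidable (λ w → ∃ λ k → w ∈ˢ ball A (v k) sep)
      covered? w = Fin.any? (λ k → w ∈ˢ? ball A (v k) sep)
    ... | w , w∈ , w∉ = v′ , high′ , far′
      where
      covered? : Decidable (λ w → ∃ λ k → w ∈ˢ ball A (v k) sep)
      covered? w = Fin.any? (λ k → w ∈ˢ? ball A (v k) sep)
      v′ : Fin (suc m) → V J
      v′ zero    = w
      v′ (suc i) = v i
      high′ : ∀ i → v′ i ∈ˢ High
      high′ zero    = w∈
      high′ (suc i) = high i
      far′ : ∀ {i j} → i ≢ j → v′ j ∉ˢ ball A (v′ i) sep
      far′ {zero}  {zero}  ne _ = ne refl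
      far′ {zero}  {suc j} _  p = w∉ (∈⟪⟫⁺ covered? (j , ball-sym sep p))
      far′ {suc i} {zero}  _  p = w∉ (∈⟪⟫⁺ covered? (i , p))
      far′ {suc i} {suc j} ne p = far (ne ∘ cong suc) p

    opaque
      branching : Spread (2 + s₂)
      branching = spread-out (2 + s₂) ≤-refl

    v : Fin (2 + s₂) → V J
    v = proj₁ branching

    v∈A : ∀ i → v i ∈ˢ A
    v∈A i = proj₁ (∈⟪⟫⁻ High? (proj₁ (proj₂ branching) i))

    v-degree : ∀ i → 2 + s₂ ≤ suc (card (nbrs A (v i)))
    v-degree i = s≤s (proj₂ (∈⟪⟫⁻ High? (proj₁ (proj₂ branching) i)))

    open Routing J maxdeg A v v∈A ρ sep (proj₂ (proj₂ branching))

    R₀≤ : ∀ {j} → j₀ ≤ j → suc (2 * q₂ * j₀) ≤ R j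
    R₀≤ h = ≤-trans tree-radius (R-mono h)

    module _ {a b} (a≢b : a ≢ b) {es F} (P : Plan L es F) (simple : Simple ((a , b) ∷ es)) (few : length es ≤ E) where

      open Source a≢b P

      X-mono : ∀ r → X r ⊆ˢ X (suc r)
      X-mono r = ball-mono1 r

      -- The centre is left out because its neighbours on earlier routes are forbidden. Around all
      -- other vertices of the ball nothing is lost below the girth, except possibly `v a`, which
      -- lies in the ball anyway.
      size : ℕ → ℕ
      size t = card (X (suc t) ∖₁ v a)

      within : ∀ {t} → t < 2 * q₂ * j₀ → suc (suc (suc t)) ≤ ρ × suc (suc t) + ρ ≤ sep × 5 + (suc t + suc t) < g
      within {t} h = ≤-trans (s≤s (s≤s h)) (s≤s (≤-trans (R₀≤ j₀≤k₁) (m≤n+m (R k₁) 1)))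
                   , +-monoˡ-≤ ρ {suc (suc t)} {R k₂} (≤-trans (s≤s h) (R₀≤ (≤-trans j₀≤k₁ k₁≤k₂)))
                   , ≤-<-trans (+-monoʳ-≤ 5 (+-mono-≤ h h)) tree-girth

      module _ {t} (h : t < 2 * q₂ * j₀) where

        S′ : S
        S′ = X (suc t) ∖₁ v a

        S′-closure : ∀ {w} → w ∈ˢ closure S′ → w ≢ v a → w ∈ˢ X (suc (suc t))
        S′-closure {w} p w≢ with ∈∩⁻ p
        ... | w∈A , w∈N with ∈N⁻ w∈N
        ... | x , x∈ , near with ∈∖⁻ x∈
        ... | x∈X , x∉ = ball-suc⁺ x∈X near (Tree.unblocked girth simple {suc t} (proj₁ (within h)) (proj₁ (proj₂ (within h)))
                (proj₂ (proj₂ (within h))) x∈X (λ e → x∉ (subst (_∈ˢ ⁅ v a ⁆ˢ) (sym e) (x∈⁅x⁆ˢ (v a)))) near w∈A w≢)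

        card-S′-closure : card (closure S′) ≤ suc (size (suc t))
        card-S′-closure = ≤-trans (card-∪ {Y = ⁅ v a ⁆ˢ} {X (suc (suc t)) ∖₁ v a} sp) (≤-reflexive (cong (_+ size (suc t)) (card-⁅⁆ (v a))))
          where
          sp : ∀ {w} → w ∈ˢ closure S′ → w ∈ˢ ⁅ v a ⁆ˢ ⊎ w ∈ˢ X (suc (suc t)) ∖₁ v a
          sp {w} p with w ∈ˢ? ⁅ v a ⁆ˢ
          ... | yes q = inj₁ q
          ... | no q = inj₂ (∈∖⁺ (S′-closure p (λ e → q (subst (_∈ˢ ⁅ v a ⁆ˢ) (sym e) (x∈⁅x⁆ˢ (v a))))) q)

        S′-small : size t < 2 ^ j₀ → card (closure S′) < g
        S′-small small = ≤-<-trans (≤-trans (card-⊆ (proj₂ ∘ ∈∩⁻)) (≤-trans (card-N maxdeg S′) (*-monoʳ-≤ (suc D) (<⇒≤ small)))) tree-small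

        -- The closure of the punctured ball may contain `v a`, which `size` does not count; the
        -- extra vertex granted by `tree-expands` makes up for it.
        tree-step : size t < 2 ^ j₀ → 1 ≤ size t → suc (2 * q₂) * size t ≤ 2 * q₂ * size (suc t)
        tree-step small pos = +-cancelʳ-≤ (2 * q₂) _ _ (≤-trans
          (tree-expands girth 2≤s₂ 1≤q₂ {S′} (λ p → X⊆A (suc t) (proj₁ (∈∖⁻ p))) pos (S′-small small))
          (≤-trans (*-monoʳ-≤ (2 * q₂) card-S′-closure)
            (≤-reflexive (trans (*-suc (2 * q₂) (size (suc t))) (+-comm (2 * q₂) _)))))

      size-mono : ∀ t → size t ≤ size (suc t)
      size-mono t = card-⊆ (λ p → let (x , y) = ∈∖⁻ p in ∈∖⁺ (X-mono (suc t) x) y)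

      leg-exists : ∃ λ u → u ∈ˢ X 1 × u ≢ v a
      leg-exists = Legs.free-leg girth simple 2≤ρ 1+ρ≤sep 5<g (v-degree a)
        where
        2≤ρ : 2 ≤ ρ
        2≤ρ = m≤m+n 2 (R k₁)
        1≤Rk₂ : 1 ≤ R k₂
        1≤Rk₂ = ≤-trans (s≤s z≤n) (R₀≤ (≤-trans j₀≤k₁ k₁≤k₂))
        1+ρ≤sep : 1 + ρ ≤ sep
        1+ρ≤sep = +-monoˡ-≤ ρ {1} {R k₂} 1≤Rk₂
        5<g : 5 < g
        5<g = ≤-<-trans (m≤m+n 5 (2 * q₂ * j₀ + 2 * q₂ * j₀)) tree-girth

      1≤size : 1 ≤ size 0
      1≤size = ∈⇒card>0 (∈∖⁺ (proj₁ (proj₂ leg-exists)) (proj₂ (proj₂ leg-exists) ∘ ∈⁅⁆ˢ⁻))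

      base : 2 ^ j₀ ≤ card (X (R j₀))
      base = ≤-trans (tree-growth size (2 * q₂) j₀ {{ℕ.>-nonZero (≤-trans 1≤q₂ (m≤m+n q₂ _))}} size-mono 1≤size
               (λ t h small → tree-step h small (≤-trans 1≤size (mono-≤ size size-mono z≤n))))
             (card-⊆ (λ p → ball-mono (R₀≤ ≤-refl) (proj₁ (∈∖⁻ p))))

      -- Up to `R k₁` the loss is counted locally, position by position along the routes. Up to
      -- `R k₂` all of `F` is charged, but no guarded ball is in reach. Beyond that both are charged
      -- in full.
      deduct : ∀ j r → j₀ ≤ j → r < R (suc j) → 2 * W j * card (Y r ∖ˢ H) ≤ 2 ^ j
      deduct j r j₀≤j r< with suc j ≤? k₁ | suc j ≤? k₂
      ... | yes p | _ = ≤-trans (*-monoʳ-≤ (2 * W j) (≤-trans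
              (Local.deducted-local (s≤s (s≤s (≤-trans (<⇒≤ r<) (R-mono p)))) (+-monoˡ-≤ ρ {suc r} {R k₂} (≤-trans r< (R-mono (≤-trans p k₁≤k₂)))))
              (*-mono-≤ few (*-monoˡ-≤ (suc D) (+-monoʳ-≤ 3 (<⇒≤ r<)))))) (deduct-near j j₀≤j)
      ... | no p | yes q = ≤-trans (*-monoʳ-≤ (2 * W j) (≤-trans (≤-trans
              (card-⊆ (deducted-close (+-monoˡ-≤ ρ {suc r} {R k₂} (≤-trans r< (R-mono q))))) (card-forbidden P))
              (*-monoˡ-≤ (L * suc D) few))) (deduct-mid j (≤-pred (≰⇒> p)))
      ... | no _ | no q = ≤-trans (*-monoʳ-≤ (2 * W j) (≤-trans (deducted r)
              (+-monoˡ-≤ _ (≤-trans (card-forbidden P) (*-monoˡ-≤ (L * suc D) few))))) (deduct-far j (≤-pred (≰⇒> q)))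

      X-majority : ∣A∣ < 2 * card (ball (allowed a b F) (v a) (R (suc (top))))
      X-majority = majority ∣A∣ (card ∘ X) (card ∘ Y) (λ r → card (Y r ∖ˢ H))
        (λ r → card-⊆ (X-mono r)) (λ r → card-⊆ (X⊆A r)) (λ r → card-∪ (Y⊆X∪ r))
        (λ r j small lo hi → expands-at-scale (X⊆A r) (∈⇒card>0 (ball-mono {r = 0} z≤n (ball-zero⁺ va∈H))) j small lo hi)
        j₀ (top) (m≤n⇒m≤1+n j₀≤top) n<2^ base deduct

    next-route : ∀ {i j es F} → Plan L es F → Simple ((i , j) ∷ es) → length es ≤ E →
                 Σ (Route i j F) λ γ → len γ ≤ L
    next-route {i} {j} {es} {F} P simple@(i≢j , ij∉ , ji∉ , simple′) few = geo L within-L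
      where
      radius : ℕ
      radius = R (suc top)
      from-i from-j : S
      from-i = ball (allowed i j F) (v i) radius
      from-j = ball (allowed j i F) (v j) radius
      meet : ∃ λ w → w ∈ˢ from-i × w ∈ˢ from-j
      meet = majorities-meet {A = A} {from-i} {from-j} (λ p → allowed⊆A (ball⊆ radius p)) (λ p → allowed⊆A (ball⊆ radius p))
               (X-majority i≢j P simple few) (X-majority (i≢j ∘ sym) P (i≢j ∘ sym , ji∉ , ij∉ , simple′) few)
      within-L : v j ∈ˢ ball (allowed i j F) (v i) L
      within-L = ball-trans radius (proj₁ (proj₂ meet))
        (ball-sym radius (ball-resp {allowed j i F} {allowed i j F} radius allowed-swap (proj₂ (proj₂ meet))))

    route-all : ∀ es → Simple es → length es ≤ E → ∃ λ F → Plan L es F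
    route-all [] _ _ = ∅ˢ , []
    route-all ((i , j) ∷ es) simple few = F ∪ˢ wake (proj₁ route) , extend {i = i} {j} P (proj₁ route) (proj₂ route)
      where
      earlier : ∃ λ F → Plan L es F
      earlier = route-all es (proj₂ (proj₂ (proj₂ simple))) (≤-trans (n≤1+n (length es)) few)
      F : S
      F = proj₁ earlier
      P : Plan L es F
      P = proj₂ earlier
      route : Σ (Route i j F) λ γ → len γ ≤ L
      route = next-route P simple (≤-trans (n≤1+n (length es)) few)

-- From a system of separated paths to an induced subdivision

lookup-injective : ∀ {A : Set} {xs : List A} → Unique xs → ∀ {i j} → lookup xs i ≡ lookup xs j → i ≡ j
lookup-injective (_ ∷ _)  {zero}  {zero}  _ = refl
lookup-injective (x∉ ∷ _) {zero}  {suc j} e = ⊥-elim (All.All¬⇒¬Any x∉ (subst (_∈ _) (sym e) (List∈.∈-lookup j)))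
lookup-injective (x∉ ∷ _) {suc i} {zero}  e = ⊥-elim (All.All¬⇒¬Any x∉ (subst (_∈ _) e (List∈.∈-lookup i)))
lookup-injective (_ ∷ u)  {suc i} {suc j} e = cong suc (lookup-injective u e)

consecutive-applyUpTo⁺ : ∀ {A : Set} (f : ℕ → A) {t m} → suc t < m → Consecutive (f t) (f (suc t)) (applyUpTo f m)
consecutive-applyUpTo⁺ f {zero} {suc (suc m)} _ = [] , applyUpTo (λ i → f (2 + i)) m , refl
consecutive-applyUpTo⁺ f {zero} {suc zero} (s≤s ())
consecutive-applyUpTo⁺ f {suc t} {suc m} (s≤s h) with consecutive-applyUpTo⁺ (f ∘ suc) {t} {m} h
... | as , bs , e = f 0 ∷ as , bs , cong (f 0 ∷_) e

consecutive-linked : ∀ {A : Set} {R : A → A → Set} {x y xs} → Linked R xs → Consecutive x y xs → R x y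
consecutive-linked (r ∷ _) ([] , _ , refl) = r
consecutive-linked (_ ∷ l) (_ ∷ [] , _ , refl) = consecutive-linked l ([] , _ , refl)
consecutive-linked (_ ∷ l) (_ ∷ a ∷ as , _ , refl) = consecutive-linked l (a ∷ as , _ , refl)

consecutive-map⁺ : ∀ {A B : Set} (f : A → B) {x y xs} → Consecutive x y xs → Consecutive (f x) (f y) (map f xs)
consecutive-map⁺ f (as , bs , refl) = map f as , map f bs , List.map-++ f as _

consecutive-map⁻ : ∀ {A B : Set} {f : A → B} → Injective _≡_ _≡_ f → ∀ {x y} xs →
                   Consecutive (f x) (f y) (map f xs) → Consecutive x y xs
consecutive-map⁻ inj (a ∷ b ∷ xs) ([] , bs , e) with inj (List.∷-injectiveˡ e) | inj (List.∷-injectiveˡ (List.∷-injectiveʳ e))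
... | refl | refl = [] , xs , refl
consecutive-map⁻ inj (a ∷ []) ([] , bs , ())
consecutive-map⁻ inj (a ∷ xs) (_ ∷ as , bs , e) with consecutive-map⁻ inj xs (as , bs , List.∷-injectiveʳ e)
... | as′ , bs′ , refl = a ∷ as′ , bs′ , refl
consecutive-map⁻ inj [] ([] , _ , ())
consecutive-map⁻ inj [] (_ ∷ _ , _ , ())

-- p u v 0, …, p u v (ℓ u v) is the path replacing the edge uv; only pairs u < v matter.
record Layout (J : Graph) (s : ℕ) : Set where
  open Graphs J using (Near)
  field
    b       : Fin s → V J
    b-far   : ∀ {u v} → u ≢ v → ¬ Near (b u) (b v)
    ℓ       : Fin s → Fin s → ℕ
    p       : Fin s → Fin s → ℕ → V J
  _<ᶠ_ : Fin s → Fin s → Set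
  u <ᶠ v = toℕ u < toℕ v
  field
    ℓ-pos   : ∀ {u v} → u <ᶠ v → 0 < ℓ u v
    p-start : ∀ {u v} → u <ᶠ v → p u v 0 ≡ b u
    p-end   : ∀ {u v} → u <ᶠ v → p u v (ℓ u v) ≡ b v
    p-step  : ∀ {u v t} → u <ᶠ v → t < ℓ u v → Adj J (p u v t) (p u v (suc t))
    p-inj   : ∀ {u v t t′} → u <ᶠ v → t ≤ ℓ u v → t′ ≤ ℓ u v → p u v t ≡ p u v t′ → t ≡ t′
    p-adj   : ∀ {u v t t′} → u <ᶠ v → t ≤ ℓ u v → t′ ≤ ℓ u v → Adj J (p u v t) (p u v t′) → t ≤ suc t′
    p-b-far : ∀ {u v t w} → u <ᶠ v → 0 < t → t < ℓ u v → w ≢ u → w ≢ v → ¬ Near (p u v t) (b w)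
    p-p-far : ∀ {u v u′ v′ t t′} → u <ᶠ v → u′ <ᶠ v′ → u ≢ u′ ⊎ v ≢ v′ → 0 < t → t < ℓ u v → 0 < t′ → t′ < ℓ u′ v′ →
              ¬ Near (p u v t) (p u′ v′ t′)

module Assembly {J : Graph} {s : ℕ} (layout : Layout J (suc s)) where

  open Graphs J using (Near; adj-symm; adj⇒≢)
  open Layout layout

  Q : Fin (suc s) → Fin (suc s) → List (V J)
  Q u v = applyUpTo (p u v ∘ suc) (ℓ u v ∸ 1)

  whole : ∀ {u v} → u <ᶠ v → b u ∷ Q u v ++ [ b v ] ≡ applyUpTo (p u v) (suc (ℓ u v))
  whole {u} {v} lt with ℓ u v | ℓ-pos lt | p-start lt | p-end lt
  ... | suc l | _ | ps | pe = cong₂ _∷_ (sym ps) (trans (cong (λ z → applyUpTo (p u v ∘ suc) l ++ [ z ]) (sym pe)) (List.applyUpTo-∷ʳ (p u v ∘ suc) l))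

  ∈Q⁻ : ∀ {u v x} → x ∈ Q u v → ∃ λ t → 0 < t × t < ℓ u v × x ≡ p u v t
  ∈Q⁻ {u} {v} x∈ with List∈.∈-applyUpTo⁻ (p u v ∘ suc) x∈
  ... | t , lt , e = suc t , s≤s z≤n , bound (ℓ u v) lt , e
    where
    bound : ∀ l → t < l ∸ 1 → suc t < l
    bound (suc l) h = s≤s h

  EitherWay : V J → V J → Fin (suc s) → Fin (suc s) → Set
  EitherWay x y u v = Consecutive x y (b u ∷ Q u v ++ [ b v ]) ⊎ Consecutive y x (b u ∷ Q u v ++ [ b v ])

  -- The paths have no chords: `p-adj`, applied in both directions, leaves only neighbouring
  -- positions.
  on-path : ∀ {u v t t′} → u <ᶠ v → t ≤ ℓ u v → t′ ≤ ℓ u v → Adj J (p u v t) (p u v t′) →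
            EitherWay (p u v t) (p u v t′) u v
  on-path {u} {v} {t} {t′} lt h h′ a rewrite whole lt with <-cmp t t′
  ... | tri< t<t′ _ _ = inj₁ (subst (λ m → Consecutive (p u v t) (p u v m) (applyUpTo (p u v) (suc (ℓ u v))))
                          (≤-antisym t<t′ (p-adj lt h′ h (adj-symm a)))
                          (consecutive-applyUpTo⁺ (p u v) (s≤s (≤-trans t<t′ h′))))
  ... | tri≈ _ refl _ = ⊥-elim (adj⇒≢ a refl)
  ... | tri> _ _ t′<t = inj₂ (subst (λ m → Consecutive (p u v t′) (p u v m) (applyUpTo (p u v) (suc (ℓ u v))))
                          (≤-antisym t′<t (p-adj lt h h′ a))
                          (consecutive-applyUpTo⁺ (p u v) (s≤s (≤-trans t′<t h))))

  Branch Interior Used : V J → Set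
  Branch x   = ∃ λ w → b w ≡ x
  Interior x = ∃ λ u → ∃ λ v → u <ᶠ v × x ∈ Q u v
  Used x     = Branch x ⊎ Interior x

  used? : Decidable Used
  used? x = Fin.any? (λ w → b w Fin.≟ x) ⊎-dec Fin.any? (λ u → Fin.any? (λ v → (toℕ u <? toℕ v) ×-dec mem? Fin._≟_ x (Q u v)))

  vertices : List (V J)
  vertices = filter used? (allFin (n J))

  vertices-unique : Unique vertices
  vertices-unique = Unique.filter⁺ used? (Unique.allFin⁺ (n J))

  used⇒∈ : ∀ {x} → Used x → x ∈ vertices
  used⇒∈ {x} h = List∈.∈-filter⁺ used? (List∈.∈-allFin x) h

  -- The subgraph of `J` induced on the used vertices, relabelled by their positions in `vertices`;
  -- adjacency is copied, so the embedding is induced by definition.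
  S : Graph
  S = record
    { n = length vertices
    ; adj = λ x y → adj J (lookup vertices x) (lookup vertices y)
    ; adj-sym = λ x y → adj-sym J (lookup vertices x) (lookup vertices y)
    ; irrefl = λ x → irrefl J (lookup vertices x) }

  f : V S → V J
  f = lookup vertices

  f-inj : Injective _≡_ _≡_ f
  f-inj = lookup-injective vertices-unique

  f-used : ∀ x → Used (f x)
  f-used x = proj₂ (List∈.∈-filter⁻ used? {xs = allFin (n J)} (List∈.∈-lookup x))

  f⁻¹-dec : ∀ x → Dec (Used x) → V S
  f⁻¹-dec x (yes h) = index (used⇒∈ h)
  f⁻¹-dec x (no _)  = index (used⇒∈ (inj₁ (zero , refl)))

  f⁻¹ : V J → V S
  f⁻¹ x = f⁻¹-dec x (used? x)

  f∘f⁻¹ : ∀ {x} → Used x → f (f⁻¹ x) ≡ x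
  f∘f⁻¹ {x} h = go (used? x)
    where
    go : (d : Dec (Used x)) → f (f⁻¹-dec x d) ≡ x
    go (yes h′) = sym (lookup-index (used⇒∈ h′))
    go (no ¬h)  = ⊥-elim (¬h h)

  f⁻¹∘f : ∀ x → f⁻¹ (f x) ≡ x
  f⁻¹∘f x = f-inj (f∘f⁻¹ (f-used x))

  map-f∘f⁻¹ : ∀ l → (∀ {x} → x ∈ l → Used x) → map f (map f⁻¹ l) ≡ l
  map-f∘f⁻¹ [] _ = refl
  map-f∘f⁻¹ (x ∷ l) h = cong₂ _∷_ (f∘f⁻¹ (h (here refl))) (map-f∘f⁻¹ l (h ∘ there))

  b′ : Fin (suc s) → V S
  b′ = f⁻¹ ∘ b

  Q′ : Fin (suc s) → Fin (suc s) → List (V S)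
  Q′ u v = map f⁻¹ (Q u v)

  f-b′ : ∀ w → f (b′ w) ≡ b w
  f-b′ w = f∘f⁻¹ (inj₁ (w , refl))

  Q-used : ∀ {u v x} → u <ᶠ v → x ∈ Q u v → Used x
  Q-used lt x∈ = inj₂ (_ , _ , lt , x∈)

  whole′ : ∀ {u v} → u <ᶠ v → map f (b′ u ∷ Q′ u v ++ [ b′ v ]) ≡ b u ∷ Q u v ++ [ b v ]
  whole′ {u} {v} lt = cong₂ _∷_ (f-b′ u) (trans (List.map-++ f (Q′ u v) [ b′ v ])
    (cong₂ _++_ (map-f∘f⁻¹ (Q u v) (Q-used lt)) (cong [_] (f-b′ v))))

  f-∈Q′ : ∀ {u v x} → u <ᶠ v → x ∈ Q′ u v → f x ∈ Q u v
  f-∈Q′ {u} {v} {x} lt x∈ = subst (f x ∈_) (map-f∘f⁻¹ (Q u v) (Q-used lt)) (List∈.∈-map⁺ f x∈)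

  path-unique′ : ∀ {u v} → u <ᶠ v → Unique (b u ∷ Q u v ++ [ b v ])
  path-unique′ {u} {v} lt = subst Unique (sym (whole lt)) (Unique.applyUpTo⁺₁ (p u v) _
    (λ i<j j< e → <-irrefl (p-inj lt (≤-trans (<⇒≤ i<j) (≤-pred j<)) (≤-pred j<) e) i<j))

  path-linked : ∀ {u v} → u <ᶠ v → Linked (Adj J) (b u ∷ Q u v ++ [ b v ])
  path-linked {u} {v} lt = subst (Linked (Adj J)) (sym (whole lt)) (Linked.applyUpTo⁺₁ (p u v) _ (λ i< → p-step lt (≤-pred i<)))

  b∉Q : ∀ {u v} → u <ᶠ v → ∀ w → b w ∉ Q u v
  b∉Q {u} {v} lt w b∈ with ∈Q⁻ b∈
  ... | t , pos , t< , e with w Fin.≟ u | w Fin.≟ v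
  ... | yes refl | _ = <-irrefl (p-inj lt z≤n (<⇒≤ t<) (trans (p-start lt) e)) pos
  ... | no _ | yes refl = <-irrefl (sym (p-inj lt ≤-refl (<⇒≤ t<) (trans (p-end lt) e))) t<
  ... | no w≢u | no w≢v = p-b-far lt pos t< w≢u w≢v (inj₁ (sym e))

  Q-disjoint : ∀ {u v u′ v′ x} → u <ᶠ v → u′ <ᶠ v′ → u ≢ u′ ⊎ v ≢ v′ → x ∈ Q u v → x ∉ Q u′ v′
  Q-disjoint lt lt′ ne x∈ x∈′ with ∈Q⁻ x∈ | ∈Q⁻ x∈′
  ... | t , pos , t< , e | t′ , pos′ , t′< , e′ = p-p-far lt lt′ ne pos t< pos′ t′< (inj₁ (trans (sym e) e′))

  Joined : V J → V J → Set
  Joined x y = ∃ λ u → ∃ λ v → u <ᶠ v × EitherWay x y u v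

  joined-sym : ∀ {x y} → Joined x y → Joined y x
  joined-sym (u , v , lt , inj₁ c) = u , v , lt , inj₂ c
  joined-sym (u , v , lt , inj₂ c) = u , v , lt , inj₁ c

  branch-interior : ∀ {x y} → Branch x → Interior y → Adj J x y → Joined x y
  branch-interior (w , refl) (u , v , lt , y∈) a with ∈Q⁻ y∈
  ... | t , pos , t< , refl with w Fin.≟ u | w Fin.≟ v
  ... | yes refl | _ = u , v , lt , subst (λ x → EitherWay x (p u v t) u v) (p-start lt)
                         (on-path lt z≤n (<⇒≤ t<) (subst (λ x → Adj J x (p u v t)) (sym (p-start lt)) a))
  ... | no _ | yes refl = u , v , lt , subst (λ x → EitherWay x (p u v t) u v) (p-end lt)
                         (on-path lt ≤-refl (<⇒≤ t<) (subst (λ x → Adj J x (p u v t)) (sym (p-end lt)) a))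
  ... | no w≢u | no w≢v = ⊥-elim (p-b-far lt pos t< w≢u w≢v (inj₂ (adj-symm a)))

  -- All adjacencies across distinct pieces are excluded by the separation fields of the layout,
  -- apart from those of a path with its own ends.
  adjacent-joined : ∀ {x y} → Used x → Used y → Adj J x y → Joined x y
  adjacent-joined (inj₁ (w , refl)) (inj₁ (w′ , refl)) a = ⊥-elim (b-far (λ { refl → adj⇒≢ a refl }) (inj₂ a))
  adjacent-joined (inj₁ bx) (inj₂ iy) a = branch-interior bx iy a
  adjacent-joined (inj₂ ix) (inj₁ by) a = joined-sym (branch-interior by ix (adj-symm a))
  adjacent-joined (inj₂ (u , v , lt , x∈)) (inj₂ (u′ , v′ , lt′ , y∈)) a with ∈Q⁻ x∈ | ∈Q⁻ y∈
  ... | t , pos , t< , refl | t′ , pos′ , t′< , refl with u Fin.≟ u′ | v Fin.≟ v′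
  ... | yes refl | yes refl = u , v , lt , on-path lt (<⇒≤ t<) (<⇒≤ t′<) a
  ... | no ne | _ = ⊥-elim (p-p-far lt lt′ (inj₁ ne) pos t< pos′ t′< (inj₂ a))
  ... | yes _ | no ne = ⊥-elim (p-p-far lt lt′ (inj₂ ne) pos t< pos′ t′< (inj₂ a))

  pull : ∀ {u v x y} → u <ᶠ v → Consecutive (f x) (f y) (b u ∷ Q u v ++ [ b v ]) → Consecutive x y (b′ u ∷ Q′ u v ++ [ b′ v ])
  pull {u} {v} {x} {y} lt c = consecutive-map⁻ f-inj _ (subst (Consecutive (f x) (f y)) (sym (whole′ lt)) c)

  <⇒edge : ∀ {u v} → u <ᶠ v → IsEdge (K (suc s)) u v
  <⇒edge {u} {v} lt = lt , adjacent
    where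
    adjacent : not (⌊ u Fin.≟ v ⌋) ≡ true
    adjacent with u Fin.≟ v
    ... | yes refl = ⊥-elim (<-irrefl refl lt)
    ... | no _ = refl

  subdivision : IsSubdivisionOf S (K (suc s))
  subdivision = record
    { b = b′
    ; P = Q′
    ; b-inj = λ {u} {v} e → b′-injective u v e
    ; path-unique = λ u v (lt , _) → Unique.map⁻ (subst Unique (sym (whole′ lt)) (path-unique′ lt))
    ; interior-not-branch = λ u v (lt , _) w b∈ → b∉Q lt w (subst (_∈ Q u v) (f-b′ w) (f-∈Q′ lt b∈))
    ; disjoint = λ u v u′ v′ (lt , _) (lt′ , _) ne x x∈ x∈′ → Q-disjoint lt lt′ ne (f-∈Q′ lt x∈) (f-∈Q′ lt′ x∈′)
    ; covers = λ x → cover x (f-used x)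
    ; edges→ = λ x y a → let (u , v , lt , c) = adjacent-joined (f-used x) (f-used y) a in
                 u , v , <⇒edge lt , [ inj₁ ∘ pull lt , inj₂ ∘ pull lt ]′ c
    ; edges← = λ x y u v (lt , _) c → consecutive-linked (path-linked lt)
                 (subst (Consecutive (f x) (f y)) (whole′ lt) (consecutive-map⁺ f c)) }
    where
    b′-injective : ∀ u v → b′ u ≡ b′ v → u ≡ v
    b′-injective u v e with u Fin.≟ v
    ... | yes q = q
    ... | no ne = ⊥-elim (b-far ne (inj₁ (trans (sym (f-b′ u)) (trans (cong f e) (f-b′ v)))))
    cover : ∀ x → Used (f x) → (Σ (Fin (suc s)) λ w → b′ w ≡ x) ⊎
            (Σ (Fin (suc s)) λ u → Σ (Fin (suc s)) λ v → IsEdge (K (suc s)) u v × x ∈ Q′ u v)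
    cover x (inj₁ (w , e)) = inj₁ (w , trans (cong f⁻¹ e) (f⁻¹∘f x))
    cover x (inj₂ (u , v , lt , x∈)) = inj₂ (u , v , <⇒edge lt , subst (_∈ Q′ u v) (f⁻¹∘f x) (List∈.∈-map⁺ f⁻¹ x∈))

  contains : ContainsInducedSubdivision J (K (suc s))
  contains = S , subdivision , f , f-inj , λ _ _ → refl

-- Choice of the scales

square-cancel : ∀ {a b} → a * a ≤ b * b → a ≤ b
square-cancel {a} {b} h = ≮⇒≥ (λ b<a → <⇒≱ (*-mono-< b<a b<a) h)

-- Splits a bound on a product into bounds on two squares, so that the factor depending on the scale
-- and the one depending on n can be estimated separately.
absorb : ∀ {w d x} → w * w ≤ x → d * d ≤ x → w * d ≤ x
absorb {w} {d} {x} hw hd = square-cancel (≤-trans (≤-reflexive (eq w d)) (*-mono-≤ hw hd))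
  where
  eq : ∀ w d → w * d * (w * d) ≡ w * w * (d * d)
  eq = solve-∀

≤square : ∀ d → d ≤ d * d
≤square zero    = z≤n
≤square (suc d) = m≤m*n (suc d) (suc d)

≤2^-* : ∀ {x y a b} → x ≤ 2 ^ a → y ≤ 2 ^ b → x * y ≤ 2 ^ (a + b)
≤2^-* {a = a} {b} h h′ = ≤-trans (*-mono-≤ h h′) (≤-reflexive (sym (^-distribˡ-+-* 2 a b)))

≤2^-+ : ∀ {x y a b} → x ≤ 2 ^ a → y ≤ 2 ^ b → x + y ≤ 2 ^ suc (a + b)
≤2^-+ {a = a} {b} h h′ = ≤-trans (+-mono-≤ (≤-trans h (^-monoʳ-≤ 2 (m≤m+n a b))) (≤-trans h′ (^-monoʳ-≤ 2 (m≤n+m b a))))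
  (≤-reflexive (cong (2 ^ (a + b) +_) (sym (+-identityʳ _))))

≤2^-^ : ∀ D e → suc D ^ e ≤ 2 ^ (D * e)
≤2^-^ D e = ≤-trans (^-monoˡ-≤ e (k<2^k D)) (≤-reflexive (^-*-assoc 2 D e))

module Parameters (q₂ s₂ D E : ℕ) (1≤q₂ : 1 ≤ q₂) (2≤s₂ : 2 ≤ s₂) where

  c : ℕ
  c = q₂ * s₂ + 2

  open Growth c (≤-trans (s≤s z≤n) (m≤n+m 2 (q₂ * s₂)))

  opaque
    unfolding W

    Poly-W : Poly W
    Poly-W = Poly-* (Poly-const (30 * c)) (Poly-* (Poly-suc Poly-id) (Poly-suc Poly-id))

    Poly-R : Poly R
    Poly-R = Poly-* (Poly-const (60 * c)) (Poly-* (Poly-* (Poly-suc Poly-id) (Poly-suc Poly-id)) (Poly-suc Poly-id))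

    tree-fits : ∀ j → suc (2 * q₂ * j) ≤ R j
    tree-fits j = begin
      suc (2 * q₂ * j)                            ≤⟨ s≤s (m≤n+m (2 * q₂ * j) 1) ⟩
      2 + 2 * q₂ * j                              ≤⟨ +-monoˡ-≤ (2 * q₂ * j) (*-monoʳ-≤ 2 1≤q₂) ⟩
      2 * q₂ + 2 * q₂ * j                         ≡⟨ *-suc (2 * q₂) j ⟨
      2 * q₂ * suc j                              ≤⟨ *-monoˡ-≤ (suc j) (*-mono-≤ {2} {60} (m≤m+n 2 58) q₂≤c) ⟩
      60 * c * suc j                              ≤⟨ *-monoʳ-≤ (60 * c) (m≤n*m (suc j) (suc j * suc j)) ⟩
      60 * c * (suc j * suc j * suc j)            ∎
      where
      open ≤-Reasoning
      q₂≤c : q₂ ≤ c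
      q₂≤c = ≤-trans (≤-trans (≤-reflexive (sym (*-identityʳ q₂))) (*-monoʳ-≤ q₂ (≤-trans (s≤s z≤n) 2≤s₂))) (m≤m+n (q₂ * s₂) 2)

  near-deduction : ℕ → ℕ
  near-deduction j = 2 * W j * (E * ((3 + R (suc j)) * suc D))

  Poly-R∘suc : Poly (λ j → R (suc j))
  Poly-R∘suc = Poly-∘ Poly-R (Poly-suc Poly-id)

  Poly-2W : Poly (λ j → 2 * W j)
  Poly-2W = Poly-* (Poly-const 2) Poly-W

  near-eventually : ∃ λ j → ∀ i → j ≤ i → near-deduction i ≤ 2 ^ i
  near-eventually = eventually (Poly-* Poly-2W (Poly-* (Poly-const E) (Poly-* (Poly-+ (Poly-const 3) Poly-R∘suc) (Poly-const (suc D)))))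

  W²-eventually : ∃ λ j → ∀ i → j ≤ i → 2 * W i * (2 * W i) ≤ 2 ^ i
  W²-eventually = eventually (Poly-* Poly-2W Poly-2W)

  J₀ : ℕ
  J₀ = proj₁ near-eventually ⊔ proj₁ W²-eventually

  routes : ℕ → ℕ
  routes t = E * ((R (suc t) + R (suc t)) * suc D)

  -- `k₂ k` is twice an exponent whose power of 2 bounds routes and guarded balls together, since
  -- `absorb` asks for the square. `need k` collects the exponents of all factors in `spread`; its
  -- `suc` gives strictness and its leading `k` the inequality `k ≤ need k`.
  ρ k₂ sep need : ℕ → ℕ
  ρ k    = 2 + R k
  k₂ k   = suc (k + (2 + s₂ + D * ρ k)) + suc (k + (2 + s₂ + D * ρ k))
  sep k  = R (k₂ k) + ρ k
  need k = k + suc (q₂ + D + (2 + s₂ + D * sep k))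

  Poly-need : Poly need
  Poly-need = Poly-+ Poly-id (Poly-suc (Poly-+ (Poly-const (q₂ + D)) (Poly-+ (Poly-const (2 + s₂)) (Poly-* (Poly-const D) Poly-sep))))
    where
    Poly-ρ : Poly ρ
    Poly-ρ = Poly-+ (Poly-const 2) Poly-R
    Poly-half : Poly (λ k → suc (k + (2 + s₂ + D * ρ k)))
    Poly-half = Poly-suc (Poly-+ Poly-id (Poly-+ (Poly-const (2 + s₂)) (Poly-* (Poly-const D) Poly-ρ)))
    Poly-sep : Poly sep
    Poly-sep = Poly-+ (Poly-∘ Poly-R (Poly-+ Poly-half Poly-half)) Poly-ρ

  Poly-routes : Poly routes
  Poly-routes = Poly-* (Poly-const E) (Poly-* (Poly-+ Poly-R∘suc Poly-R∘suc) (Poly-const (suc D)))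

  -- `need` is a polynomial. Hence if log n is below `need (suc k)`, the routes have total size
  -- polynomial in `k`, and 2^k overtakes its square.
  routes-eventually : ∃ λ k → ∀ i → k ≤ i → routes (need (suc i)) * routes (need (suc i)) ≤ 2 ^ i
  routes-eventually = eventually (Poly-∘ (Poly-* Poly-routes Poly-routes) (Poly-∘ Poly-need (Poly-suc Poly-id)))

  k* : ℕ
  k* = J₀ ⊔ proj₁ routes-eventually

  -- The summands serve `tree-small`, `tree-girth` and the requirement that log n be at least
  -- `need k*`.
  girth-bound : ℕ
  girth-bound = suc (suc D * 2 ^ J₀) + (suc (5 + (2 * q₂ * J₀ + 2 * q₂ * J₀)) + 2 ^ need k*)

  -- With `t` the integer part of log₂ n, `k` is taken where `need` crosses `t`: `need k ≤ t` leaves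
  -- room to spread the branch vertices, and `t < need (suc k)` keeps the routes small compared with
  -- 2^k.
  scales : ∀ n → girth-bound ≤ n → Scales q₂ s₂ D E girth-bound n
  scales n big = result (binary-scale n (≤-trans (s≤s z≤n) big))
    where
    result : (∃ λ t → 2 ^ t ≤ n × n < 2 ^ suc t) → Scales q₂ s₂ D E girth-bound n
    result (t , lo , hi) = finish (last-below need k* t need≤t (λ k → m≤m+n k _))
      where
      need≤t : need k* ≤ t
      need≤t = ≮⇒≥ (λ h → <⇒≱ hi (≤-trans (^-monoʳ-≤ 2 h) (≤-trans (≤-trans (m≤n+m (2 ^ need k*) (suc (5 + (2 * q₂ * J₀ + 2 * q₂ * J₀)))) (m≤n+m _ (suc (suc D * 2 ^ J₀)))) big)))
      finish : (∃ λ k → k* ≤ k × need k ≤ t × t < need (suc k)) → Scales q₂ s₂ D E girth-bound n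
      finish (k , k*≤k , need≤ , t<) = record
        { j₀ = J₀ ; k₁ = k ; k₂ = k₂ k ; top = t
        ; j₀≤k₁ = J₀≤k
        ; k₁≤k₂ = k≤k₂
        ; j₀≤top = ≤-trans J₀≤k (≤-trans (m≤m+n k _) need≤)
        ; n<2^ = hi
        ; tree-radius = tree-fits J₀
        ; tree-small = m≤m+n (suc (suc D * 2 ^ J₀)) _
        ; tree-girth = ≤-trans (m≤m+n (suc (5 + (2 * q₂ * J₀ + 2 * q₂ * J₀))) (2 ^ need k*)) (m≤n+m _ (suc (suc D * 2 ^ J₀)))
        ; deduct-near = λ j h → proj₂ near-eventually j (≤-trans (m≤m⊔n (proj₁ near-eventually) (proj₁ W²-eventually)) h)
        ; deduct-mid = λ j h → absorb {2 * W j} {routes t} (W² (≤-trans J₀≤k h)) (≤-trans routes² (^-monoʳ-≤ 2 h))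
        ; deduct-far = λ j h → absorb {2 * W j} {routes t + (2 + s₂) * suc D ^ ρ k} (W² (≤-trans J₀≤k (≤-trans k≤k₂ h))) (≤-trans far² (^-monoʳ-≤ 2 h))
        ; spread = ≤-trans (s≤s guard) (≤-trans (m<2m (q₂ + D + (2 + s₂ + D * sep k))) (≤-trans (^-monoʳ-≤ 2 (≤-trans (m≤n+m _ k) need≤)) lo))
        }
        where
        J₀≤k : J₀ ≤ k
        J₀≤k = ≤-trans (m≤m⊔n J₀ (proj₁ routes-eventually)) k*≤k
        k≤k₂ : k ≤ k₂ k
        k≤k₂ = ≤-trans (≤-trans (m≤m+n k (2 + s₂ + D * ρ k)) (n≤1+n _)) (m≤m+n _ _)
        W² : ∀ {j} → J₀ ≤ j → 2 * W j * (2 * W j) ≤ 2 ^ j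
        W² {j} h = proj₂ W²-eventually j (≤-trans (m≤n⊔m (proj₁ near-eventually) (proj₁ W²-eventually)) h)
        routes-mono : routes t ≤ routes (need (suc k))
        routes-mono = *-monoʳ-≤ E (*-monoˡ-≤ (suc D) (+-mono-≤ (R-mono (s≤s (<⇒≤ t<))) (R-mono (s≤s (<⇒≤ t<)))))
        routes² : routes t * routes t ≤ 2 ^ k
        routes² = ≤-trans (*-mono-≤ routes-mono routes-mono) (proj₂ routes-eventually k (≤-trans (m≤n⊔m J₀ (proj₁ routes-eventually)) k*≤k))
        ball-size : (2 + s₂) * suc D ^ ρ k ≤ 2 ^ (2 + s₂ + D * ρ k)
        ball-size = ≤2^-* {a = 2 + s₂} (<⇒≤ (k<2^k (2 + s₂))) (≤2^-^ D (ρ k))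
        far≤ : routes t + (2 + s₂) * suc D ^ ρ k ≤ 2 ^ suc (k + (2 + s₂ + D * ρ k))
        far≤ = ≤2^-+ {a = k} (≤-trans (≤square (routes t)) routes²) ball-size
        far² : (routes t + (2 + s₂) * suc D ^ ρ k) * (routes t + (2 + s₂) * suc D ^ ρ k) ≤ 2 ^ k₂ k
        far² = ≤2^-* {a = suc (k + (2 + s₂ + D * ρ k))} far≤ far≤
        guard : q₂ * D * ((2 + s₂) * suc D ^ sep k) ≤ 2 ^ (q₂ + D + (2 + s₂ + D * sep k))
        guard = ≤2^-* {a = q₂ + D} (≤2^-* {a = q₂} (<⇒≤ (k<2^k q₂)) (<⇒≤ (k<2^k D)))
                  (≤2^-* {a = 2 + s₂} (<⇒≤ (k<2^k (2 + s₂))) (≤2^-^ D (sep k)))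
        m<2m : ∀ m → 2 ^ m < 2 ^ suc m
        m<2m m = ^-monoʳ-< 2 (s≤s (s≤s z≤n)) (n<1+n m)

-- Reading the separated paths off a complete plan

pairs : ∀ s → List (Fin s × Fin s)
pairs s = filter (λ (i , j) → toℕ i <? toℕ j) (cartesianProduct (allFin s) (allFin s))

∈pairs : ∀ {s} {i j : Fin s} → toℕ i < toℕ j → (i , j) ∈ pairs s
∈pairs {s} {i} {j} lt = List∈.∈-filter⁺ (λ (i , j) → toℕ i <? toℕ j) (List∈.∈-cartesianProduct⁺ (List∈.∈-allFin i) (List∈.∈-allFin j)) lt

pairs-simple : ∀ s → Simple (pairs s)
pairs-simple s = go (pairs s)
  (Unique.filter⁺ (λ (i , j) → toℕ i <? toℕ j) (Unique.cartesianProduct⁺ (Unique.allFin⁺ s) (Unique.allFin⁺ s)))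
  (λ p → proj₂ (List∈.∈-filter⁻ (λ (i , j) → toℕ i <? toℕ j) {xs = cartesianProduct (allFin s) (allFin s)} p))
  where
  go : ∀ es → Unique es → (∀ {e} → e ∈ es → toℕ (proj₁ e) < toℕ (proj₂ e)) → Simple es
  go [] _ _ = tt
  go ((i , j) ∷ es) (e∉ ∷ u) ord = (λ { refl → <-irrefl refl (ord (here refl)) }) , All.All¬⇒¬Any e∉
    , (λ p → <-asym (ord (here refl)) (ord (there p))) , go es u (ord ∘ there)

module Extraction (J : Graph) {D} (maxdeg : MaxDegreeAtMost J D) (A : Sub (n J)) {s : ℕ} (v : Fin s → V J)
  (v∈A : ∀ i → v i ∈ˢ A) (ρ sep : ℕ) (1≤ρ : 1 ≤ ρ) (1≤sep : 1 ≤ sep)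
  (far : ∀ {i j} → i ≢ j → v j ∉ˢ Graphs.ball J A (v i) sep) where

  open Graphs J
  open Routing J maxdeg A v v∈A ρ sep far

  routeAt : ∀ {L es F i j} → Plan L es F → (i , j) ∈ es → ∃ λ F′ → Route i j F′
  routeAt (extend P γ _) (here refl) = _ , γ
  routeAt (extend P γ _) (there m)   = routeAt P m

  wake⊆F : ∀ {L es F i j} (P : Plan L es F) (m : (i , j) ∈ es) → wake (proj₂ (routeAt P m)) ⊆ˢ F
  wake⊆F (extend P γ _) (here refl) p = ∈∪⁺ (inj₂ p)
  wake⊆F (extend P γ _) (there m)   p = ∈∪⁺ (inj₁ (wake⊆F P m p))

  -- Of two routes, the later one has its interior outside the wake of the earlier one; nearness is
  -- symmetric, so the order does not matter.
  separated : ∀ {L es F i j i′ j′} (P : Plan L es F) (m : (i , j) ∈ es) (m′ : (i′ , j′) ∈ es) → i ≢ i′ ⊎ j ≢ j′ →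
    ∀ {t t′} → 0 < t → t < len (proj₂ (routeAt P m)) → 0 < t′ → t′ < len (proj₂ (routeAt P m′)) →
    ¬ Near (at (proj₂ (routeAt P m)) t) (at (proj₂ (routeAt P m′)) t′)
  separated (extend P γ _) (here refl) (here refl) (inj₁ ne) _ _ _ _ _ = ne refl
  separated (extend P γ _) (here refl) (here refl) (inj₂ ne) _ _ _ _ _ = ne refl
  separated (extend P γ _) (here refl) (there m′) _ pos lt pos′ lt′ near =
    proj₂ (interior-allowed γ pos lt) (wake⊆F P m′ (wake⁺ pos′ lt′ (near-symm near)))
  separated (extend P γ _) (there m) (here refl) _ pos lt pos′ lt′ near =
    proj₂ (interior-allowed γ pos′ lt′) (wake⊆F P m (wake⁺ pos lt near))
  separated (extend P γ _) (there m) (there m′) ne = separated P m m′ ne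

  near-ball : ∀ {r} → 1 ≤ r → ∀ {x y} → x ∈ˢ A → y ∈ˢ A → Near x y → y ∈ˢ ball A x r
  near-ball 1≤r x∈ y∈ near = ball-mono 1≤r (ball-suc⁺ (ball-zero⁺ x∈) near y∈)

  module _ {L F} (P : Plan L (pairs s) F) where

    -- The forbidden set in the type of a route varies from pair to pair. Keeping only length and
    -- positions gives one function for all pairs, and `via` carries facts about routes over to it.
    Path : Set
    Path = ℕ × (ℕ → V J)

    trace : ∀ {H x y} → Geo H x y → Path
    trace γ = len γ , at γ

    path-dec : ∀ i j → Dec (toℕ i < toℕ j) → Path
    path-dec i j (yes lt) = trace (proj₂ (routeAt P (∈pairs {i = i} {j} lt)))
    path-dec i j (no _)   = 0 , λ _ → v i

    path : Fin s → Fin s → Path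
    path i j = path-dec i j (toℕ i <? toℕ j)

    path-route : ∀ {i j} → toℕ i < toℕ j → Σ ((i , j) ∈ pairs s) λ m → trace (proj₂ (routeAt P m)) ≡ path i j
    path-route {i} {j} lt = go (toℕ i <? toℕ j)
      where
      go : (d : Dec (toℕ i < toℕ j)) → Σ ((i , j) ∈ pairs s) λ m → trace (proj₂ (routeAt P m)) ≡ path-dec i j d
      go (yes lt′) = ∈pairs lt′ , refl
      go (no ¬lt)  = ⊥-elim (¬lt lt)

    via : ∀ {i j} (Φ : Path → Set) → toℕ i < toℕ j → (∀ {F′} (γ : Route i j F′) → Φ (trace γ)) → Φ (path i j)
    via Φ lt h with path-route lt
    ... | m , e = subst Φ e (h (proj₂ (routeAt P m)))

    distinct : ∀ {i j : Fin s} → toℕ i < toℕ j → i ≢ j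
    distinct lt refl = <-irrefl refl lt

    layout : Layout J s
    layout = record
      { b = v
      ; b-far = λ {i} {j} ne near → far ne (near-ball 1≤sep (v∈A i) (v∈A j) near)
      ; ℓ = λ i j → proj₁ (path i j)
      ; p = λ i j → proj₂ (path i j)
      ; ℓ-pos = λ lt → via (λ d → 0 < proj₁ d) lt (λ γ → ≤-trans (s≤s z≤n) (route-long (distinct lt) γ))
      ; p-start = λ {i} lt → via (λ d → proj₂ d 0 ≡ v i) lt at-0
      ; p-end = λ {i} {j} lt → via (λ d → proj₂ d (proj₁ d) ≡ v j) lt at-len
      ; p-step = λ {i} {j} {t} lt → via (λ d → t < proj₁ d → Adj J (proj₂ d t) (proj₂ d (suc t))) lt (λ γ → step γ)
      ; p-inj = λ {i} {j} {t} {t′} lt → via (λ d → t ≤ proj₁ d → t′ ≤ proj₁ d → proj₂ d t ≡ proj₂ d t′ → t ≡ t′) lt (λ γ → at-injective γ)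
      ; p-adj = λ {i} {j} {t} {t′} lt → via (λ d → t ≤ proj₁ d → t′ ≤ proj₁ d → Adj J (proj₂ d t) (proj₂ d t′) → t ≤ suc t′) lt (λ γ → at-adj γ)
      ; p-b-far = λ {i} {j} {t} {w} lt → via (λ d → 0 < t → t < proj₁ d → w ≢ i → w ≢ j → ¬ Near (proj₂ d t) (v w)) lt
          (λ γ pos t< w≢i w≢j near → proj₁ (interior-allowed γ pos t<) w w≢i w≢j
             (near-ball 1≤ρ (v∈A w) (allowed⊆A (at∈H γ (<⇒≤ t<))) (near-symm near)))
      ; p-p-far = λ lt lt′ ne → apart lt lt′ ne
      }
      where
      apart : ∀ {i j i′ j′ t t′} → toℕ i < toℕ j → toℕ i′ < toℕ j′ → i ≢ i′ ⊎ j ≢ j′ →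
        0 < t → t < proj₁ (path i j) → 0 < t′ → t′ < proj₁ (path i′ j′) → ¬ Near (proj₂ (path i j) t) (proj₂ (path i′ j′) t′)
      apart {t = t} {t′} lt lt′ ne with path-route lt | path-route lt′
      ... | m , e | m′ , e′ = subst₂ (λ d d′ → 0 < t → t < proj₁ d → 0 < t′ → t′ < proj₁ d′ → ¬ Near (proj₂ d t) (proj₂ d′ t′)) e e′
                                (separated P m m′ ne)

-- Average degree

module _ (J : Graph) where

  open Graphs J

  -- `numEdges` counts only pairs with u < v. Adding the transposed count never counts an ordered
  -- pair twice.
  2*numEdges≤e2 : 2 * numEdges J ≤ e2 full
  2*numEdges≤e2 = begin
    2 * numEdges J                                       ≡⟨ cong (2 *_) (trans (sumᴸ-allFin (λ u → sumᴸ (map (h u) (allFin (n J))))) (sum-cong-≗ (λ u → sumᴸ-allFin (h u)))) ⟩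
    2 * sum (λ u → sum (h u))                            ≡⟨ cong (λ x → sum (λ u → sum (h u)) + x) (+-identityʳ _) ⟩
    sum (λ u → sum (h u)) + sum (λ u → sum (h u))        ≡⟨ cong (λ x → sum (λ u → sum (h u)) + x) (sum-swap h) ⟩
    sum (λ u → sum (h u)) + sum (λ u → sum (λ v → h v u)) ≡⟨ sum-+ (λ u → sum (h u)) (λ u → sum (λ v → h v u)) ⟨
    sum (λ u → sum (h u) + sum (λ v → h v u))            ≡⟨ sum-cong-≗ (λ u → sym (sum-+ (h u) (λ v → h v u))) ⟩
    sum (λ u → sum (λ v → h u v + h v u))                ≤⟨ sum-mono (λ u → ≤-trans (sum-mono (pt u)) (≤-reflexive (unfold u))) ⟩
    e2 full                                              ∎
    where
    open ≤-Reasoning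
    h : V J → V J → ℕ
    h u v = 𝟙 (adj J u v ∧ ⌊ u Fin.<? v ⌋)
    opaque
      unfolding card
      unfold : ∀ u → sum (𝟙 ∘ nbrs full u) ≡ card (nbrs full u)
      unfold u = refl
    ∧⁻ : ∀ {x y} → x ∧ y ≡ true → x ≡ true × y ≡ true
    ∧⁻ {true} {true} _ = refl , refl
    <⁻ : ∀ {u v : V J} → ⌊ u Fin.<? v ⌋ ≡ true → u Fin.< v
    <⁻ {u} {v} e with u Fin.<? v
    ... | yes lt = lt
    pt : ∀ u v → h u v + h v u ≤ 𝟙 (nbrs full u v)
    pt u v = 𝟙-disjoint (λ e → nbrs⁺ {full} refl refl (proj₁ (∧⁻ e))) (λ e → nbrs⁺ {full} refl refl (adj-symm (proj₁ (∧⁻ e))))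
      (λ (e , e′) → <-asym (<⁻ {u} {v} (proj₂ (∧⁻ e))) (<⁻ {v} {u} (proj₂ (∧⁻ {adj J v u} e′))))

avgDeg≡ : ∀ J k → n J ≡ suc k → avgDeg J ≡ ℤ.+ (2 * numEdges J) ℚ./ suc k
avgDeg≡ record { n = suc _ } _ refl = refl

avgDeg-zero : ∀ J → n J ≡ 0 → avgDeg J ≡ 0ℚ
avgDeg-zero record { n = zero } refl = refl

-- The numerator of the positive rational is at least 1, so only its denominator is kept.
clear-denominators : ∀ {a k m e d-1} .{c : Coprime (suc m) (suc d-1)} → ℤ.+ a ℚ./ 1 ℚ.+ mkℚ (ℤ.+ suc m) d-1 c ℚ.< ℤ.+ e ℚ./ suc k →
                     (a * suc d-1 + 1) * suc k ≤ e * suc d-1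
clear-denominators {a} {k} {m} {e} {d-1} {c} h = ≤-trans
  (*-monoˡ-≤ (suc k) (+-monoʳ-≤ (a * suc d-1) {1} {suc m * 1} (s≤s z≤n)))
  (<⇒≤ (ℤ.drop‿+<+ (subst₂ ℤ._<_ left right (ℚᵘ.drop-*<* cleared))))
  where
  cleared : mkℚᵘ (ℤ.+ a) 0 ℚᵘ.+ mkℚᵘ (ℤ.+ suc m) d-1 ℚᵘ.< mkℚᵘ (ℤ.+ e) k
  cleared = ℚᵘ.<-respʳ-≃ (ℚ.toℚᵘ-fromℚᵘ (mkℚᵘ (ℤ.+ e) k)) (ℚᵘ.<-respˡ-≃ (ℚᵘ.≃-trans (ℚ.toℚᵘ-homo-+ (ℤ.+ a ℚ./ 1) (mkℚ (ℤ.+ suc m) d-1 c))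
              (ℚᵘ.+-congˡ (mkℚᵘ (ℤ.+ suc m) d-1) (ℚ.toℚᵘ-fromℚᵘ (mkℚᵘ (ℤ.+ a) 0)))) (ℚ.toℚᵘ-mono-< h))
  left : (ℤ.+ a ℤ.* ℤ.+ suc d-1 ℤ.+ ℤ.+ suc m ℤ.* ℤ.+ 1) ℤ.* ℤ.+ suc k ≡ ℤ.+ ((a * suc d-1 + suc m * 1) * suc k)
  left = trans (cong (ℤ._* ℤ.+ suc k) (trans (cong₂ ℤ._+_ (sym (ℤ.pos-* a (suc d-1))) (sym (ℤ.pos-* (suc m) 1))) (sym (ℤ.pos-+ (a * suc d-1) (suc m * 1)))))
               (sym (ℤ.pos-* (a * suc d-1 + suc m * 1) (suc k)))
  right : ℤ.+ e ℤ.* (ℤ.+ 1 ℤ.* ℤ.+ suc d-1) ≡ ℤ.+ (e * suc d-1)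
  right = trans (cong (ℤ.+ e ℤ.*_) (ℤ.*-identityˡ (ℤ.+ suc d-1))) (sym (ℤ.pos-* e (suc d-1)))

-- Doubling the denominator turns the excess 1/d into 2/q₂, so the whole graph reaches even the
-- limit of the thresholds.
heavy-full : ∀ J s₂ d-1 → 0 < n J → (s₂ * suc d-1 + 1) * n J ≤ 2 * numEdges J * suc d-1 →
             Density.Heavy J (2 * suc d-1) s₂ full
heavy-full J s₂ d-1 pos dense = ≤-trans pos (≤-reflexive (sym card-full)) , ≤-trans (*-monoʳ-≤ (κ (card {n J} full)) (begin
  c * card {n J} full                      ≡⟨ cong (c *_) card-full ⟩
  c * n J                                  ≡⟨ eq₁ (suc d-1) s₂ (n J) ⟩
  2 * ((s₂ * suc d-1 + 1) * n J)           ≤⟨ *-monoʳ-≤ 2 dense ⟩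
  2 * (2 * numEdges J * suc d-1)           ≡⟨ eq₂ (2 * numEdges J) (suc d-1) ⟩
  2 * suc d-1 * (2 * numEdges J)           ≤⟨ *-monoʳ-≤ (2 * suc d-1) (2*numEdges≤e2 J) ⟩
  2 * suc d-1 * e2 full                    ∎)) (m≤m+n _ _)
  where
  open ≤-Reasoning
  open Density J (2 * suc d-1) s₂ using (c)
  open Graphs J using (e2)
  eq₁ : ∀ q s x → (2 * q * s + 2) * x ≡ 2 * ((s * q + 1) * x)
  eq₁ = solve-∀
  eq₂ : ∀ e q → 2 * (e * q) ≡ 2 * q * e
  eq₂ = solve-∀

-- From a dense graph of large girth to the subdivision

heavy⇒subdivision : ∀ s₂ q₂ D → 2 ≤ s₂ → 1 ≤ q₂ → Σ ℕ λ g → ∀ J → MaxDegreeAtMost J D → GirthAtLeast J g →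
  Density.Heavy J q₂ s₂ full → ContainsInducedSubdivision J (K (2 + s₂))
heavy⇒subdivision s₂ q₂ D 2≤s₂ 1≤q₂ = girth-bound , found
  where
  E = length (pairs (2 + s₂))
  open Parameters q₂ s₂ D E 1≤q₂ 2≤s₂
  found : ∀ J → MaxDegreeAtMost J D → GirthAtLeast J girth-bound → Density.Heavy J q₂ s₂ full →
          ContainsInducedSubdivision J (K (2 + s₂))
  found J maxdeg girth heavy-J = Assembly.contains (layout (proj₂ plan))
    where
    core : Density.Core J q₂ s₂
    core = Density.core J q₂ s₂ full heavy-J
    open Density.Core-properties J q₂ s₂ core
    sc : Scales q₂ s₂ D E girth-bound ∣A∣
    sc = scales ∣A∣ (girth≤∣A∣ girth 2≤s₂ 1≤q₂)
    plan = route-all J maxdeg q₂ s₂ 1≤q₂ 2≤s₂ girth core sc (pairs (2 + s₂)) (pairs-simple (2 + s₂)) ≤-refl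
    open Extraction J maxdeg A (v J maxdeg q₂ s₂ 1≤q₂ 2≤s₂ girth core sc) (v∈A J maxdeg q₂ s₂ 1≤q₂ 2≤s₂ girth core sc)
      (Scales.ρ sc) (Scales.sep sc) (s≤s z≤n) (≤-trans (s≤s z≤n) (m≤n+m (Scales.ρ sc) _))
      (proj₂ (proj₂ (branching J maxdeg q₂ s₂ 1≤q₂ 2≤s₂ girth core sc)))

theorem1p5 : ∀ (s : ℕ) → 4 ≤ s → (η : ℚ) → 0ℚ ℚ.< η → (D : ℕ) → s ∸ 1 ≤ D →
    Σ ℕ λ g → ∀ (J : Graph) → MaxDegreeAtMost J D →
    ((ℤ.+ (s ∸ 2) ℚ./ 1) ℚ.+ η) ℚ.< avgDeg J → GirthAtLeast J g →
    ContainsInducedSubdivision J (K s)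
theorem1p5 (suc (suc s₂)) (s≤s (s≤s 2≤s₂)) (mkℚ (ℤ.+ zero) _ _) (*<* (ℤ.+<+ ())) D _
theorem1p5 (suc (suc s₂)) (s≤s (s≤s 2≤s₂)) η@(mkℚ (ℤ.+ suc m) d-1 c) _ D _ =
  proj₁ core , λ J maxdeg dense girth → proj₂ core J maxdeg girth (heavy J dense)
  where
  core = heavy⇒subdivision s₂ (2 * suc d-1) D 2≤s₂ (s≤s z≤n)
  heavy : ∀ J → (ℤ.+ s₂ ℚ./ 1) ℚ.+ η ℚ.< avgDeg J → Density.Heavy J (2 * suc d-1) s₂ full
  heavy J dense = by-order (n J) refl
    where
    by-order : ∀ k → n J ≡ k → Density.Heavy J (2 * suc d-1) s₂ full
    -- The empty graph has average degree 0, below any positive bound; the cleared inequality would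
    -- read `s₂ * suc d-1 + 1 ≤ 0`.
    by-order zero    e = ⊥-elim (<⇒≱ (m≤n+m 1 (s₂ * suc d-1)) (≤-trans (≤-reflexive (sym (*-identityʳ (s₂ * suc d-1 + 1)))) (clear-denominators {s₂} {0} {m} {0} {d-1} {c}
                           (subst (ℤ.+ s₂ ℚ./ 1 ℚ.+ η ℚ.<_) (avgDeg-zero J e) dense))))
    by-order (suc k) e = heavy-full J s₂ d-1 (subst (0 <_) (sym e) (s≤s z≤n)) (subst (λ x → (s₂ * suc d-1 + 1) * x ≤ 2 * numEdges J * suc d-1) (sym e)
                           (clear-denominators {s₂} {k} {m} {2 * numEdges J} {d-1} {c} (subst (ℤ.+ s₂ ℚ./ 1 ℚ.+ η ℚ.<_) (avgDeg≡ J k e) dense)))
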